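{- Let $p\ge 2$ be an integer. For $n,k\ge 0$ let $a_{n,k}$ be the number of elements of $\mathbb{F}_n^p$ having exactly $k$ upper covers in $\mathbb{F}_n^p$. Then $$\sum_{n\ge 0}\sum_{k\ge 0} a_{n,k}\,x^ny^k=\frac{(1-x)\bigl(1+(y-1)x^p\bigr)}{1-2x+x^{p+1}-(y-1)\bigl(x^2-x^p+x^{p+1}-x^{p+2}\bigr)}.$$
   Context: A Dyck path of semilength $n\ge 0$ is a lattice path from $(0,0)$ to $(2n,0)$ with steps $U=(1,1)$ and $D=(1,-1)$ that never goes below the $x$-axis; it is identified with its word over $\{U,D\}$ (the empty path is the unique one of semilength $0$). A path avoids a pattern $\alpha$ (a word over $\{U,D\}$) if $\alpha$ does not occur as a factor, i.e. as a block of consecutive steps. For an integer $p\ge 2$, $\mathcal{F}_n^p$ denotes the set of Dyck paths of semilength $n$ avoiding both $DUU$ and $D^{p+1}$. It is partially ordered by the Stanley order: $P\le Q$ iff the path $P$ lies weakly below the path $Q$ when both are drawn in the plane. $\mathbb{F}_n^p$ denotes the poset $(\mathcal{F}_n^p,\le)$. An upper cover of $P$ is an element $Q$ with $P<Q$ and no element strictly between them in $\mathbb{F}_n^p$. -}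

module Defs where

open import Data.Bool using (Bool; true; false; _∧_; _∨_; not; if_then_else_)
open import Data.Nat using (ℕ; zero; suc; _∸_) renaming (_*_ to _*ℕ_; _≡ᵇ_ to _==ℕ_)
open import Data.Integer using (ℤ; +_; 0ℤ; 1ℤ; _+_; _*_; -_; _≤ᵇ_)
open import Data.List using (List; []; _∷_; length; map; foldr; filterᵇ; replicate; upTo; zipWith)
open import Data.Bool.ListAction using (any; all)

data Step : Set where
  U D : Step

_==S_ : Step → Step → Bool
U ==S U = true
D ==S D = true
_ ==S _ = false

_==W_ : List Step → List Step → Bool
[] ==W [] = true
(a ∷ v) ==W (b ∷ w) = (a ==S b) ∧ (v ==W w)
_ ==W _ = false

words : ℕ → List (List Step)
words zero = [] ∷ []
words (suc m) = map (U ∷_) (words m) Data.List.++ map (D ∷_) (words m)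

dyckFrom : ℕ → List Step → Bool
dyckFrom zero [] = true
dyckFrom (suc h) [] = false
dyckFrom h (U ∷ w) = dyckFrom (suc h) w
dyckFrom zero (D ∷ w) = false
dyckFrom (suc h) (D ∷ w) = dyckFrom h w

isDyck : List Step → Bool
isDyck = dyckFrom zero

isPrefix : List Step → List Step → Bool
isPrefix [] _ = true
isPrefix (a ∷ α) [] = false
isPrefix (a ∷ α) (b ∷ w) = (a ==S b) ∧ isPrefix α w

occurs : List Step → List Step → Bool
occurs α [] = isPrefix α []
occurs α (b ∷ w) = isPrefix α (b ∷ w) ∨ occurs α w

DUU : List Step
DUU = D ∷ U ∷ U ∷ []

𝓕 : ℕ → ℕ → List (List Step)
𝓕 p n = filterᵇ (λ w → isDyck w ∧ not (occurs DUU w) ∧ not (occurs (replicate (suc p) D) w))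
                (words (2 *ℕ n))

heights : ℤ → List Step → List ℤ
heights h [] = []
heights h (U ∷ w) = (h + 1ℤ) ∷ heights (h + 1ℤ) w
heights h (D ∷ w) = (h + - 1ℤ) ∷ heights (h + - 1ℤ) w

-- P ≤ Q in Stanley order (P weakly below Q); used on paths of equal length
_≤St_ : List Step → List Step → Bool
P ≤St Q = all (λ b → b) (zipWith _≤ᵇ_ (heights 0ℤ P) (heights 0ℤ Q))

_<St_ : List Step → List Step → Bool
P <St Q = (P ≤St Q) ∧ not (P ==W Q)

upperCovers : List (List Step) → List Step → List (List Step)
upperCovers S P = filterᵇ (λ Q → (P <St Q) ∧ not (any (λ R → (P <St R) ∧ (R <St Q)) S)) S

a : ℕ → ℕ → ℕ → ℕ
a p n k = length (filterᵇ (λ P → length (upperCovers (𝓕 p n) P) ==ℕ k) (𝓕 p n))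

-- Formal power series in x, y with integer coefficients:
-- s n k is the coefficient of xⁿ yᵏ.

Ser : Set
Ser = ℕ → ℕ → ℤ

sumℤ : List ℤ → ℤ
sumℤ = foldr _+_ 0ℤ

_⊕_ : Ser → Ser → Ser
(f ⊕ g) n k = f n k + g n k

⊝_ : Ser → Ser
(⊝ f) n k = - f n k

_⊖_ : Ser → Ser → Ser
f ⊖ g = f ⊕ (⊝ g)

_⊛_ : Ser → Ser → Ser
(f ⊛ g) n k = sumℤ (map (λ i → sumℤ (map (λ j → f i j * g (n ∸ i) (k ∸ j)) (upTo (suc k)))) (upTo (suc n)))

𝟙 : Ser
𝟙 zero zero = 1ℤ
𝟙 _ _ = 0ℤ

𝕏 : Ser
𝕏 (suc zero) zero = 1ℤ
𝕏 _ _ = 0ℤ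

𝕐 : Ser
𝕐 zero (suc zero) = 1ℤ
𝕐 _ _ = 0ℤ

_^ˢ_ : Ser → ℕ → Ser
f ^ˢ zero = 𝟙
f ^ˢ suc m = f ⊛ (f ^ˢ m)

GF : ℕ → Ser
GF p n k = + a p n k

Num : ℕ → Ser
Num p = (𝟙 ⊖ 𝕏) ⊛ (𝟙 ⊕ ((𝕐 ⊖ 𝟙) ⊛ (𝕏 ^ˢ p)))

Den : ℕ → Ser
Den p = ((𝟙 ⊖ (𝕏 ⊕ 𝕏)) ⊕ (𝕏 ^ˢ suc p))
        ⊖ ((𝕐 ⊖ 𝟙) ⊛ ((((𝕏 ^ˢ 2) ⊖ (𝕏 ^ˢ p)) ⊕ (𝕏 ^ˢ suc p)) ⊖ (𝕏 ^ˢ suc (suc p))))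

-- A path of 𝓕ₙᵖ is determined by its gaps g 0, …, g n, the lengths of the runs of D's around its
-- n U's.  Avoiding DUU makes the nonzero gaps a final block and avoiding D^(p+1) bounds them by p,
-- so reading the nonzero gaps gives a bijection with the compositions of n into parts from
-- [1, p] (the Dyck condition then holds automatically).  In terms of gaps the Stanley order compares
-- partial sums, and the upper covers of a path are the moves of one D from a run to the next one
-- (a valley DU becomes a peak UD), allowed when the source run is ≥ 2 or is the first nonzero
-- run and the target run stays ≤ p.  Building compositions by appending parts, a new cover appears
-- exactly when the last part is ≥ 2 (or the only part) and the new part is < p; this gives linear
-- equations for the generating functions of the two kinds of compositions, and eliminating them
-- yields the rational function.

module Submission where

open import Defs
open import Data.Nat using (ℕ; _≤_)
open import Relation.Binary.PropositionalEquality using (_≡_)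

module BoolFacts where

  open import Data.Nat using (zero; suc; _≤_; _<_; _≤ᵇ_)
  open import Data.Nat.Properties using (≤ᵇ⇒≤; ≤⇒≤ᵇ; ≰⇒>; <⇒≱)
  open import Data.Bool using (true; false; _∧_; _∨_; not; T)
  open import Data.Product using (_×_; _,_)
  open import Data.Empty using (⊥-elim)
  open import Relation.Binary.PropositionalEquality
  open import Function using (case_of_)

  true≢false : true ≢ false
  true≢false ()

  false≢true : false ≢ true
  false≢true ()

  ∧-true⁻ : ∀ {a b} → (a ∧ b) ≡ true → a ≡ true × b ≡ true
  ∧-true⁻ {true} {true} _ = refl , refl

  ∧-true⁺ : ∀ {a b} → a ≡ true → b ≡ true → (a ∧ b) ≡ true
  ∧-true⁺ refl refl = refl

  ∨-false⁻ : ∀ {a b} → (a ∨ b) ≡ false → a ≡ false × b ≡ false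
  ∨-false⁻ {false} {false} _ = refl , refl

  ∨-false⁺ : ∀ {a b} → a ≡ false → b ≡ false → (a ∨ b) ≡ false
  ∨-false⁺ refl refl = refl

  not-true⁻ : ∀ {a} → not a ≡ true → a ≡ false
  not-true⁻ {false} _ = refl

  not-true⁺ : ∀ {a} → a ≡ false → not a ≡ true
  not-true⁺ refl = refl

  ≤ᵇ-true⁻ : ∀ m n → (m ≤ᵇ n) ≡ true → m ≤ n
  ≤ᵇ-true⁻ m n e = ≤ᵇ⇒≤ m n (subst T (sym e) _)

  ≤ᵇ-true⁺ : ∀ {m n} → m ≤ n → (m ≤ᵇ n) ≡ true
  ≤ᵇ-true⁺ {m} {n} le with m ≤ᵇ n | ≤⇒≤ᵇ le
  ... | true | _ = refl

  ≤ᵇ-false⁻ : ∀ m n → (m ≤ᵇ n) ≡ false → n < m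
  ≤ᵇ-false⁻ m n e = ≰⇒> (λ le → case trans (sym (≤ᵇ-true⁺ le)) e of λ ())

  ≤ᵇ-false⁺ : ∀ {m n} → n < m → (m ≤ᵇ n) ≡ false
  ≤ᵇ-false⁺ {m} {n} lt with m ≤ᵇ n in eq
  ... | true = ⊥-elim (<⇒≱ lt (≤ᵇ-true⁻ m n eq))
  ... | false = refl

  ≤ᵇ-suc : ∀ j a → (suc j ≤ᵇ suc a) ≡ (j ≤ᵇ a)
  ≤ᵇ-suc zero a = refl
  ≤ᵇ-suc (suc j) a = refl

module NatSearch where

  open import Data.Nat as ℕ using (ℕ; zero; suc; _<_; s≤s)
  import Data.Nat.Properties as ℕₚ
  open import Data.Product using (_×_; _,_; ∃)
  open import Data.Sum using (_⊎_; inj₁; inj₂)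
  open import Data.Empty using (⊥; ⊥-elim)
  open import Relation.Nullary using (¬_; Dec; yes; no)
  open import Relation.Binary.PropositionalEquality using (refl)

  first-below : ∀ (P : ℕ → Set) → (∀ i → Dec (P i)) → ∀ b → (∀ i → i < b → ¬ P i) ⊎ ∃
      (λ k → k < b × P k × (∀ i → i < k → ¬ P i))
  first-below P d zero = inj₁ (λ i ())
  first-below P d (suc b) with first-below P d b
  ... | inj₂ (k , lt , pk , mk) = inj₂ (k , ℕₚ.m<n⇒m<1+n lt , pk , mk)
  ... | inj₁ none with d b
  ...   | yes pb = inj₂ (b , ℕₚ.n<1+n b , pb , none)
  ...   | no ¬pb = inj₁ (λ i lt pi → case i lt pi)
    where
    case : ∀ i → i < suc b → P i → ⊥
    case i (s≤s le) pi with i ℕ.≟ b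
    ... | yes refl = ¬pb pi
    ... | no ne = none i (ℕₚ.≤∧≢⇒< le ne) pi

  least : ∀ (P : ℕ → Set) → (∀ i → Dec (P i)) → ∀ m → P m → ∃ (λ k → P k × (∀ i → i < k → ¬ P i))
  least P d m pm with first-below P d (suc m)
  ... | inj₁ none = ⊥-elim (none m (ℕₚ.n<1+n m) pm)
  ... | inj₂ (k , _ , pk , mk) = k , pk , mk

module Counting where

  open import Data.Nat using (ℕ; zero; suc; _+_; _≤_; z≤n; s≤s)
  open import Data.Nat.Properties using (+-assoc; +-comm; +-suc; ≤-antisym)
  open import Data.Bool using (Bool; true; false; _∧_; not; if_then_else_; T)
  open import Data.Bool.ListAction using (any)
  open import Data.List using (List; []; _∷_; map; _++_; length; filterᵇ)
  open import Data.List.Properties using (length-++; length-map)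
  open import Data.List.Membership.Propositional using (_∈_)
  open import Data.List.Membership.Propositional.Properties using (∈-++⁺ˡ; ∈-++⁺ʳ; ∈-++⁻; ∈-∃++; ∈-filter⁺; ∈-filter⁻)
  open import Data.List.Relation.Unary.Any using (here; there)
  open import Data.List.Relation.Unary.All as All using (All; []; _∷_)
  open import Data.List.Relation.Unary.AllPairs using ([]; _∷_)
  open import Data.List.Relation.Unary.Unique.Propositional using (Unique)
  import Data.List.Relation.Unary.Unique.Propositional.Properties as Unique
  open import Data.Product using (_×_; _,_)
  open import Data.Sum using (inj₁; inj₂)
  open import Data.Empty using (⊥-elim)
  open import Relation.Nullary.Decidable using (T?)
  open import Relation.Binary.PropositionalEquality

  private variable
    A B : Set

  toℕ : Bool → ℕ
  toℕ true = 1
  toℕ false = 0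

  countᵇ : (A → Bool) → List A → ℕ
  countᵇ Q [] = 0
  countᵇ Q (x ∷ xs) = toℕ (Q x) + countᵇ Q xs

  length-filterᵇ : ∀ (Q : A → Bool) xs → length (filterᵇ Q xs) ≡ countᵇ Q xs
  length-filterᵇ Q [] = refl
  length-filterᵇ Q (x ∷ xs) with Q x
  ... | true = cong suc (length-filterᵇ Q xs)
  ... | false = length-filterᵇ Q xs

  countᵇ-++ : ∀ (Q : A → Bool) xs flippableIndices → countᵇ Q (xs ++ flippableIndices) ≡ countᵇ Q xs + countᵇ
      Q flippableIndices
  countᵇ-++ Q [] flippableIndices = refl
  countᵇ-++ Q (x ∷ xs) flippableIndices = trans (cong (toℕ (Q x) +_) (countᵇ-++ Q xs flippableIndices))
      (sym (+-assoc (toℕ (Q x)) _ _))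

  countᵇ-map : ∀ (Q : B → Bool) (f : A → B) xs → countᵇ Q (map f xs) ≡ countᵇ (λ x → Q (f x)) xs
  countᵇ-map Q f [] = refl
  countᵇ-map Q f (x ∷ xs) = cong (toℕ (Q (f x)) +_) (countᵇ-map Q f xs)

  countᵇ-cong-∈ : ∀ {Q Q' : A → Bool} xs → (∀ {x} → x ∈ xs → Q x ≡ Q' x) → countᵇ Q xs ≡ countᵇ Q' xs
  countᵇ-cong-∈ [] h = refl
  countᵇ-cong-∈ (x ∷ xs) h = cong₂ _+_ (cong toℕ (h (here refl))) (countᵇ-cong-∈ xs (λ m → h (there m)))

  countᵇ-cong : ∀ {Q Q' : A → Bool} xs → (∀ x → Q x ≡ Q' x) → countᵇ Q xs ≡ countᵇ Q' xs
  countᵇ-cong xs h = countᵇ-cong-∈ xs (λ {x} _ → h x)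

  countᵇ-split : ∀ (Q R : A → Bool) xs →
    countᵇ Q xs ≡ countᵇ (λ x → Q x ∧ R x) xs + countᵇ (λ x → Q x ∧ not (R x)) xs
  countᵇ-split Q R [] = refl
  countᵇ-split Q R (x ∷ xs) =
    trans (cong₂ _+_ (split (Q x) (R x)) (countᵇ-split Q R xs)) (interchange (toℕ (Q x ∧ R x)) _ _ _)
    where
    split : ∀ a b → toℕ a ≡ toℕ (a ∧ b) + toℕ (a ∧ not b)
    split true true = refl
    split true false = refl
    split false b = refl
    interchange : ∀ a b c d → (a + b) + (c + d) ≡ (a + c) + (b + d)
    interchange a b c d = begin
      (a + b) + (c + d)  ≡⟨ +-assoc a b (c + d) ⟩
      a + (b + (c + d))  ≡⟨ cong (a +_) (trans (sym (+-assoc b c d)) (cong (_+ d) (+-comm b c))) ⟩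
      a + ((c + b) + d)  ≡⟨ cong (a +_) (+-assoc c b d) ⟩
      a + (c + (b + d))  ≡⟨ sym (+-assoc a c (b + d)) ⟩
      (a + c) + (b + d)  ∎
      where open ≡-Reasoning

  countᵇ-none : ∀ (Q : A → Bool) xs → (∀ x → Q x ≡ false) → countᵇ Q xs ≡ 0
  countᵇ-none Q [] h = refl
  countᵇ-none Q (x ∷ xs) h rewrite h x = countᵇ-none Q xs h

  countᵇ-const∧ : ∀ b (R : A → Bool) xs → countᵇ (λ x → b ∧ R x) xs ≡ (if b then countᵇ R xs else 0)
  countᵇ-const∧ true R xs = refl
  countᵇ-const∧ false R xs = countᵇ-none (λ _ → false) xs (λ _ → refl)

  any-true : ∀ (Q : A → Bool) {x} xs → x ∈ xs → Q x ≡ true → any Q xs ≡ true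
  any-true Q (y ∷ xs) (here refl) e rewrite e = refl
  any-true Q (y ∷ xs) (there m) e with Q y
  ... | true = refl
  ... | false = any-true Q xs m e

  any-false : ∀ (Q : A → Bool) xs → (∀ {x} → x ∈ xs → Q x ≡ false) → any Q xs ≡ false
  any-false Q [] h = refl
  any-false Q (y ∷ xs) h rewrite h (here refl) = any-false Q xs (λ m → h (there m))

  Σℕ : ℕ → (ℕ → ℕ) → ℕ
  Σℕ zero g = 0
  Σℕ (suc c) g = g 0 + Σℕ c (λ i → g (suc i))

  Σℕ-cong : ∀ c {g h : ℕ → ℕ} → (∀ i → g i ≡ h i) → Σℕ c g ≡ Σℕ c h
  Σℕ-cong zero e = refl
  Σℕ-cong (suc c) e = cong₂ _+_ (e 0) (Σℕ-cong c (λ i → e (suc i)))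

  Σℕ-zero : ∀ c {g : ℕ → ℕ} → (∀ i → g i ≡ 0) → Σℕ c g ≡ 0
  Σℕ-zero zero h = refl
  Σℕ-zero (suc c) h rewrite h 0 = Σℕ-zero c (λ i → h (suc i))

  ∈-filterᵇ⁺ : ∀ (Q : A → Bool) {x xs} → x ∈ xs → Q x ≡ true → x ∈ filterᵇ Q xs
  ∈-filterᵇ⁺ Q {x} m e = ∈-filter⁺ (λ a → T? (Q a)) m (subst T (sym e) _)

  ∈-filterᵇ⁻ : ∀ (Q : A → Bool) {x xs} → x ∈ filterᵇ Q xs → x ∈ xs × Q x ≡ true
  ∈-filterᵇ⁻ Q {x} {xs} m with ∈-filter⁻ (λ a → T? (Q a)) {xs = xs} m
  ... | m′ , t with Q x
  ...   | true = m′ , refl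

  unique-filterᵇ : ∀ (Q : A → Bool) {xs} → Unique xs → Unique (filterᵇ Q xs)
  unique-filterᵇ Q = Unique.filter⁺ (λ a → T? (Q a))

  unique-map-injectiveOn : ∀ (f : A → B) xs → (∀ {x y} → x ∈ xs → y ∈ xs → f x ≡ f y → x ≡ y) →
    Unique xs → Unique (map f xs)
  unique-map-injectiveOn f [] inj u = []
  unique-map-injectiveOn f (x ∷ xs) inj (x∉xs ∷ u) =
    distinct xs x∉xs there ∷ unique-map-injectiveOn f xs (λ mx my → inj (there mx) (there my)) u
    where
    distinct : ∀ flippableIndices → All (x ≢_) flippableIndices → (∀ {y} → y ∈ flippableIndices → y ∈ x ∷ xs)
        → All (f x ≢_) (map f flippableIndices)
    distinct [] [] _ = []
    distinct (y ∷ flippableIndices) (x≢y ∷ x≢ys) ⊆ =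
      (λ eq → x≢y (inj (here refl) (⊆ (here refl)) eq)) ∷ distinct flippableIndices x≢ys (λ m → ⊆ (there m))

  length-≤-Unique : ∀ (xs flippableIndices : List A) → Unique xs → (∀ {a} → a ∈ xs → a ∈ flippableIndices) →
      length xs ≤ length flippableIndices
  length-≤-Unique [] flippableIndices u ⊆ = z≤n
  length-≤-Unique (x ∷ xs) flippableIndices (x∉xs ∷ u) ⊆ with ∈-∃++ (⊆ (here refl))
  ... | ys₁ , ys₂ , refl =
    subst (suc (length xs) ≤_) (sym (trans (length-++ ys₁) (+-suc (length ys₁) (length ys₂))))
      (s≤s (subst (length xs ≤_) (length-++ ys₁) (length-≤-Unique xs (ys₁ ++ ys₂) u ⊆′)))
    where
    ⊆′ : ∀ {a} → a ∈ xs → a ∈ ys₁ ++ ys₂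
    ⊆′ {a} m with ∈-++⁻ ys₁ (⊆ (there m))
    ... | inj₁ m₁ = ∈-++⁺ˡ m₁
    ... | inj₂ (here refl) = ⊥-elim (All.lookup x∉xs m refl)
    ... | inj₂ (there m₂) = ∈-++⁺ʳ ys₁ m₂

  length-≡-Unique : ∀ (xs flippableIndices : List A) → Unique xs → Unique flippableIndices →
    (∀ {a} → a ∈ xs → a ∈ flippableIndices) → (∀ {a} → a ∈ flippableIndices → a ∈ xs) → length xs ≡ length
        flippableIndices
  length-≡-Unique xs flippableIndices ux uy ⊆ ⊇ = ≤-antisym (length-≤-Unique xs flippableIndices ux ⊆)
      (length-≤-Unique flippableIndices xs uy ⊇)

  length-image : ∀ (xs : List A) (f : B → A) flippableIndices → Unique xs → Unique (map f flippableIndices) →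
    (∀ {a} → a ∈ xs → a ∈ map f flippableIndices) → (∀ {a} → a ∈ map f flippableIndices → a ∈ xs) → length xs
        ≡ length flippableIndices
  length-image xs f flippableIndices ux uy ⊆ ⊇ = trans (length-≡-Unique xs (map f flippableIndices) ux uy ⊆ ⊇)
      (length-map f flippableIndices)

  countᵇ-image : ∀ (Q : A → Bool) xs (f : B → A) flippableIndices → Unique xs → Unique (map f flippableIndices) →
    (∀ {a} → a ∈ xs → a ∈ map f flippableIndices) → (∀ {a} → a ∈ map f flippableIndices → a ∈ xs) →
    countᵇ Q xs ≡ countᵇ (λ y → Q (f y)) flippableIndices
  countᵇ-image Q xs f flippableIndices ux uy ⊆ ⊇ = begin
    countᵇ Q xs                      ≡⟨ sym (length-filterᵇ Q xs) ⟩
    length (filterᵇ Q xs)            ≡⟨ length-≡-Unique (filterᵇ Q xs) (filterᵇ Q (map f flippableIndices))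
                                          (unique-filterᵇ Q ux) (unique-filterᵇ Q uy) (restrict ⊆) (restrict ⊇) ⟩
    length (filterᵇ Q (map f flippableIndices))    ≡⟨ length-filterᵇ Q (map f flippableIndices) ⟩
    countᵇ Q (map f flippableIndices)              ≡⟨ countᵇ-map Q f flippableIndices ⟩
    countᵇ (λ y → Q (f y)) flippableIndices        ∎
    where
    open ≡-Reasoning
    restrict : ∀ {us vs} → (∀ {a} → a ∈ us → a ∈ vs) → ∀ {a} → a ∈ filterᵇ Q us → a ∈ filterᵇ Q vs
    restrict ⊆′ m with ∈-filterᵇ⁻ Q m
    ... | m′ , e = ∈-filterᵇ⁺ Q (⊆′ m′) e

module IntegerSums where

  open import Data.Nat as ℕ using (ℕ; zero; suc; _∸_; z≤n; s≤s) renaming (_<_ to _<ℕ_)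
  import Data.Nat.Properties as ℕₚ
  open import Data.Integer using (ℤ; 0ℤ; _+_; _*_; -_)
  open import Data.Integer.Properties
  open import Data.List using (map; upTo; applyUpTo)
  open import Data.Integer.Tactic.RingSolver using (solve-∀)
  open import Relation.Binary.PropositionalEquality

  +-interchange : ∀ a b c d → (a + b) + (c + d) ≡ (a + c) + (b + d)
  +-interchange = solve-∀

  Σℤ : ℕ → (ℕ → ℤ) → ℤ
  Σℤ zero f = 0ℤ
  Σℤ (suc n) f = f 0 + Σℤ n (λ i → f (suc i))

  sumℤ-applyUpTo : ∀ (f : ℕ → ℤ) g n → sumℤ (map f (applyUpTo g n)) ≡ Σℤ n (λ i → f (g i))
  sumℤ-applyUpTo f g zero = refl
  sumℤ-applyUpTo f g (suc n) = cong (_+_ (f (g 0))) (sumℤ-applyUpTo f (λ i → g (suc i)) n)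

  sumℤ-upTo : ∀ (f : ℕ → ℤ) n → sumℤ (map f (upTo n)) ≡ Σℤ n f
  sumℤ-upTo f n = sumℤ-applyUpTo f (λ i → i) n

  Σℤ-cong< : ∀ n {f g : ℕ → ℤ} → (∀ i → i <ℕ n → f i ≡ g i) → Σℤ n f ≡ Σℤ n g
  Σℤ-cong< zero h = refl
  Σℤ-cong< (suc n) h = cong₂ _+_ (h 0 (s≤s z≤n)) (Σℤ-cong< n (λ i lt → h (suc i) (s≤s lt)))

  Σℤ-cong : ∀ n {f g : ℕ → ℤ} → (∀ i → f i ≡ g i) → Σℤ n f ≡ Σℤ n g
  Σℤ-cong n h = Σℤ-cong< n (λ i _ → h i)

  Σℤ-zero : ∀ n {f : ℕ → ℤ} → (∀ i → f i ≡ 0ℤ) → Σℤ n f ≡ 0ℤ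
  Σℤ-zero zero h = refl
  Σℤ-zero (suc n) h = cong₂ _+_ (h 0) (Σℤ-zero n (λ i → h (suc i)))

  Σℤ-+ : ∀ n (f g : ℕ → ℤ) → Σℤ n (λ i → f i + g i) ≡ Σℤ n f + Σℤ n g
  Σℤ-+ zero f g = refl
  Σℤ-+ (suc n) f g = trans (cong (_+_ (f 0 + g 0)) (Σℤ-+ n (λ i → f (suc i)) (λ i → g (suc i))))
      (+-interchange (f 0) (g 0) _ _)

  Σℤ-*ˡ : ∀ n (c : ℤ) (f : ℕ → ℤ) → Σℤ n (λ i → c * f i) ≡ c * Σℤ n f
  Σℤ-*ˡ zero c f = sym (*-zeroʳ c)
  Σℤ-*ˡ (suc n) c f = trans (cong (_+_ (c * f 0)) (Σℤ-*ˡ n c (λ i → f (suc i)))) (sym (*-distribˡ-+ c (f 0) _))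

  Σℤ-*ʳ : ∀ n (c : ℤ) (f : ℕ → ℤ) → Σℤ n (λ i → f i * c) ≡ Σℤ n f * c
  Σℤ-*ʳ n c f = trans (Σℤ-cong n (λ i → *-comm (f i) c)) (trans (Σℤ-*ˡ n c f) (*-comm c _))

  Σℤ-neg : ∀ n (f : ℕ → ℤ) → Σℤ n (λ i → - f i) ≡ - Σℤ n f
  Σℤ-neg zero f = refl
  Σℤ-neg (suc n) f = trans (cong (_+_ (- f 0)) (Σℤ-neg n (λ i → f (suc i)))) (sym (neg-distrib-+ (f 0) _))

  Σℤ-last : ∀ n (f : ℕ → ℤ) → Σℤ (suc n) f ≡ Σℤ n f + f n
  Σℤ-last zero f = trans (+-identityʳ (f 0)) (sym (+-identityˡ (f 0)))
  Σℤ-last (suc n) f = begin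
      f 0 + Σℤ (suc n) (λ i → f (suc i))
    ≡⟨ cong (_+_ (f 0)) (Σℤ-last n (λ i → f (suc i))) ⟩
      f 0 + (Σℤ n (λ i → f (suc i)) + f (suc n))
    ≡⟨ sym (+-assoc (f 0) _ _) ⟩
      (f 0 + Σℤ n (λ i → f (suc i))) + f (suc n)
    ∎ where open ≡-Reasoning

  Σℤ-swap : ∀ m n (F : ℕ → ℕ → ℤ) → Σℤ m (λ i → Σℤ n (λ j → F i j)) ≡ Σℤ n (λ j → Σℤ m (λ i → F i j))
  Σℤ-swap zero n F = sym (Σℤ-zero n (λ _ → refl))
  Σℤ-swap (suc m) n F = begin
      Σℤ n (λ j → F 0 j) + Σℤ m (λ i → Σℤ n (λ j → F (suc i) j))
    ≡⟨ cong (_+_ (Σℤ n (λ j → F 0 j))) (Σℤ-swap m n (λ i j → F (suc i) j)) ⟩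
      Σℤ n (λ j → F 0 j) + Σℤ n (λ j → Σℤ m (λ i → F (suc i) j))
    ≡⟨ sym (Σℤ-+ n (λ j → F 0 j) (λ j → Σℤ m (λ i → F (suc i) j))) ⟩
      Σℤ n (λ j → F 0 j + Σℤ m (λ i → F (suc i) j))
    ∎ where open ≡-Reasoning

  Σℤ-reverse : ∀ n (f : ℕ → ℤ) → Σℤ n f ≡ Σℤ n (λ i → f (n ∸ suc i))
  Σℤ-reverse zero f = refl
  Σℤ-reverse (suc n) f = begin
      f 0 + Σℤ n (λ i → f (suc i))
    ≡⟨ cong (_+_ (f 0)) (Σℤ-reverse n (λ i → f (suc i))) ⟩
      f 0 + Σℤ n (λ i → f (suc (n ∸ suc i)))
    ≡⟨ +-comm (f 0) _ ⟩
      Σℤ n (λ i → f (suc (n ∸ suc i))) + f 0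
    ≡⟨ cong₂ _+_ (Σℤ-cong< n (λ i lt → cong f (sym (ℕₚ.+-∸-assoc 1 lt)))) (cong f (sym (ℕₚ.n∸n≡0 n))) ⟩
      Σℤ n (λ i → f (suc n ∸ suc i)) + f (n ∸ n)
    ≡⟨ sym (Σℤ-last n (λ i → f (suc n ∸ suc i))) ⟩
      Σℤ (suc n) (λ i → f (suc n ∸ suc i))
    ∎ where open ≡-Reasoning

  Σℤ-triangle : ∀ N (F : ℕ → ℕ → ℤ) →
    Σℤ N (λ i → Σℤ (suc i) (λ i' → F i' i)) ≡ Σℤ N (λ i' → Σℤ (N ∸ i') (λ u → F i' (i' ℕ.+ u)))
  Σℤ-triangle zero F = refl
  Σℤ-triangle (suc N) F = begin
      Σℤ (suc N) (λ i → Σℤ (suc i) (λ i' → F i' i))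
    ≡⟨ Σℤ-last N _ ⟩
      Σℤ N (λ i → Σℤ (suc i) (λ i' → F i' i)) + Σℤ (suc N) (λ i' → F i' N)
    ≡⟨ cong (λ zz → zz + Σℤ (suc N) (λ i' → F i' N)) (Σℤ-triangle N F) ⟩
      Σℤ N (λ i' → Σℤ (N ∸ i') (λ u → F i' (i' ℕ.+ u))) + Σℤ (suc N) (λ i' → F i' N)
    ≡⟨ cong (λ zz → zz + Σℤ (suc N) (λ i' → F i' N)) lastz ⟩
      Σℤ (suc N) (λ i' → Σℤ (N ∸ i') (λ u → F i' (i' ℕ.+ u))) + Σℤ (suc N) (λ i' → F i' N)
    ≡⟨ sym (Σℤ-+ (suc N) G (λ i' → F i' N)) ⟩
      Σℤ (suc N) (λ i' → Σℤ (N ∸ i') (λ u → F i' (i' ℕ.+ u)) + F i' N)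
    ≡⟨ Σℤ-cong< (suc N) (λ i' lt → step i' lt) ⟩
      Σℤ (suc N) (λ i' → Σℤ (suc N ∸ i') (λ u → F i' (i' ℕ.+ u)))
    ∎ where
    open ≡-Reasoning
    G : ℕ → ℤ
    G i' = Σℤ (N ∸ i') (λ u → F i' (i' ℕ.+ u))
    lastz : Σℤ N G ≡ Σℤ (suc N) G
    lastz = trans (sym (+-identityʳ (Σℤ N G)))
        (trans (cong (λ m → Σℤ N G + Σℤ m (λ u → F N (N ℕ.+ u))) (sym (ℕₚ.n∸n≡0 N))) (sym (Σℤ-last N G)))
    step : ∀ i' → i' <ℕ suc N → Σℤ (N ∸ i') (λ u → F i' (i' ℕ.+ u)) + F i' N ≡ Σℤ (suc N ∸ i') (λ u → F i' (i' ℕ.+ u))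
    step i' (s≤s le) = begin
        Σℤ (N ∸ i') (λ u → F i' (i' ℕ.+ u)) + F i' N
      ≡⟨ cong (λ z → Σℤ (N ∸ i') (λ u → F i' (i' ℕ.+ u)) + F i' z) (sym (ℕₚ.m+[n∸m]≡n le)) ⟩
        Σℤ (N ∸ i') (λ u → F i' (i' ℕ.+ u)) + F i' (i' ℕ.+ (N ∸ i'))
      ≡⟨ sym (Σℤ-last (N ∸ i') _) ⟩
        Σℤ (suc (N ∸ i')) (λ u → F i' (i' ℕ.+ u))
      ≡⟨ cong (λ m → Σℤ m (λ u → F i' (i' ℕ.+ u))) (sym (ℕₚ.+-∸-assoc 1 le)) ⟩
        Σℤ (suc N ∸ i') (λ u → F i' (i' ℕ.+ u))
      ∎

module PowerSeries where

  open IntegerSums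
  open import Data.Nat as ℕ using (ℕ; zero; suc; _∸_; s≤s; _≤ᵇ_) renaming (_≤_ to _≤ℕ_; _<_ to _<ℕ_)
  import Data.Nat.Properties as ℕₚ
  open import Data.Bool using (if_then_else_)
  open import Data.Integer using (ℤ; 0ℤ; 1ℤ; _+_; _*_; -_)
  open import Data.Integer.Properties
  open import Data.Integer.Tactic.RingSolver using (solve-∀)
  open import Data.List using (map; upTo)
  open import Data.Maybe using (Maybe; just; nothing)
  open import Data.Product using (_,_)
  open import Algebra.Bundles using (CommutativeRing)
  open import Algebra.Solver.Ring.AlmostCommutativeRing using
      (AlmostCommutativeRing; fromCommutativeRing; _-Raw-AlmostCommutative⟶_)
  open import Relation.Nullary using (yes; no)
  open import Relation.Binary.PropositionalEquality

  infix 4 _≋_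
  _≋_ : Ser → Ser → Set
  f ≋ g = ∀ n k → f n k ≡ g n k

  ≋-refl : ∀ {f} → f ≋ f
  ≋-refl n k = refl

  ≋-sym : ∀ {f g} → f ≋ g → g ≋ f
  ≋-sym e n k = sym (e n k)

  ≋-trans : ∀ {f g h} → f ≋ g → g ≋ h → f ≋ h
  ≋-trans e e' n k = trans (e n k) (e' n k)

  ⊕-cong : ∀ {a a' b b'} → a ≋ a' → b ≋ b' → (a ⊕ b) ≋ (a' ⊕ b')
  ⊕-cong e e' n k = cong₂ _+_ (e n k) (e' n k)

  ⊝-cong : ∀ {a a'} → a ≋ a' → (⊝ a) ≋ (⊝ a')
  ⊝-cong e n k = cong -_ (e n k)

  ⊖-cong : ∀ {a a' b b'} → a ≋ a' → b ≋ b' → (a ⊖ b) ≋ (a' ⊖ b')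
  ⊖-cong e e' = ⊕-cong e (⊝-cong e')

  conv : Ser → Ser → Ser
  conv f g n k = Σℤ (suc n) (λ i → Σℤ (suc k) (λ j → f i j * g (n ∸ i) (k ∸ j)))

  ⊛≋conv : ∀ f g → (f ⊛ g) ≋ conv f g
  ⊛≋conv f g n k = trans (sumℤ-upTo (λ i → sumℤ (map (λ j → f i j * g (n ∸ i) (k ∸ j)) (upTo (suc k))))
      (suc n)) (Σℤ-cong (suc n) (λ i → sumℤ-upTo (λ j → f i j * g (n ∸ i) (k ∸ j)) (suc k)))

  conv-cong : ∀ {f f' g g'} → f ≋ f' → g ≋ g' → conv f g ≋ conv f' g'
  conv-cong ef eg n k = Σℤ-cong (suc n) (λ i → Σℤ-cong (suc k) (λ j → cong₂ _*_ (ef i j) (eg (n ∸ i) (k ∸ j))))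

  conv-comm : ∀ f g → conv f g ≋ conv g f
  conv-comm f g n k = begin
      Σℤ (suc n) (λ i → Σℤ (suc k) (λ j → f i j * g (n ∸ i) (k ∸ j)))
    ≡⟨ Σℤ-reverse (suc n) (λ i → Σℤ (suc k) (λ j → f i j * g (n ∸ i) (k ∸ j))) ⟩
      Σℤ (suc n) (λ i → Σℤ (suc k) (λ j → f (n ∸ i) j * g (n ∸ (n ∸ i)) (k ∸ j)))
    ≡⟨ Σℤ-cong (suc n) (λ i → Σℤ-reverse (suc k) (λ j → f (n ∸ i) j * g (n ∸ (n ∸ i)) (k ∸ j))) ⟩
      Σℤ (suc n) (λ i → Σℤ (suc k) (λ j → f (n ∸ i) (k ∸ j) * g (n ∸ (n ∸ i)) (k ∸ (k ∸ j))))
    ≡⟨ Σℤ-cong< (suc n) (λ i li → Σℤ-cong< (suc k) (λ j lj →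
         trans (*-comm (f (n ∸ i) (k ∸ j)) (g (n ∸ (n ∸ i)) (k ∸ (k ∸ j))))
             (cong₂ (λ a b → g a b * f (n ∸ i) (k ∸ j)) (ℕₚ.m∸[m∸n]≡n (le li)) (ℕₚ.m∸[m∸n]≡n (le lj))))) ⟩
      Σℤ (suc n) (λ i → Σℤ (suc k) (λ j → g i j * f (n ∸ i) (k ∸ j)))
    ∎ where
    open ≡-Reasoning
    le : ∀ {a b} → a <ℕ suc b → a ≤ℕ b
    le (s≤s x) = x

  conv-assoc : ∀ f g h → conv (conv f g) h ≋ conv f (conv g h)
  conv-assoc f g h n k = begin
      Σℤ (suc n) (λ i → Σℤ (suc k) (λ j → conv f g i j * h (n ∸ i) (k ∸ j)))
    ≡⟨ Σℤ-cong (suc n) (λ i → Σℤ-cong (suc k) (λ j → expand-left i j)) ⟩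
      Σℤ (suc n) (λ i → Σℤ (suc k) (λ j → Σℤ (suc i) (λ i' → Σℤ (suc j) (λ j' → T i j i' j'))))
    ≡⟨ Σℤ-cong (suc n) (λ i → Σℤ-swap (suc k) (suc i) (λ j i' → Σℤ (suc j) (λ j' → T i j i' j'))) ⟩
      Σℤ (suc n) (λ i → Σℤ (suc i) (λ i' → Σℤ (suc k) (λ j → Σℤ (suc j) (λ j' → T i j i' j'))))
    ≡⟨ Σℤ-triangle (suc n) (λ i' i → Σℤ (suc k) (λ j → Σℤ (suc j) (λ j' → T i j i' j'))) ⟩
      Σℤ (suc n) (λ i' → Σℤ (suc n ∸ i') (λ u → Σℤ (suc k) (λ j → Σℤ (suc j) (λ j' → T (i' ℕ.+ u) j i' j'))))
    ≡⟨ Σℤ-cong (suc n) (λ i' → Σℤ-cong (suc n ∸ i') (λ u → Σℤ-triangle (suc k) (λ j' j → T (i' ℕ.+ u) j i' j'))) ⟩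
      Σℤ (suc n) (λ i' → Σℤ (suc n ∸ i')
          (λ u → Σℤ (suc k) (λ j' → Σℤ (suc k ∸ j') (λ v → T (i' ℕ.+ u) (j' ℕ.+ v) i' j'))))
    ≡⟨ Σℤ-cong (suc n) (λ i' → Σℤ-swap (suc n ∸ i') (suc k)
        (λ u j' → Σℤ (suc k ∸ j') (λ v → T (i' ℕ.+ u) (j' ℕ.+ v) i' j'))) ⟩
      Σℤ (suc n) (λ i' → Σℤ (suc k)
          (λ j' → Σℤ (suc n ∸ i') (λ u → Σℤ (suc k ∸ j') (λ v → T (i' ℕ.+ u) (j' ℕ.+ v) i' j'))))
    ≡⟨ Σℤ-cong< (suc n) (λ i' li → Σℤ-cong< (suc k) (λ j' lj → shift-ranges i' j' (le li) (le lj))) ⟩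
      Σℤ (suc n) (λ i' → Σℤ (suc k) (λ j' → Σℤ (suc (n ∸ i'))
          (λ u → Σℤ (suc (k ∸ j')) (λ v → f i' j' * (g u v * h (n ∸ i' ∸ u) (k ∸ j' ∸ v))))))
    ≡⟨ Σℤ-cong (suc n) (λ i' → Σℤ-cong (suc k) (λ j' → factor-left i' j')) ⟩
      Σℤ (suc n) (λ i' → Σℤ (suc k) (λ j' → f i' j' * conv g h (n ∸ i') (k ∸ j')))
    ∎ where
    open ≡-Reasoning
    le : ∀ {a b} → a <ℕ suc b → a ≤ℕ b
    le (s≤s x) = x
    T : ℕ → ℕ → ℕ → ℕ → ℤ
    T i j i' j' = f i' j' * g (i ∸ i') (j ∸ j') * h (n ∸ i) (k ∸ j)
    expand-left : ∀ i j → conv f g i j * h (n ∸ i) (k ∸ j) ≡ Σℤ (suc i) (λ i' → Σℤ (suc j) (λ j' → T i j i' j'))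
    expand-left i j = trans (sym (Σℤ-*ʳ (suc i) (h (n ∸ i) (k ∸ j)) (λ i' → Σℤ (suc j) (λ j' → f i' j' * g (i ∸ i') (j ∸ j')))))
       (Σℤ-cong (suc i) (λ i' → sym (Σℤ-*ʳ (suc j) (h (n ∸ i) (k ∸ j)) (λ j' → f i' j' * g (i ∸ i') (j ∸ j')))))
    term-shifted : ∀ i' j' u v → T (i' ℕ.+ u) (j' ℕ.+ v) i' j' ≡ f i' j' * (g u v * h (n ∸ i' ∸ u) (k ∸ j' ∸ v))
    term-shifted i' j' u v = trans (*-assoc (f i' j') _ _)
       (cong (λ z → f i' j' * z) (cong₂ _*_ (cong₂ g (ℕₚ.m+n∸m≡n i' u) (ℕₚ.m+n∸m≡n j' v))
          (cong₂ h (sym (ℕₚ.∸-+-assoc n i' u)) (sym (ℕₚ.∸-+-assoc k j' v)))))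
    shift-ranges : ∀ i' j' → i' ≤ℕ n → j' ≤ℕ k →
      Σℤ (suc n ∸ i') (λ u → Σℤ (suc k ∸ j') (λ v → T (i' ℕ.+ u) (j' ℕ.+ v) i' j'))
      ≡ Σℤ (suc (n ∸ i')) (λ u → Σℤ (suc (k ∸ j')) (λ v → f i' j' * (g u v * h (n ∸ i' ∸ u) (k ∸ j' ∸ v))))
    shift-ranges i' j' li lj rewrite ℕₚ.+-∸-assoc 1 li | ℕₚ.+-∸-assoc 1 lj =
      Σℤ-cong (suc (n ∸ i')) (λ u → Σℤ-cong (suc (k ∸ j')) (λ v → term-shifted i' j' u v))
    factor-left : ∀ i' j' → Σℤ (suc (n ∸ i')) (λ u → Σℤ (suc (k ∸ j')) (λ v → f i' j' * (g u v * h (n ∸ i' ∸ u) (k ∸ j' ∸ v))))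
          ≡ f i' j' * conv g h (n ∸ i') (k ∸ j')
    factor-left i' j' = trans (Σℤ-cong (suc (n ∸ i'))
        (λ u → Σℤ-*ˡ (suc (k ∸ j')) (f i' j') (λ v → g u v * h (n ∸ i' ∸ u) (k ∸ j' ∸ v))))
       (Σℤ-*ˡ (suc (n ∸ i')) (f i' j') (λ u → Σℤ (suc (k ∸ j')) (λ v → g u v * h (n ∸ i' ∸ u) (k ∸ j' ∸ v))))

  conv-identityˡ : ∀ f → conv 𝟙 f ≋ f
  conv-identityˡ f n k = begin
      (Σℤ (suc k) (λ j → 𝟙 0 j * f n (k ∸ j))) + Σℤ n (λ i → Σℤ (suc k) (λ j → 𝟙 (suc i) j * f (n ∸ suc i) (k ∸ j)))
    ≡⟨ cong₂ _+_ inner (Σℤ-zero n (λ i → Σℤ-zero (suc k) (λ j → *-zeroˡ (f (n ∸ suc i) (k ∸ j))))) ⟩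
      f n k + 0ℤ
    ≡⟨ +-identityʳ (f n k) ⟩
      f n k
    ∎ where
    open ≡-Reasoning
    inner : Σℤ (suc k) (λ j → 𝟙 0 j * f n (k ∸ j)) ≡ f n k
    inner = trans (cong₂ _+_ (*-identityˡ (f n k)) (Σℤ-zero k (λ j → *-zeroˡ (f n (k ∸ suc j))))) (+-identityʳ (f n k))

  conv-distribˡ : ∀ f g h → conv f (g ⊕ h) ≋ (conv f g ⊕ conv f h)
  conv-distribˡ f g h n k =
    trans (Σℤ-cong (suc n) (λ i → trans
        (Σℤ-cong (suc k) (λ j → *-distribˡ-+ (f i j) (g (n ∸ i) (k ∸ j)) (h (n ∸ i) (k ∸ j))))
            (Σℤ-+ (suc k) (λ j → f i j * g (n ∸ i) (k ∸ j)) (λ j → f i j * h (n ∸ i) (k ∸ j)))))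
          (Σℤ-+ (suc n) (λ i → Σℤ (suc k) (λ j → f i j * g (n ∸ i) (k ∸ j)))
              (λ i → Σℤ (suc k) (λ j → f i j * h (n ∸ i) (k ∸ j))))

  ⊛-cong : ∀ {f f' g g'} → f ≋ f' → g ≋ g' → (f ⊛ g) ≋ (f' ⊛ g')
  ⊛-cong {f} {f'} {g} {g'} ef eg = ≋-trans (⊛≋conv f g)
      (≋-trans (conv-cong {f} {f'} {g} {g'} ef eg) (≋-sym (⊛≋conv f' g')))

  ⊛-comm : ∀ f g → (f ⊛ g) ≋ (g ⊛ f)
  ⊛-comm f g = ≋-trans (⊛≋conv f g) (≋-trans (conv-comm f g) (≋-sym (⊛≋conv g f)))

  ⊛-assoc : ∀ f g h → ((f ⊛ g) ⊛ h) ≋ (f ⊛ (g ⊛ h))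
  ⊛-assoc f g h = ≋-trans (⊛≋conv (f ⊛ g) h) (≋-trans (conv-cong {f ⊛ g} {conv f g} {h} {h} (⊛≋conv f g) ≋-refl)
     (≋-trans (conv-assoc f g h) (≋-trans (conv-cong {f} {f} {conv g h} {g ⊛ h} ≋-refl (≋-sym (⊛≋conv g h)))
         (≋-sym (⊛≋conv f (g ⊛ h))))))

  ⊛-identityˡ : ∀ f → (𝟙 ⊛ f) ≋ f
  ⊛-identityˡ f = ≋-trans (⊛≋conv 𝟙 f) (conv-identityˡ f)

  ⊛-identityʳ : ∀ f → (f ⊛ 𝟙) ≋ f
  ⊛-identityʳ f = ≋-trans (⊛-comm f 𝟙) (⊛-identityˡ f)

  ⊛-distribˡ : ∀ f g h → (f ⊛ (g ⊕ h)) ≋ ((f ⊛ g) ⊕ (f ⊛ h))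
  ⊛-distribˡ f g h n k = trans (⊛≋conv f (g ⊕ h) n k)
      (trans (conv-distribˡ f g h n k) (sym (cong₂ _+_ (⊛≋conv f g n k) (⊛≋conv f h n k))))

  ⊛-distribʳ : ∀ f g h → ((g ⊕ h) ⊛ f) ≋ ((g ⊛ f) ⊕ (h ⊛ f))
  ⊛-distribʳ f g h n k = trans (⊛-comm (g ⊕ h) f n k)
      (trans (⊛-distribˡ f g h n k) (cong₂ _+_ (⊛-comm f g n k) (⊛-comm f h n k)))

  𝟘 : Ser
  𝟘 n k = 0ℤ

  seriesRing : CommutativeRing _ _
  seriesRing = record
    { Carrier = Ser
    ; _≈_ = _≋_
    ; _+_ = _⊕_
    ; _*_ = _⊛_
    ; -_ = ⊝_
    ; 0# = 𝟘
    ; 1# = 𝟙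
    ; isCommutativeRing = record
      { isRing = record
        { +-isAbelianGroup = record
          { isGroup = record
            { isMonoid = record
              { isSemigroup = record
                { isMagma = record
                  { isEquivalence = record { refl = λ {f} → ≋-refl {f} ; sym = ≋-sym ; trans = ≋-trans }
                  ; ∙-cong = ⊕-cong }
                ; assoc = λ f g h n k → +-assoc (f n k) (g n k) (h n k) }
              ; identity = (λ f n k → +-identityˡ (f n k)) , (λ f n k → +-identityʳ (f n k)) }
            ; inverse = (λ f n k → +-inverseˡ (f n k)) , (λ f n k → +-inverseʳ (f n k))
            ; ⁻¹-cong = ⊝-cong }
          ; comm = λ f g n k → +-comm (f n k) (g n k) }
        ; *-cong = ⊛-cong
        ; *-assoc = ⊛-assoc
        ; *-identity = ⊛-identityˡ , ⊛-identityʳ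
        ; distrib = ⊛-distribˡ , ⊛-distribʳ }
      ; *-comm = ⊛-comm }
    }

  const : ℤ → Ser
  const c zero zero = c
  const c _ _ = 0ℤ

  conv-constˡ : ∀ c f → conv (const c) f ≋ (λ n k → c * f n k)
  conv-constˡ c f n k = begin
      (Σℤ (suc k) (λ j → const c 0 j * f n (k ∸ j))) + Σℤ n
          (λ i → Σℤ (suc k) (λ j → const c (suc i) j * f (n ∸ suc i) (k ∸ j)))
    ≡⟨ cong₂ _+_ inner (Σℤ-zero n (λ i → Σℤ-zero (suc k) (λ j → *-zeroˡ (f (n ∸ suc i) (k ∸ j))))) ⟩
      c * f n k + 0ℤ
    ≡⟨ +-identityʳ (c * f n k) ⟩
      c * f n k
    ∎ where
    open ≡-Reasoning
    inner : Σℤ (suc k) (λ j → const c 0 j * f n (k ∸ j)) ≡ c * f n k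
    inner = trans (cong (_+_ (c * f n k)) (Σℤ-zero k (λ j → *-zeroˡ (f n (k ∸ suc j))))) (+-identityʳ (c * f n k))

  seriesAlmostCommutativeRing : AlmostCommutativeRing _ _
  seriesAlmostCommutativeRing = fromCommutativeRing seriesRing

  const-morphism : CommutativeRing.rawRing +-*-commutativeRing -Raw-AlmostCommutative⟶ seriesAlmostCommutativeRing
  const-morphism = record
    { ⟦_⟧ = const
    ; +-homo = λ a b → hp a b
    ; *-homo = λ a b n k → trans (hm a b n k)
        (sym (trans (⊛≋conv (const a) (const b) n k) (conv-constˡ a (const b) n k)))
    ; -‿homo = λ a → hn a
    ; 0-homo = λ { zero zero → refl ; zero (suc k) → refl ; (suc n) k → refl }
    ; 1-homo = λ { zero zero → refl ; zero (suc k) → refl ; (suc n) k → refl }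
    } where
    hp : ∀ a b → const (a + b) ≋ (const a ⊕ const b)
    hp a b zero zero = refl
    hp a b zero (suc k) = refl
    hp a b (suc n) k = refl
    hm : ∀ a b n k → const (a * b) n k ≡ a * const b n k
    hm a b zero zero = refl
    hm a b zero (suc k) = sym (*-zeroʳ a)
    hm a b (suc n) k = sym (*-zeroʳ a)
    hn : ∀ a → const (- a) ≋ (⊝ const a)
    hn a zero zero = refl
    hn a zero (suc k) = refl
    hn a (suc n) k = refl

  const-≟ : ∀ a b → Maybe (const a ≋ const b)
  const-≟ a b with a ≟ b
  ... | yes refl = just (λ n k → refl)
  ... | no _ = nothing

  open import Algebra.Solver.Ring (CommutativeRing.rawRing +-*-commutativeRing) seriesAlmostCommutativeRing
      const-morphism const-≟ public

  ⊛-≋𝟘 : ∀ a {e} → e ≋ 𝟘 → (a ⊛ e) ≋ 𝟘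
  ⊛-≋𝟘 a {e} h n k = trans (⊛-cong {a} {a} {e} {𝟘} ≋-refl h n k)
     (trans (⊛≋conv a 𝟘 n k) (Σℤ-zero (suc n) (λ i → Σℤ-zero (suc k) (λ j → *-zeroʳ (a i j)))))

  ⊕-≋𝟘 : ∀ {a b} → a ≋ 𝟘 → b ≋ 𝟘 → (a ⊕ b) ≋ 𝟘
  ⊕-≋𝟘 e e' n k = cong₂ _+_ (e n k) (e' n k)

  ⊖-≋𝟘 : ∀ {a b} → a ≋ b → (a ⊖ b) ≋ 𝟘
  ⊖-≋𝟘 {a} {b} e n k = trans (cong (λ z → z + - b n k) (e n k)) (+-inverseʳ (b n k))

  ⊖≋𝟘⇒≋ : ∀ {a b} → (a ⊖ b) ≋ 𝟘 → a ≋ b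
  ⊖≋𝟘⇒≋ {a} {b} e n k = begin
    a n k                     ≡⟨ sym (+-identityʳ (a n k)) ⟩
    a n k + 0ℤ                ≡⟨ cong (a n k +_) (sym (+-inverseˡ (b n k))) ⟩
    a n k + (- b n k + b n k) ≡⟨ sym (+-assoc (a n k) (- b n k) (b n k)) ⟩
    (a n k + - b n k) + b n k ≡⟨ cong (_+ b n k) (e n k) ⟩
    0ℤ + b n k                ≡⟨ +-identityˡ (b n k) ⟩
    b n k                     ∎
    where open ≡-Reasoning

  -- The solver reads the numeral 1 as const 1ℤ, which agrees with 𝟙 only up to ≋.
  const1 : Ser
  const1 = const 1ℤ

  const1≋𝟙 : const1 ≋ 𝟙
  const1≋𝟙 zero zero = refl
  const1≋𝟙 zero (suc k) = refl
  const1≋𝟙 (suc n) k = refl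

  shiftX : Ser → Ser
  shiftX H zero k = 0ℤ
  shiftX H (suc n) k = H n k

  shiftY : Ser → Ser
  shiftY H n zero = 0ℤ
  shiftY H n (suc k) = H n k

  𝕏⊛≋shiftX : ∀ H → (𝕏 ⊛ H) ≋ shiftX H
  𝕏⊛≋shiftX H n k = trans (⊛≋conv 𝕏 H n k) (go n)
    where
    z0 : ∀ m → Σℤ (suc k) (λ j → 𝕏 0 j * H m (k ∸ j)) ≡ 0ℤ
    z0 m = Σℤ-zero (suc k) (λ j → *-zeroˡ (H m (k ∸ j)))
    go : ∀ n → conv 𝕏 H n k ≡ shiftX H n k
    go zero = trans (cong (λ z → z + 0ℤ) (z0 0)) refl
    go (suc n) = begin
        Σℤ (suc k) (λ j → 𝕏 0 j * H (suc n) (k ∸ j)) + (Σℤ (suc k) (λ j → 𝕏 1 j * H n (k ∸ j)) + Σℤ n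
            (λ i → Σℤ (suc k) (λ j → 𝕏 (suc (suc i)) j * H (n ∸ suc i) (k ∸ j))))
      ≡⟨ cong₂ _+_ (z0 (suc n))
          (cong₂ _+_ one (Σℤ-zero n (λ i → Σℤ-zero (suc k) (λ j → *-zeroˡ (H (n ∸ suc i) (k ∸ j)))))) ⟩
        0ℤ + (H n k + 0ℤ)
      ≡⟨ trans (+-identityˡ _) (+-identityʳ _) ⟩
        H n k
      ∎ where
      open ≡-Reasoning
      one : Σℤ (suc k) (λ j → 𝕏 1 j * H n (k ∸ j)) ≡ H n k
      one = trans (cong₂ _+_ (*-identityˡ (H n k)) (Σℤ-zero k (λ j → *-zeroˡ (H n (k ∸ suc j))))) (+-identityʳ (H n k))

  𝕐⊛≋shiftY : ∀ H → (𝕐 ⊛ H) ≋ shiftY H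
  𝕐⊛≋shiftY H n k = trans (⊛≋conv 𝕐 H n k) (trans (cong₂ _+_ (inner k) rest) (+-identityʳ _))
    where
    rest : Σℤ n (λ i → Σℤ (suc k) (λ j → 𝕐 (suc i) j * H (n ∸ suc i) (k ∸ j))) ≡ 0ℤ
    rest = Σℤ-zero n (λ i → Σℤ-zero (suc k) (λ j → *-zeroˡ (H (n ∸ suc i) (k ∸ j))))
    inner : ∀ k → Σℤ (suc k) (λ j → 𝕐 0 j * H n (k ∸ j)) ≡ shiftY H n k
    inner zero = trans (cong (λ z → z + 0ℤ) (*-zeroˡ (H n 0))) refl
    inner (suc k) = begin
        𝕐 0 0 * H n (suc k) + (𝕐 0 1 * H n k + Σℤ k (λ j → 𝕐 0 (suc (suc j)) * H n (k ∸ suc j)))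
      ≡⟨ cong₂ _+_ (*-zeroˡ (H n (suc k)))
          (cong₂ _+_ (*-identityˡ (H n k)) (Σℤ-zero k (λ j → *-zeroˡ (H n (k ∸ suc j))))) ⟩
        0ℤ + (H n k + 0ℤ)
      ≡⟨ trans (+-identityˡ _) (+-identityʳ _) ⟩
        H n k
      ∎ where open ≡-Reasoning

  shiftXⁿ : ℕ → Ser → Ser
  shiftXⁿ zero H = H
  shiftXⁿ (suc d) H = shiftX (shiftXⁿ d H)

  𝕏^⊛≋shiftXⁿ : ∀ d H → ((𝕏 ^ˢ d) ⊛ H) ≋ shiftXⁿ d H
  𝕏^⊛≋shiftXⁿ zero H = ⊛-identityˡ H
  𝕏^⊛≋shiftXⁿ (suc d) H = ≋-trans (⊛-assoc 𝕏 (𝕏 ^ˢ d) H)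
     (≋-trans (⊛-cong {𝕏} {𝕏} {(𝕏 ^ˢ d) ⊛ H} {shiftXⁿ d H} ≋-refl (𝕏^⊛≋shiftXⁿ d H)) (𝕏⊛≋shiftX (shiftXⁿ d H)))

  𝟙⊖𝕏⊛-eval : ∀ H n k → ((𝟙 ⊖ 𝕏) ⊛ H) n k ≡ H n k + - shiftX H n k
  𝟙⊖𝕏⊛-eval H n k = trans (⊛-distribʳ H 𝟙 (⊝ 𝕏) n k) (cong₂ _+_ (⊛-identityˡ H n k) neg)
    where
    neg : ((⊝ 𝕏) ⊛ H) n k ≡ - shiftX H n k
    neg = trans (⊛≋conv (⊝ 𝕏) H n k) (trans (Σℤ-cong (suc n) (λ i → trans
        (Σℤ-cong (suc k) (λ j → sym (neg-distribˡ-* (𝕏 i j) (H (n ∸ i) (k ∸ j)))))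
        (Σℤ-neg (suc k) (λ j → 𝕏 i j * H (n ∸ i) (k ∸ j)))))
          (trans (Σℤ-neg (suc n) (λ i → Σℤ (suc k) (λ j → 𝕏 i j * H (n ∸ i) (k ∸ j))))
              (cong -_ (trans (sym (⊛≋conv 𝕏 H n k)) (𝕏⊛≋shiftX H n k)))))

  𝟙⊖𝕏-cancel : ∀ H → ((𝟙 ⊖ 𝕏) ⊛ H) ≋ 𝟘 → H ≋ 𝟘
  𝟙⊖𝕏-cancel H h = go
    where
    go : H ≋ 𝟘
    go zero k = trans (sym (+-identityʳ (H 0 k))) (trans (sym (𝟙⊖𝕏⊛-eval H 0 k)) (h 0 k))
    go (suc n) k = trans (sym (+-identityʳ (H (suc n) k))) (trans
        (cong (λ z → H (suc n) k + - z) (sym (go n k))) (trans (sym (𝟙⊖𝕏⊛-eval H (suc n) k)) (h (suc n) k)))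

  powerRange : ℕ → ℕ → Ser
  powerRange a zero = 𝟘
  powerRange a (suc c) = (𝕏 ^ˢ a) ⊕ powerRange (suc a) c

  𝟙⊖𝕏⊛powerRange : ∀ a c → ((𝟙 ⊖ 𝕏) ⊛ powerRange a c) ≋ ((𝕏 ^ˢ a) ⊖ (𝕏 ^ˢ (a ℕ.+ c)))
  𝟙⊖𝕏⊛powerRange a zero n k rewrite ℕₚ.+-identityʳ a = trans (⊛-≋𝟘 (𝟙 ⊖ 𝕏) {𝟘} ≋-refl n k)
      (sym (⊖-≋𝟘 {𝕏 ^ˢ a} {𝕏 ^ˢ a} ≋-refl n k))
  𝟙⊖𝕏⊛powerRange a (suc c) n k rewrite ℕₚ.+-suc a c = begin
      ((𝟙 ⊖ 𝕏) ⊛ (W ⊕ powerRange (suc a) c)) n k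
    ≡⟨ ⊛-distribˡ (𝟙 ⊖ 𝕏) W (powerRange (suc a) c) n k ⟩
      ((𝟙 ⊖ 𝕏) ⊛ W) n k + ((𝟙 ⊖ 𝕏) ⊛ powerRange (suc a) c) n k
    ≡⟨ cong₂ _+_ (𝟙⊖𝕏⊛-eval W n k) (𝟙⊖𝕏⊛powerRange (suc a) c n k) ⟩
      (W n k + - shiftX W n k) + ((𝕏 ⊛ W) n k + - V n k)
    ≡⟨ cong (λ z → (W n k + - shiftX W n k) + (z + - V n k)) (𝕏⊛≋shiftX W n k) ⟩
      (W n k + - shiftX W n k) + (shiftX W n k + - V n k)
    ≡⟨ alg (W n k) (shiftX W n k) (V n k) ⟩
      W n k + - V n k
    ∎ where
    open ≡-Reasoning
    W V : Ser
    W = 𝕏 ^ˢ a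
    V = 𝕏 ^ˢ suc (a ℕ.+ c)
    alg : ∀ w s v → (w + - s) + (s + - v) ≡ w + - v
    alg = solve-∀

  shiftXⁿ-eval : ∀ t H m k → shiftXⁿ t H m k ≡ (if t ≤ᵇ m then H (m ∸ t) k else 0ℤ)
  shiftXⁿ-eval zero H m k = refl
  shiftXⁿ-eval (suc t) H zero k = refl
  shiftXⁿ-eval (suc zero) H (suc m) k = refl
  shiftXⁿ-eval (suc (suc t)) H (suc m) k = shiftXⁿ-eval (suc t) H m k

  shiftXⁿ-⊕ : ∀ t F G → shiftXⁿ t (F ⊕ G) ≋ (shiftXⁿ t F ⊕ shiftXⁿ t G)
  shiftXⁿ-⊕ zero F G n k = refl
  shiftXⁿ-⊕ (suc t) F G zero k = refl
  shiftXⁿ-⊕ (suc t) F G (suc n) k = shiftXⁿ-⊕ t F G n k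

  shiftXⁿ-cong : ∀ t {F G} → F ≋ G → shiftXⁿ t F ≋ shiftXⁿ t G
  shiftXⁿ-cong zero e n k = e n k
  shiftXⁿ-cong (suc t) e zero k = refl
  shiftXⁿ-cong (suc t) e (suc n) k = shiftXⁿ-cong t e n k

  powerRange⊛ : ∀ a c H → (powerRange a c ⊛ H) ≋ (λ n k → Σℤ c (λ t → shiftXⁿ (a ℕ.+ t) H n k))
  powerRange⊛ a zero H n k = trans (⊛≋conv 𝟘 H n k)
      (Σℤ-zero (suc n) (λ i → Σℤ-zero (suc k) (λ j → *-zeroˡ (H (n ∸ i) (k ∸ j)))))
  powerRange⊛ a (suc c) H n k = begin
      (((𝕏 ^ˢ a) ⊕ powerRange (suc a) c) ⊛ H) n k
    ≡⟨ ⊛-distribʳ H (𝕏 ^ˢ a) (powerRange (suc a) c) n k ⟩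
      ((𝕏 ^ˢ a) ⊛ H) n k + (powerRange (suc a) c ⊛ H) n k
    ≡⟨ cong₂ _+_ (trans (𝕏^⊛≋shiftXⁿ a H n k) (cong (λ z → shiftXⁿ z H n k) (sym (ℕₚ.+-identityʳ a))))
        (powerRange⊛ (suc a) c H n k) ⟩
      shiftXⁿ (a ℕ.+ 0) H n k + Σℤ c (λ t → shiftXⁿ (suc a ℕ.+ t) H n k)
    ≡⟨ cong (_+_ (shiftXⁿ (a ℕ.+ 0) H n k)) (Σℤ-cong c (λ t → cong (λ z → shiftXⁿ z H n k) (sym (ℕₚ.+-suc a t)))) ⟩
      shiftXⁿ (a ℕ.+ 0) H n k + Σℤ c (λ t → shiftXⁿ (a ℕ.+ suc t) H n k)
    ∎ where open ≡-Reasoning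

module RationalIdentity where

  open PowerSeries
  open import Data.Nat using (ℕ)
  open import Data.Integer using (1ℤ)
  open import Relation.Binary.PropositionalEquality using (refl)

  cong₂-⊕ : ∀ a a' b b' → a ≋ a' → b ≋ b' → (a ⊕ b) ≋ (a' ⊕ b')
  cong₂-⊕ a a' b b' = ⊕-cong {a} {a'} {b} {b'}

  cong₂-⊖ : ∀ a a' b b' → a ≋ a' → b ≋ b' → (a ⊖ b) ≋ (a' ⊖ b')
  cong₂-⊖ a a' b b' = ⊖-cong {a} {a'} {b} {b'}

  cong₂-⊛ : ∀ a a' b b' → a ≋ a' → b ≋ b' → (a ⊛ b) ≋ (a' ⊛ b')
  cong₂-⊛ a a' b b' = ⊛-cong {a} {a'} {b} {b'}

  -- Den p and Num p with the unit and x^p abstracted: DenF 𝟙 (𝕏 ^ˢ p) is Den p by definition.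
  DenF : Ser → Ser → Ser
  DenF o Z = ((o ⊖ (𝕏 ⊕ 𝕏)) ⊕ (𝕏 ⊛ Z)) ⊖ ((𝕐 ⊖ o) ⊛ ((((𝕏 ⊛ (𝕏 ⊛ o)) ⊖ Z) ⊕ (𝕏 ⊛ Z)) ⊖ (𝕏 ⊛ (𝕏 ⊛ Z))))

  NumF : Ser → Ser → Ser
  NumF o Z = (o ⊖ 𝕏) ⊛ (o ⊕ ((𝕐 ⊖ o) ⊛ Z))

  DenF-cong : ∀ o o' Z → o ≋ o' → DenF o Z ≋ DenF o' Z
  DenF-cong o o' Z e = cong₂-⊖ _ _ _ _
    (cong₂-⊕ (o ⊖ (𝕏 ⊕ 𝕏)) (o' ⊖ (𝕏 ⊕ 𝕏)) (𝕏 ⊛ Z) (𝕏 ⊛ Z) (cong₂-⊖ o o' (𝕏 ⊕ 𝕏) (𝕏 ⊕ 𝕏) e ≋-refl) ≋-refl)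
    (cong₂-⊛ (𝕐 ⊖ o) (𝕐 ⊖ o') _ _ (cong₂-⊖ 𝕐 𝕐 o o' ≋-refl e)
       (cong₂-⊖ _ _ (𝕏 ⊛ (𝕏 ⊛ Z)) (𝕏 ⊛ (𝕏 ⊛ Z))
          (cong₂-⊕ ((𝕏 ⊛ (𝕏 ⊛ o)) ⊖ Z) ((𝕏 ⊛ (𝕏 ⊛ o')) ⊖ Z) (𝕏 ⊛ Z) (𝕏 ⊛ Z)
             (cong₂-⊖ (𝕏 ⊛ (𝕏 ⊛ o)) (𝕏 ⊛ (𝕏 ⊛ o')) Z Z
                (cong₂-⊛ 𝕏 𝕏 (𝕏 ⊛ o) (𝕏 ⊛ o') ≋-refl (cong₂-⊛ 𝕏 𝕏 o o' ≋-refl e)) ≋-refl) ≋-refl) ≋-refl))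

  NumF-cong : ∀ o o' Z → o ≋ o' → NumF o Z ≋ NumF o' Z
  NumF-cong o o' Z e = cong₂-⊛ (o ⊖ 𝕏) (o' ⊖ 𝕏) _ _ (cong₂-⊖ o o' 𝕏 𝕏 e ≋-refl)
    (cong₂-⊕ o o' ((𝕐 ⊖ o) ⊛ Z) ((𝕐 ⊖ o') ⊛ Z) e (cong₂-⊛ (𝕐 ⊖ o) (𝕐 ⊖ o') Z Z (cong₂-⊖ 𝕐 𝕐 o o' ≋-refl e) ≋-refl))

  module Elimination (p : ℕ) (E I G S P : Ser) where

    X Y Z o O T : Ser
    X = 𝕏
    Y = 𝕐
    Z = 𝕏 ^ˢ p
    o = const1
    O = o ⊖ X
    T = (Y ⊛ E) ⊕ I

    defectI defectE defectS defectP defectG : Ser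
    defectI = I ⊖ (X ⊛ T)
    defectE = E ⊖ ((S ⊕ (P ⊛ T)) ⊕ (Z ⊛ (E ⊕ I)))
    defectS = (O ⊛ S) ⊖ ((X ⊛ o) ⊖ (X ⊛ Z))
    defectP = (O ⊛ P) ⊖ ((X ⊛ (X ⊛ o)) ⊖ Z)
    defectG = G ⊖ ((o ⊕ E) ⊕ I)

    combination : Ser
    combination =
      (((O ⊕ (X ⊛ Y)) ⊛ (((((O ⊛ O) ⊛ defectE) ⊕ (O ⊛ defectS)) ⊕ ((O ⊛ T) ⊛ defectP))
                         ⊕ ((((X ⊛ X) ⊖ Z) ⊕ (Z ⊛ O)) ⊛ defectI)))
       ⊕ (DenF o Z ⊛ defectI))
      ⊕ ((O ⊛ DenF o Z) ⊛ defectG)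

    -- The coefficients come from eliminating I, E, S, P and G from the five equations.
    elimination-identity : (O ⊛ ((G ⊛ DenF o Z) ⊖ NumF o Z)) ≋ combination
    elimination-identity = solve 8 (λ X Y Z E I G S P →
       let o = con 1ℤ
           O = o :- X
           Den = ((o :- (X :+ X)) :+ X :* Z) :- ((Y :- o) :* ((((X :* (X :* o)) :- Z) :+ (X :* Z)) :- (X :* (X :* Z))))
           Num = (o :- X) :* (o :+ (Y :- o) :* Z)
           T = Y :* E :+ I
           defectI = I :- X :* T
           defectE = E :- (S :+ P :* T :+ Z :* (E :+ I))
           defectS = O :* S :- (X :* o :- X :* Z)
           defectP = O :* P :- (X :* (X :* o) :- Z)
           defectG = G :- (o :+ E :+ I)
       in O :* (G :* Den :- Num)
          := (O :+ X :* Y) :* (O :* O :* defectE :+ O :* defectS :+ O :* T :* defectP :+ (X :* X :- Z :+ Z :* O) :* defectI)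
             :+ Den :* defectI :+ O :* Den :* defectG)
       (λ n k → refl) X Y Z E I G S P

    O≋𝟙⊖𝕏 : O ≋ (𝟙 ⊖ X)
    O≋𝟙⊖𝕏 = cong₂-⊖ o 𝟙 X X const1≋𝟙 ≋-refl

    scaled : ((𝟙 ⊖ X) ⊛ ((G ⊛ Den p) ⊖ Num p)) ≋ (O ⊛ ((G ⊛ DenF o Z) ⊖ NumF o Z))
    scaled = cong₂-⊛ (𝟙 ⊖ X) O ((G ⊛ Den p) ⊖ Num p) ((G ⊛ DenF o Z) ⊖ NumF o Z) (≋-sym O≋𝟙⊖𝕏)
      (cong₂-⊖ (G ⊛ Den p) (G ⊛ DenF o Z) (Num p) (NumF o Z)
        (cong₂-⊛ G G (Den p) (DenF o Z) ≋-refl (DenF-cong 𝟙 o Z (≋-sym const1≋𝟙))) (NumF-cong 𝟙 o Z (≋-sym const1≋𝟙)))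

  ⊛Den≋Num : ∀ (p : ℕ) (E I G S P : Ser) →
    I ≋ (𝕏 ⊛ ((𝕐 ⊛ E) ⊕ I)) →
    E ≋ ((S ⊕ (P ⊛ ((𝕐 ⊛ E) ⊕ I))) ⊕ ((𝕏 ^ˢ p) ⊛ (E ⊕ I))) →
    ((𝟙 ⊖ 𝕏) ⊛ S) ≋ ((𝕏 ⊛ 𝟙) ⊖ (𝕏 ⊛ (𝕏 ^ˢ p))) →
    ((𝟙 ⊖ 𝕏) ⊛ P) ≋ ((𝕏 ⊛ (𝕏 ⊛ 𝟙)) ⊖ (𝕏 ^ˢ p)) →
    G ≋ ((𝟙 ⊕ E) ⊕ I) →
    (G ⊛ Den p) ≋ Num p
  ⊛Den≋Num p E I G S P Iˢ-equation Eˢ-equation Sˢ-closed-form Pˢ-closed-form Aˢ-classes =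
    ⊖≋𝟘⇒≋ (𝟙⊖𝕏-cancel _ (≋-trans scaled (≋-trans elimination-identity combination≋𝟘)))
    where
    open Elimination p E I G S P
    X⊛o≋X⊛𝟙 : (X ⊛ o) ≋ (X ⊛ 𝟙)
    X⊛o≋X⊛𝟙 = cong₂-⊛ X X o 𝟙 ≋-refl const1≋𝟙
    defectI≋𝟘 : defectI ≋ 𝟘
    defectI≋𝟘 = ⊖-≋𝟘 {I} {X ⊛ T} Iˢ-equation
    defectE≋𝟘 : defectE ≋ 𝟘
    defectE≋𝟘 = ⊖-≋𝟘 {E} Eˢ-equation
    defectS≋𝟘 : defectS ≋ 𝟘
    defectS≋𝟘 = ⊖-≋𝟘 {O ⊛ S} {(X ⊛ o) ⊖ (X ⊛ Z)} (≋-trans (cong₂-⊛ O (𝟙 ⊖ X) S S O≋𝟙⊖𝕏 ≋-refl)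
      (≋-trans Sˢ-closed-form (cong₂-⊖ (X ⊛ 𝟙) (X ⊛ o) (X ⊛ Z) (X ⊛ Z) (≋-sym X⊛o≋X⊛𝟙) ≋-refl)))
    defectP≋𝟘 : defectP ≋ 𝟘
    defectP≋𝟘 = ⊖-≋𝟘 {O ⊛ P} {(X ⊛ (X ⊛ o)) ⊖ Z} (≋-trans (cong₂-⊛ O (𝟙 ⊖ X) P P O≋𝟙⊖𝕏 ≋-refl)
      (≋-trans Pˢ-closed-form (cong₂-⊖ (X ⊛ (X ⊛ 𝟙)) (X ⊛ (X ⊛ o)) Z Z
          (cong₂-⊛ X X (X ⊛ 𝟙) (X ⊛ o) ≋-refl (≋-sym X⊛o≋X⊛𝟙)) ≋-refl)))
    defectG≋𝟘 : defectG ≋ 𝟘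
    defectG≋𝟘 = ⊖-≋𝟘 {G} {(o ⊕ E) ⊕ I}
        (≋-trans Aˢ-classes (cong₂-⊕ (𝟙 ⊕ E) (o ⊕ E) I I (cong₂-⊕ 𝟙 o E E (≋-sym const1≋𝟙) ≋-refl) ≋-refl))
    combination≋𝟘 : combination ≋ 𝟘
    combination≋𝟘 =
      ⊕-≋𝟘 (⊕-≋𝟘 (⊛-≋𝟘 (O ⊕ (X ⊛ Y))
                    (⊕-≋𝟘 (⊕-≋𝟘 (⊕-≋𝟘 (⊛-≋𝟘 (O ⊛ O) defectE≋𝟘) (⊛-≋𝟘 O defectS≋𝟘)) (⊛-≋𝟘 (O ⊛ T) defectP≋𝟘))
                          (⊛-≋𝟘 (((X ⊛ X) ⊖ Z) ⊕ (Z ⊛ O)) defectI≋𝟘)))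
                  (⊛-≋𝟘 (DenF o Z) defectI≋𝟘))
            (⊛-≋𝟘 (O ⊛ DenF o Z) defectG≋𝟘)

module Words where

  open Counting
  open import Data.Nat using (ℕ; zero; suc) renaming (_*_ to _*ℕ_)
  open import Data.Bool using (Bool; true; _∧_; not)
  open import Data.List using (List; []; _∷_; map; length; replicate)
  open import Data.List.Properties using (∷-injectiveʳ)
  open import Data.List.Membership.Propositional using (_∈_)
  open import Data.List.Membership.Propositional.Properties using (∈-map⁺; ∈-map⁻; ∈-++⁺ˡ; ∈-++⁺ʳ; ∈-++⁻)
  open import Data.List.Relation.Unary.Any using (here)
  open import Data.List.Relation.Unary.All using ([])
  open import Data.List.Relation.Unary.AllPairs using ([]; _∷_)
  open import Data.List.Relation.Unary.Unique.Propositional using (Unique)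
  import Data.List.Relation.Unary.Unique.Propositional.Properties as Unique
  open import Data.Product using (_×_; _,_)
  open import Data.Sum using (inj₁; inj₂)
  open import Relation.Binary.PropositionalEquality
  open import Data.Empty using (⊥)

  words-unique : ∀ m → Unique (words m)
  words-unique zero = [] ∷ []
  words-unique (suc m) = Unique.++⁺ (Unique.map⁺ ∷-injectiveʳ (words-unique m))
      (Unique.map⁺ ∷-injectiveʳ (words-unique m)) disj
    where
    disj : ∀ {v} → v ∈ map (U ∷_) (words m) × v ∈ map (D ∷_) (words m) → ⊥
    disj (m1 , m2) with ∈-map⁻ (U ∷_) m1 | ∈-map⁻ (D ∷_) m2
    ... | x , _ , refl | y , _ , ()

  words-complete : ∀ w → w ∈ words (length w)
  words-complete [] = here refl
  words-complete (U ∷ w) = ∈-++⁺ˡ (∈-map⁺ (U ∷_) (words-complete w))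
  words-complete (D ∷ w) = ∈-++⁺ʳ (map (U ∷_) (words (length w))) (∈-map⁺ (D ∷_) (words-complete w))

  words-length : ∀ m {w} → w ∈ words m → length w ≡ m
  words-length zero (here refl) = refl
  words-length (suc m) mem with ∈-++⁻ (map (U ∷_) (words m)) mem
  ... | inj₁ m1 with ∈-map⁻ (U ∷_) m1
  ... | x , mx , refl = cong suc (words-length m mx)
  words-length (suc m) mem | inj₂ m2 with ∈-map⁻ (D ∷_) m2
  ... | x , mx , refl = cong suc (words-length m mx)

  is𝓕 : ℕ → List Step → Bool
  is𝓕 p w = isDyck w ∧ not (occurs DUU w) ∧ not (occurs (replicate (suc p) D) w)

  𝓕-unique : ∀ p n → Unique (𝓕 p n)
  𝓕-unique p n = unique-filterᵇ (is𝓕 p) (words-unique (2 *ℕ n))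

  ∈𝓕⁺ : ∀ p n {w} → length w ≡ 2 *ℕ n → is𝓕 p w ≡ true → w ∈ 𝓕 p n
  ∈𝓕⁺ p n {w} l e = ∈-filterᵇ⁺ (is𝓕 p) (subst (λ z → w ∈ words z) l (words-complete w)) e

  ∈𝓕⁻ : ∀ p n {w} → w ∈ 𝓕 p n → length w ≡ 2 *ℕ n × is𝓕 p w ≡ true
  ∈𝓕⁻ p n m with ∈-filterᵇ⁻ (is𝓕 p) m
  ... | m1 , e = words-length (2 *ℕ n) m1 , e

module Gaps where

  open import Data.Nat using (ℕ; zero; suc; _+_; z≤n; s≤s) renaming (_≤_ to _≤ℕ_; _<_ to _<ℕ_)
  import Data.Nat.Properties as ℕₚ
  open import Data.List using (List; []; _∷_; _++_; length; replicate)
  import Data.List.Properties as LP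
  open import Relation.Binary.PropositionalEquality

  downs : ℕ → List Step
  downs a = replicate a D

  toPath : (ℕ → ℕ) → ℕ → List Step
  toPath g zero = downs (g 0)
  toPath g (suc n) = downs (g 0) ++ U ∷ toPath (λ i → g (suc i)) n

  -- δ g k = g 0 + ⋯ + g (k - 1) is the number of D's before the k-th U.
  δ : (ℕ → ℕ) → ℕ → ℕ
  δ g zero = 0
  δ g (suc k) = g 0 + δ (λ i → g (suc i)) k

  _∷ᶠ_ : ℕ → (ℕ → ℕ) → ℕ → ℕ
  (a ∷ᶠ g) zero = a
  (a ∷ᶠ g) (suc i) = g i

  incHead : (ℕ → ℕ) → ℕ → ℕ
  incHead g zero = suc (g 0)
  incHead g (suc i) = g (suc i)

  gaps : List Step → ℕ → ℕ
  gaps [] = λ _ → 0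
  gaps (U ∷ w) = 0 ∷ᶠ gaps w
  gaps (D ∷ w) = incHead (gaps w)

  ups : List Step → ℕ
  ups [] = 0
  ups (U ∷ w) = suc (ups w)
  ups (D ∷ w) = ups w

  toPath-incHead : ∀ g n → toPath (incHead g) n ≡ D ∷ toPath g n
  toPath-incHead g zero = refl
  toPath-incHead g (suc n) = refl

  toPath-gaps : ∀ w → toPath (gaps w) (ups w) ≡ w
  toPath-gaps [] = refl
  toPath-gaps (U ∷ w) = cong (U ∷_) (toPath-gaps w)
  toPath-gaps (D ∷ w) = trans (toPath-incHead (gaps w) (ups w)) (cong (D ∷_) (toPath-gaps w))

  toPath-cong : ∀ n {g h : ℕ → ℕ} → (∀ i → i ≤ℕ n → g i ≡ h i) → toPath g n ≡ toPath h n
  toPath-cong zero e = cong downs (e 0 z≤n)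
  toPath-cong (suc n) e = cong₂ (λ a w → downs a ++ U ∷ w) (e 0 z≤n) (toPath-cong n (λ i le → e (suc i) (s≤s le)))

  ups-downs-++ : ∀ a w → ups (downs a ++ w) ≡ ups w
  ups-downs-++ zero w = refl
  ups-downs-++ (suc a) w = ups-downs-++ a w

  ups-downs : ∀ a → ups (downs a) ≡ 0
  ups-downs zero = refl
  ups-downs (suc a) = ups-downs a

  ups-toPath : ∀ g n → ups (toPath g n) ≡ n
  ups-toPath g zero = ups-downs (g 0)
  ups-toPath g (suc n) = trans (ups-downs-++ (g 0) _) (cong suc (ups-toPath (λ i → g (suc i)) n))

  gaps-downs-++-head : ∀ a w → gaps (downs a ++ w) 0 ≡ a + gaps w 0
  gaps-downs-++-head zero w = refl
  gaps-downs-++-head (suc a) w = cong suc (gaps-downs-++-head a w)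

  gaps-downs-++-tail : ∀ a w i → gaps (downs a ++ w) (suc i) ≡ gaps w (suc i)
  gaps-downs-++-tail zero w i = refl
  gaps-downs-++-tail (suc a) w i = gaps-downs-++-tail a w i

  gaps-toPath : ∀ g n i → i ≤ℕ n → gaps (toPath g n) i ≡ g i
  gaps-toPath g zero zero _ = trans (cong (λ w → gaps w 0) (sym (LP.++-identityʳ (downs (g 0)))))
      (trans (gaps-downs-++-head (g 0) []) (ℕₚ.+-identityʳ (g 0)))
  gaps-toPath g (suc n) zero _ = trans (gaps-downs-++-head (g 0) _) (ℕₚ.+-identityʳ (g 0))
  gaps-toPath g (suc n) (suc i) (s≤s le) = trans (gaps-downs-++-tail (g 0) _ i) (gaps-toPath (λ j → g (suc j)) n i le)

  toPath-injective : ∀ n g h → toPath g n ≡ toPath h n → ∀ i → i ≤ℕ n → g i ≡ h i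
  toPath-injective n g h e i le = trans (sym (gaps-toPath g n i le))
      (trans (cong (λ w → gaps w i) e) (gaps-toPath h n i le))

  length-downs : ∀ a → length (downs a) ≡ a
  length-downs zero = refl
  length-downs (suc a) = cong suc (length-downs a)

  length-toPath : ∀ g n → length (toPath g n) ≡ n + δ g (suc n)
  length-toPath g zero = trans (length-downs (g 0)) (sym (ℕₚ.+-identityʳ (g 0)))
  length-toPath g (suc n) = begin
      length (downs (g 0) ++ U ∷ toPath (λ i → g (suc i)) n)
    ≡⟨ LP.length-++ (downs (g 0)) ⟩
      length (downs (g 0)) + suc (length (toPath (λ i → g (suc i)) n))
    ≡⟨ cong₂ (λ a b → a + suc b) (length-downs (g 0)) (length-toPath (λ i → g (suc i)) n) ⟩
      g 0 + suc (n + δ (λ i → g (suc i)) (suc n))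
    ≡⟨ rearrange (g 0) n (δ (λ i → g (suc i)) (suc n)) ⟩
      suc n + (g 0 + δ (λ i → g (suc i)) (suc n))
    ∎ where
    open ≡-Reasoning
    rearrange : ∀ a n d → a + suc (n + d) ≡ suc n + (a + d)
    rearrange a n d = trans (ℕₚ.+-suc a (n + d))
        (cong suc (trans (sym (ℕₚ.+-assoc a n d)) (trans (cong (_+ d) (ℕₚ.+-comm a n)) (ℕₚ.+-assoc n a d))))

  δ-last : ∀ g k → δ g (suc k) ≡ δ g k + g k
  δ-last g zero = ℕₚ.+-comm (g 0) 0
  δ-last g (suc k) = trans (cong (g 0 +_) (δ-last (λ i → g (suc i)) k)) (sym (ℕₚ.+-assoc (g 0) _ _))

  δ-mono : ∀ g {j k} → j ≤ℕ k → δ g j ≤ℕ δ g k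
  δ-mono g {zero} {k} _ = z≤n
  δ-mono g {suc j} {suc k} (s≤s le) = ℕₚ.+-monoʳ-≤ (g 0) (δ-mono (λ i → g (suc i)) le)

  δ-cong : ∀ k {g h : ℕ → ℕ} → (∀ i → i <ℕ k → g i ≡ h i) → δ g k ≡ δ h k
  δ-cong zero e = refl
  δ-cong (suc k) e = cong₂ _+_ (e 0 (s≤s z≤n)) (δ-cong k (λ i lt → e (suc i) (s≤s lt)))

module Validity where

  open Gaps
  open Words using (is𝓕)
  open BoolFacts
  open import Data.Nat as ℕ using (ℕ; zero; suc; _+_; _∸_; z≤n; s≤s; _≤ᵇ_) renaming (_≤_ to _≤ℕ_; _<_ to _<ℕ_)
  import Data.Nat.Properties as ℕₚ
  open import Data.Bool using (true; false; _∨_)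
  open import Data.List using (List; []; _∷_; _++_; replicate)
  open import Data.Product using (_×_; _,_; proj₁; proj₂)
  open import Relation.Binary.PropositionalEquality
  open import Relation.Nullary using (yes; no)
  open import Data.Empty using (⊥-elim)

  -- DUU occurs exactly when a nonempty run k is followed by an empty run k + 1 that is not the last run.
  record ValidGaps (p n : ℕ) (g : ℕ → ℕ) : Set where
    field
      dyck  : ∀ k → 1 ≤ℕ k → k ≤ℕ n → δ g k <ℕ k
      total : δ g (suc n) ≡ n
      noDUU : ∀ k → suc k <ℕ n → 1 ≤ℕ g k → 1 ≤ℕ g (suc k)
      gap≤p : ∀ k → k ≤ℕ n → g k ≤ℕ p

  dyck-downs-≤ : ∀ a h w → a ≤ℕ h → dyckFrom h (downs a ++ w) ≡ dyckFrom (h ∸ a) w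
  dyck-downs-≤ zero h w _ = refl
  dyck-downs-≤ (suc a) (suc h) w (s≤s le) = dyck-downs-≤ a h w le

  dyck-downs-> : ∀ a h w → h <ℕ a → dyckFrom h (downs a ++ w) ≡ false
  dyck-downs-> (suc a) zero w _ = refl
  dyck-downs-> (suc a) (suc h) w (s≤s lt) = dyck-downs-> a h w lt

  dyck-downs⇒ : ∀ a h → dyckFrom h (downs a) ≡ true → a ≡ h
  dyck-downs⇒ zero zero _ = refl
  dyck-downs⇒ (suc a) (suc h) e = cong suc (dyck-downs⇒ a h e)

  dyck-downs⇐ : ∀ a → dyckFrom a (downs a) ≡ true
  dyck-downs⇐ zero = refl
  dyck-downs⇐ (suc a) = dyck-downs⇐ a

  dyck-U : ∀ h w → dyckFrom h (U ∷ w) ≡ dyckFrom (suc h) w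
  dyck-U zero w = refl
  dyck-U (suc h) w = refl

  DyckGaps : ℕ → (ℕ → ℕ) → ℕ → Set
  DyckGaps h g n = (∀ k → 1 ≤ℕ k → k ≤ℕ n → δ g k <ℕ h + k) × δ g (suc n) ≡ h + n

  +-suc-∸ : ∀ a h x → a ≤ℕ h → a + (suc (h ∸ a) + x) ≡ h + suc x
  +-suc-∸ a h x le = trans (ℕₚ.+-suc a ((h ∸ a) + x)) (trans (cong suc (sym (ℕₚ.+-assoc a (h ∸ a) x)))
      (trans (cong (λ z → suc (z + x)) (ℕₚ.m+[n∸m]≡n le)) (sym (ℕₚ.+-suc h x))))

  dyck-toPath⇒ : ∀ n h g → dyckFrom h (toPath g n) ≡ true → DyckGaps h g n
  dyck-toPath⇒ zero h g e = (λ k k1 kn → ⊥-elim (ℕₚ.<⇒≱ k1 kn)) , trans (ℕₚ.+-identityʳ (g 0))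
      (trans (dyck-downs⇒ (g 0) h e) (sym (ℕₚ.+-identityʳ h)))
  dyck-toPath⇒ (suc n) h g e with g 0 ℕ.≤? h
  ... | no ¬le = ⊥-elim (false≢true (trans (sym (dyck-downs-> (g 0) h _ (ℕₚ.≰⇒> ¬le))) e))
  ... | yes le = above , returns
    where
    a0 : ℕ
    a0 = g 0
    g' : ℕ → ℕ
    g' i = g (suc i)
    IH : DyckGaps (suc (h ∸ a0)) g' n
    IH = dyck-toPath⇒ n (suc (h ∸ a0)) g'
        (trans (sym (dyck-U (h ∸ a0) (toPath g' n))) (trans (sym (dyck-downs-≤ a0 h _ le)) e))
    above : ∀ k → 1 ≤ℕ k → k ≤ℕ suc n → δ g k <ℕ h + k
    above (suc zero) _ _ = subst (λ z → z <ℕ h + 1) (sym (ℕₚ.+-identityʳ a0))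
        (subst (λ z → a0 <ℕ z) (sym (ℕₚ.+-comm h 1)) (s≤s le))
    above (suc (suc k)) _ (s≤s kn) = subst (λ z → a0 + δ g' (suc k) <ℕ z) (+-suc-∸ a0 h (suc k) le)
        (ℕₚ.+-monoʳ-< a0 (proj₁ IH (suc k) (s≤s z≤n) kn))
    returns : δ g (suc (suc n)) ≡ h + suc n
    returns = trans (cong (a0 +_) (proj₂ IH)) (+-suc-∸ a0 h n le)

  dyck-toPath⇐ : ∀ n h g → DyckGaps h g n → dyckFrom h (toPath g n) ≡ true
  dyck-toPath⇐ zero h g (_ , t) = subst (λ z → dyckFrom h (downs z) ≡ true)
      (sym (trans (sym (ℕₚ.+-identityʳ (g 0))) (trans t (ℕₚ.+-identityʳ h)))) (dyck-downs⇐ h)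
  dyck-toPath⇐ (suc n) h g (f , t) = trans (dyck-downs-≤ a0 h _ le)
      (trans (dyck-U (h ∸ a0) (toPath g' n)) (dyck-toPath⇐ n (suc (h ∸ a0)) g' (above , returns)))
    where
    a0 : ℕ
    a0 = g 0
    g' : ℕ → ℕ
    g' i = g (suc i)
    le : a0 ≤ℕ h
    le = ℕₚ.≤-pred (subst₂ _<ℕ_ (ℕₚ.+-identityʳ a0) (ℕₚ.+-comm h 1) (f 1 (s≤s z≤n) (s≤s z≤n)))
    above : ∀ k → 1 ≤ℕ k → k ≤ℕ n → δ g' k <ℕ suc (h ∸ a0) + k
    above k k1 kn = ℕₚ.+-cancelˡ-< a0 (δ g' k) _
        (subst (λ z → a0 + δ g' k <ℕ z) (sym (+-suc-∸ a0 h k le)) (f (suc k) (s≤s z≤n) (s≤s kn)))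
    returns : δ g' (suc n) ≡ suc (h ∸ a0) + n
    returns = ℕₚ.+-cancelˡ-≡ a0 (δ g' (suc n)) _ (trans t (sym (+-suc-∸ a0 h n le)))

  noDUU-downs : ∀ a → occurs DUU (downs a) ≡ false
  noDUU-downs zero = refl
  noDUU-downs (suc zero) = refl
  noDUU-downs (suc (suc a)) = noDUU-downs (suc a)

  occursDUU-downs-U : ∀ a w → occurs DUU (downs (suc a) ++ U ∷ w) ≡ (isPrefix (U ∷ []) w ∨ occurs DUU w)
  occursDUU-downs-U zero w = refl
  occursDUU-downs-U (suc a) w = occursDUU-downs-U a w

  DUUGaps : (ℕ → ℕ) → ℕ → Set
  DUUGaps g n = ∀ k → suc k <ℕ n → 1 ≤ℕ g k → 1 ≤ℕ g (suc k)

  startsU-toPath⁻ : ∀ g n → isPrefix (U ∷ []) (toPath g n) ≡ true → g 0 ≡ 0 × 1 ≤ℕ n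
  startsU-toPath⁻ g zero e with g 0
  startsU-toPath⁻ g zero () | zero
  startsU-toPath⁻ g zero () | suc a
  startsU-toPath⁻ g (suc n) e with g 0
  ... | zero = refl , s≤s z≤n
  startsU-toPath⁻ g (suc n) () | suc a

  startsU-toPath⁺ : ∀ g n → g 0 ≡ 0 → 1 ≤ℕ n → isPrefix (U ∷ []) (toPath g n) ≡ true
  startsU-toPath⁺ g (suc n) e _ rewrite e = refl

  noDUU-toPath⇒ : ∀ n g → occurs DUU (toPath g n) ≡ false → DUUGaps g n
  noDUU-toPath⇒ zero g e k ()
  noDUU-toPath⇒ (suc n) g e zero (s≤s 1n) g0 with g 0 in eq
  ... | zero = ⊥-elim (ℕₚ.<⇒≱ g0 z≤n)
  ... | suc a0 with g 1 in eq1
  ...   | suc b = s≤s z≤n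
  ...   | zero = ⊥-elim (true≢false (trans (sym (startsU-toPath⁺ (λ i → g (suc i)) n eq1 1n))
      (proj₁ (∨-false⁻ (trans (sym (occursDUU-downs-U a0 _)) e)))))
  noDUU-toPath⇒ (suc n) g e (suc k) (s≤s lt) g0 = noDUU-toPath⇒ n (λ i → g (suc i)) (occ-tail (g 0) e) k lt g0
    where
    occ-tail : ∀ a0 → occurs DUU (downs a0 ++ U ∷ toPath (λ i → g (suc i)) n) ≡ false →
        occurs DUU (toPath (λ i → g (suc i)) n) ≡ false
    occ-tail zero e' = e'
    occ-tail (suc a0) e' = proj₂ (∨-false⁻ (trans (sym (occursDUU-downs-U a0 _)) e'))

  noDUU-toPath⇐ : ∀ n g → DUUGaps g n → occurs DUU (toPath g n) ≡ false
  noDUU-toPath⇐ zero g d = noDUU-downs (g 0)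
  noDUU-toPath⇐ (suc n) g d = go (g 0) refl
    where
    g' : ℕ → ℕ
    g' = λ i → g (suc i)
    IH : occurs DUU (toPath g' n) ≡ false
    IH = noDUU-toPath⇐ n g' (λ k lt gk → d (suc k) (s≤s lt) gk)
    go : ∀ a0 → g 0 ≡ a0 → occurs DUU (downs a0 ++ U ∷ toPath g' n) ≡ false
    go zero _ = IH
    go (suc a0) e0 = trans (occursDUU-downs-U a0 _) (∨-false⁺ hp IH)
      where
      hp : isPrefix (U ∷ []) (toPath g' n) ≡ false
      hp with isPrefix (U ∷ []) (toPath g' n) in ep
      ... | false = refl
      ... | true with startsU-toPath⁻ g' n ep
      ...   | g10 , 1n = ⊥-elim
          (ℕₚ.<⇒≱ (subst (λ z → 1 ≤ℕ z) g10 (d 0 (s≤s 1n) (subst (λ z → 1 ≤ℕ z) (sym e0) (s≤s z≤n)))) z≤n)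

  prefixDs-downs-U : ∀ j a w → isPrefix (replicate j D) (downs a ++ U ∷ w) ≡ (j ≤ᵇ a)
  prefixDs-downs-U zero a w = refl
  prefixDs-downs-U (suc j) zero w = refl
  prefixDs-downs-U (suc j) (suc a) w = trans (prefixDs-downs-U j a w) (sym (≤ᵇ-suc j a))

  prefixDs-downs : ∀ j a → isPrefix (replicate j D) (downs a) ≡ (j ≤ᵇ a)
  prefixDs-downs zero a = refl
  prefixDs-downs (suc j) zero = refl
  prefixDs-downs (suc j) (suc a) = trans (prefixDs-downs j a) (sym (≤ᵇ-suc j a))

  module LongDescents (p : ℕ) where
    α : List Step
    α = replicate (suc p) D

    noDᵖ⁺¹-downs-U⁻ : ∀ a w → occurs α (downs a ++ U ∷ w) ≡ false → a ≤ℕ p × occurs α w ≡ false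
    noDᵖ⁺¹-downs-U⁻ zero w e = z≤n , e
    noDᵖ⁺¹-downs-U⁻ (suc a) w e with ∨-false⁻ e
    ... | e1 , e2 = ℕₚ.≤-pred (≤ᵇ-false⁻ (suc p) (suc a)
        (trans (sym (prefixDs-downs-U (suc p) (suc a) w)) e1)) , proj₂ (noDᵖ⁺¹-downs-U⁻ a w e2)

    noDᵖ⁺¹-downs-U⁺ : ∀ a w → a ≤ℕ p → occurs α w ≡ false → occurs α (downs a ++ U ∷ w) ≡ false
    noDᵖ⁺¹-downs-U⁺ zero w _ e = e
    noDᵖ⁺¹-downs-U⁺ (suc a) w le e = ∨-false⁺
        (trans (prefixDs-downs-U (suc p) (suc a) w) (≤ᵇ-false⁺ (s≤s le))) (noDᵖ⁺¹-downs-U⁺ a w (ℕₚ.<⇒≤ le) e)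

    noDᵖ⁺¹-downs⁻ : ∀ a → occurs α (downs a) ≡ false → a ≤ℕ p
    noDᵖ⁺¹-downs⁻ zero e = z≤n
    noDᵖ⁺¹-downs⁻ (suc a) e = ℕₚ.≤-pred
        (≤ᵇ-false⁻ (suc p) (suc a) (trans (sym (prefixDs-downs (suc p) (suc a))) (proj₁ (∨-false⁻ e))))

    noDᵖ⁺¹-downs⁺ : ∀ a → a ≤ℕ p → occurs α (downs a) ≡ false
    noDᵖ⁺¹-downs⁺ zero _ = refl
    noDᵖ⁺¹-downs⁺ (suc a) le = ∨-false⁺ (trans (prefixDs-downs (suc p) (suc a)) (≤ᵇ-false⁺ (s≤s le)))
        (noDᵖ⁺¹-downs⁺ a (ℕₚ.<⇒≤ le))

    gap≤p-toPath⇒ : ∀ n g → occurs α (toPath g n) ≡ false → ∀ k → k ≤ℕ n → g k ≤ℕ p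
    gap≤p-toPath⇒ zero g e zero _ = noDᵖ⁺¹-downs⁻ (g 0) e
    gap≤p-toPath⇒ (suc n) g e zero _ = proj₁ (noDᵖ⁺¹-downs-U⁻ (g 0) _ e)
    gap≤p-toPath⇒ (suc n) g e (suc k) (s≤s le) = gap≤p-toPath⇒ n (λ i → g (suc i))
        (proj₂ (noDᵖ⁺¹-downs-U⁻ (g 0) _ e)) k le

    gap≤p-toPath⇐ : ∀ n g → (∀ k → k ≤ℕ n → g k ≤ℕ p) → occurs α (toPath g n) ≡ false
    gap≤p-toPath⇐ zero g d = noDᵖ⁺¹-downs⁺ (g 0) (d 0 z≤n)
    gap≤p-toPath⇐ (suc n) g d = noDᵖ⁺¹-downs-U⁺ (g 0) _ (d 0 z≤n)
        (gap≤p-toPath⇐ n (λ i → g (suc i)) (λ k le → d (suc k) (s≤s le)))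

    is𝓕⇒ValidGaps : ∀ n g → is𝓕 p (toPath g n) ≡ true → ValidGaps p n g
    is𝓕⇒ValidGaps n g e with ∧-true⁻ e
    ... | e1 , e23 with ∧-true⁻ e23
    ... | e2 , e3 = record
      { dyck = λ k k1 kn → proj₁ (dyck-toPath⇒ n 0 g e1) k k1 kn
      ; total = proj₂ (dyck-toPath⇒ n 0 g e1)
      ; noDUU = noDUU-toPath⇒ n g (not-true⁻ e2)
      ; gap≤p = gap≤p-toPath⇒ n g (not-true⁻ e3) }

    ValidGaps⇒is𝓕 : ∀ n g → ValidGaps p n g → is𝓕 p (toPath g n) ≡ true
    ValidGaps⇒is𝓕 n g v = ∧-true⁺ (dyck-toPath⇐ n 0 g ((λ k k1 kn → ValidGaps.dyck v k k1 kn) , ValidGaps.total v))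
                     (∧-true⁺ (not-true⁺ (noDUU-toPath⇐ n g (ValidGaps.noDUU v)))
                         (not-true⁺ (gap≤p-toPath⇐ n g (ValidGaps.gap≤p v))))

  positive-persists : ∀ {n g} → DUUGaps g n → ∀ j → j <ℕ n → 1 ≤ℕ δ g j → 1 ≤ℕ g j
  positive-persists v zero lt ()
  positive-persists {n} {g} v (suc j) lt d1 with g j ℕ.≟ 0
  ... | no ne = v j lt (ℕₚ.n≢0⇒n>0 ne)
  ... | yes e0 = v j lt (positive-persists v j (ℕₚ.<-trans (ℕₚ.n<1+n j) lt)
      (subst (1 ≤ℕ_) (trans (δ-last g j) (trans (cong (δ g j +_) e0) (ℕₚ.+-identityʳ _))) d1))

module StanleyOrder where

  open Gaps
  open BoolFacts using (∧-true⁻; ∧-true⁺)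
  open import Data.Nat using (ℕ; zero; suc; z≤n; s≤s) renaming (_≤_ to _≤ℕ_; _+_ to _+ℕ_)
  import Data.Nat.Properties as ℕₚ
  open import Data.Integer as ℤ using (ℤ; +_; 0ℤ; 1ℤ; _+_; -_; _≤ᵇ_) renaming (_≤_ to _≤ℤ_)
  import Data.Integer.Properties as ZP
  open import Data.Integer.Tactic.RingSolver using (solve-∀)
  open import Data.Bool using (Bool; true; _∧_; T)
  open import Data.Bool.ListAction using (all)
  open import Data.Unit using (tt)
  open import Data.List using (List; []; _∷_; zipWith; length)
  open import Data.Product using (_,_)
  open import Relation.Binary.PropositionalEquality

  step : Step → ℤ
  step U = 1ℤ
  step D = - 1ℤ

  heights-∷ : ∀ h x w → heights h (x ∷ w) ≡ (h + step x) ∷ heights (h + step x) w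
  heights-∷ h U w = refl
  heights-∷ h D w = refl

  heights≤ : ℤ → ℤ → List Step → List Step → Bool
  heights≤ a b P Q = all (λ z → z) (zipWith _≤ᵇ_ (heights a P) (heights b Q))

  heights≤-∷ : ∀ a b x y P Q → heights≤ a b (x ∷ P) (y ∷ Q) ≡
      (((a + step x) ≤ᵇ (b + step y)) ∧ heights≤ (a + step x) (b + step y) P Q)
  heights≤-∷ a b x y P Q rewrite heights-∷ a x P | heights-∷ b y Q = refl

  height : List Step → ℕ → ℤ
  height w zero = 0ℤ
  height [] (suc t) = 0ℤ
  height (x ∷ w) (suc t) = step x + height w t

  ≤ᵇℤ-true⁻ : ∀ {i j} → (i ≤ᵇ j) ≡ true → i ≤ℤ j
  ≤ᵇℤ-true⁻ e = ZP.≤ᵇ⇒≤ (subst T (sym e) tt)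

  ≤ᵇℤ-true⁺ : ∀ {i j} → i ≤ℤ j → (i ≤ᵇ j) ≡ true
  ≤ᵇℤ-true⁺ {i} {j} le with i ≤ᵇ j | ZP.≤⇒≤ᵇ le
  ... | true | _ = refl

  +-reassoc : ∀ a x h → a + (x + h) ≡ (a + x) + h
  +-reassoc a x h = sym (ZP.+-assoc a x h)

  heights≤⇒height≤ : ∀ P Q a b → length P ≡ length Q → heights≤ a b P Q ≡ true → ∀ t → 1 ≤ℕ t → t ≤ℕ length P
      → (a + height P t) ≤ℤ (b + height Q t)
  heights≤⇒height≤ (x ∷ P) (y ∷ Q) a b l e (suc zero) _ _ with ∧-true⁻ {(a + step x) ≤ᵇ (b + step y)}
      {heights≤ (a + step x) (b + step y) P Q} (trans (sym (heights≤-∷ a b x y P Q)) e)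
  ... | e1 , _ = subst₂ _≤ℤ_ (sym (trans (+-reassoc a (step x) 0ℤ) (ZP.+-identityʳ (a + step x))))
      (sym (trans (+-reassoc b (step y) 0ℤ) (ZP.+-identityʳ (b + step y))))
      (≤ᵇℤ-true⁻ {a + step x} {b + step y} e1)
  heights≤⇒height≤ (x ∷ P) (y ∷ Q) a b l e (suc (suc t)) _ (s≤s le) with ∧-true⁻
      {(a + step x) ≤ᵇ (b + step y)} {heights≤ (a + step x) (b + step y) P Q}
      (trans (sym (heights≤-∷ a b x y P Q)) e)
  ... | _ , e2 = subst₂ _≤ℤ_ (sym (+-reassoc a (step x) (height P (suc t))))
      (sym (+-reassoc b (step y) (height Q (suc t))))
      (heights≤⇒height≤ P Q (a + step x) (b + step y) (ℕₚ.suc-injective l) e2 (suc t) (s≤s z≤n) le)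

  height≤⇒heights≤ : ∀ P Q a b → length P ≡ length Q →
      (∀ t → 1 ≤ℕ t → t ≤ℕ length P → (a + height P t) ≤ℤ (b + height Q t)) → heights≤ a b P Q ≡ true
  height≤⇒heights≤ [] [] a b l h = refl
  height≤⇒heights≤ (x ∷ P) (y ∷ Q) a b l h = trans (heights≤-∷ a b x y P Q) (∧-true⁺ (≤ᵇℤ-true⁺ first) rest)
    where
    first : (a + step x) ≤ℤ (b + step y)
    first = subst₂ _≤ℤ_ (trans (+-reassoc a (step x) 0ℤ) (ZP.+-identityʳ (a + step x)))
        (trans (+-reassoc b (step y) 0ℤ) (ZP.+-identityʳ (b + step y))) (h 1 (s≤s z≤n) (s≤s z≤n))
    rest : heights≤ (a + step x) (b + step y) P Q ≡ true
    rest = height≤⇒heights≤ P Q (a + step x) (b + step y) (ℕₚ.suc-injective l) (λ t t1 tl → subst₂ _≤ℤ_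
        (+-reassoc a (step x) (height P t)) (+-reassoc b (step y) (height Q t))
        (h (suc t) (s≤s z≤n) (s≤s tl)))
  height≤⇒heights≤ [] (y ∷ Q) a b () h
  height≤⇒heights≤ (x ∷ P) [] a b () h

  -- After t steps the height is 2 · upsBefore w t - t, so comparing heights amounts to comparing numbers of U's.
  upsBefore : List Step → ℕ → ℕ
  upsBefore [] t = 0
  upsBefore (x ∷ w) zero = 0
  upsBefore (U ∷ w) (suc t) = suc (upsBefore w t)
  upsBefore (D ∷ w) (suc t) = upsBefore w t

  height-upsBefore : ∀ w t → t ≤ℕ length w → height w t + + t ≡ + (upsBefore w t +ℕ upsBefore w t)
  height-upsBefore [] zero _ = refl
  height-upsBefore (x ∷ w) zero _ = refl
  height-upsBefore (U ∷ w) (suc t) (s≤s le) = begin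
      (1ℤ + height w t) + + suc t
    ≡⟨ rearrange (height w t) (+ t) ⟩
      + 2 + (height w t + + t)
    ≡⟨ cong (λ z → + 2 + z) (height-upsBefore w t le) ⟩
      + (2 +ℕ (upsBefore w t +ℕ upsBefore w t))
    ≡⟨ cong (λ z → + suc z) (sym (ℕₚ.+-suc (upsBefore w t) (upsBefore w t))) ⟩
      + (suc (upsBefore w t) +ℕ suc (upsBefore w t))
    ∎ where
    open ≡-Reasoning
    rearrange : ∀ h tt → (1ℤ + h) + (1ℤ + tt) ≡ + 2 + (h + tt)
    rearrange = solve-∀
  height-upsBefore (D ∷ w) (suc t) (s≤s le) = trans (rearrange (height w t) (+ t)) (height-upsBefore w t le)
    where
    rearrange : ∀ h tt → (- 1ℤ + h) + (1ℤ + tt) ≡ h + tt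
    rearrange = solve-∀

  +-cancelʳ-≤ℤ : ∀ a b c → (a + c) ≤ℤ (b + c) → a ≤ℤ b
  +-cancelʳ-≤ℤ a b c le = subst₂ _≤ℤ_ (rearrange a c) (rearrange b c) (ZP.+-monoˡ-≤ (- c) le)
    where
    rearrange : ∀ x y → (x + y) + - y ≡ x
    rearrange = solve-∀

  height≤⇒upsBefore≤ : ∀ P Q t → t ≤ℕ length P → t ≤ℕ length Q → height P t ≤ℤ height Q t → upsBefore P t ≤ℕ
      upsBefore Q t
  height≤⇒upsBefore≤ P Q t lp lq le = half
      (ZP.drop‿+≤+ (subst₂ _≤ℤ_ (height-upsBefore P t lp) (height-upsBefore Q t lq) (ZP.+-monoˡ-≤ (+ t) le)))
    where
    half : ∀ {m n} → m +ℕ m ≤ℕ n +ℕ n → m ≤ℕ n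
    half {m} {n} h = ℕₚ.≮⇒≥ (λ lt → ℕₚ.<⇒≱ (ℕₚ.+-mono-< lt lt) h)

  upsBefore≤⇒height≤ : ∀ P Q t → t ≤ℕ length P → t ≤ℕ length Q → upsBefore P t ≤ℕ upsBefore Q t → height P t
      ≤ℤ height Q t
  upsBefore≤⇒height≤ P Q t lp lq le = +-cancelʳ-≤ℤ (height P t) (height Q t) (+ t) (subst₂ _≤ℤ_
      (sym (height-upsBefore P t lp)) (sym (height-upsBefore Q t lq)) (ℤ.+≤+ (ℕₚ.+-mono-≤ le le)))

  ≤St⇒upsBefore≤ : ∀ P Q → length P ≡ length Q → (P ≤St Q) ≡ true → ∀ t → t ≤ℕ length P → upsBefore P t ≤ℕ upsBefore Q t
  ≤St⇒upsBefore≤ P Q l e zero _ = upsBefore-zero P Q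
    where
    upsBefore-zero : ∀ P Q → upsBefore P 0 ≤ℕ upsBefore Q 0
    upsBefore-zero [] Q = z≤n
    upsBefore-zero (x ∷ P) Q = z≤n
  ≤St⇒upsBefore≤ P Q l e (suc t) le = height≤⇒upsBefore≤ P Q (suc t) le (subst (suc t ≤ℕ_) l le)
     (subst₂ _≤ℤ_ (ZP.+-identityˡ _) (ZP.+-identityˡ _) (heights≤⇒height≤ P Q 0ℤ 0ℤ l e (suc t) (s≤s z≤n) le))

  upsBefore≤⇒≤St : ∀ P Q → length P ≡ length Q → (∀ t → t ≤ℕ length P → upsBefore P t ≤ℕ upsBefore Q t) →
      (P ≤St Q) ≡ true
  upsBefore≤⇒≤St P Q l h = height≤⇒heights≤ P Q 0ℤ 0ℤ l (λ t t1 tl → subst₂ _≤ℤ_ (sym (ZP.+-identityˡ _))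
      (sym (ZP.+-identityˡ _)) (upsBefore≤⇒height≤ P Q t tl (subst (t ≤ℕ_) l tl) (h t tl)))

module StanleyOrderGaps where

  open Gaps
  open StanleyOrder
  open import Data.Nat as ℕ using (ℕ; zero; suc; _∸_; _+_; z≤n; s≤s) renaming (_≤_ to _≤ℕ_; _<_ to _<ℕ_)
  import Data.Nat.Properties as ℕₚ
  open import Data.List using ([]; _∷_; _++_; length)
  open import Data.Product using (_,_; ∃)
  open import Relation.Binary.PropositionalEquality
  open import Data.Empty using (⊥-elim)
  open import Relation.Nullary using (yes; no)
  open import Data.Bool using (true)

  upsBefore-zero : ∀ w → upsBefore w 0 ≡ 0
  upsBefore-zero [] = refl
  upsBefore-zero (x ∷ w) = refl

  upsBefore-downs-++ : ∀ a w t → upsBefore (downs a ++ w) t ≡ upsBefore w (t ∸ a)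
  upsBefore-downs-++ zero w t = refl
  upsBefore-downs-++ (suc a) w zero = sym (upsBefore-zero w)
  upsBefore-downs-++ (suc a) w (suc t) = upsBefore-downs-++ a w t

  upsBefore≤ups : ∀ w t → upsBefore w t ≤ℕ ups w
  upsBefore≤ups [] t = z≤n
  upsBefore≤ups (x ∷ w) zero = z≤n
  upsBefore≤ups (U ∷ w) (suc t) = s≤s (upsBefore≤ups w t)
  upsBefore≤ups (D ∷ w) (suc t) = upsBefore≤ups w t

  upsBefore-toPath≤ : ∀ g n t → upsBefore (toPath g n) t ≤ℕ n
  upsBefore-toPath≤ g n t = subst (upsBefore (toPath g n) t ≤ℕ_) (ups-toPath g n) (upsBefore≤ups (toPath g n) t)

  suc-+-interchange : ∀ k a d → suc k + (a + d) ≡ a + suc (k + d)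
  suc-+-interchange k a d = trans (cong suc (trans (sym (ℕₚ.+-assoc k a d))
      (trans (cong (_+ d) (ℕₚ.+-comm k a)) (ℕₚ.+-assoc a k d)))) (sym (ℕₚ.+-suc a (k + d)))

  <⇒∃suc : ∀ {a t} → a <ℕ t → ∃ (λ u → t ≡ a + suc u)
  <⇒∃suc {a} {t} lt = (t ∸ suc a) , sym (trans (ℕₚ.+-suc a (t ∸ suc a)) (ℕₚ.m+[n∸m]≡n lt))

  upsBefore-downs-U : ∀ a w u → upsBefore (downs a ++ U ∷ w) (a + suc u) ≡ suc (upsBefore w u)
  upsBefore-downs-U a w u = trans (upsBefore-downs-++ a (U ∷ w) (a + suc u))
      (cong (upsBefore (U ∷ w)) (ℕₚ.m+n∸m≡n a (suc u)))

  upsBefore-downs-U-short : ∀ a w t → t ≤ℕ a → upsBefore (downs a ++ U ∷ w) t ≡ 0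
  upsBefore-downs-U-short a w t le = trans (upsBefore-downs-++ a (U ∷ w) t)
      (trans (cong (upsBefore (U ∷ w)) (ℕₚ.m≤n⇒m∸n≡0 le)) (upsBefore-zero (U ∷ w)))

  -- The k-th U of toPath g n is its step number k + δ g k.
  upsBefore-toPath⇒ : ∀ n g k t → 1 ≤ℕ k → k ≤ℕ n → k ≤ℕ upsBefore (toPath g n) t → k + δ g k ≤ℕ t
  upsBefore-toPath⇒ zero g k t k1 kn le = ⊥-elim (ℕₚ.<⇒≱ k1 kn)
  upsBefore-toPath⇒ (suc n) g k t k1 kn le with g 0 ℕ.<? t
  ... | no ¬lt = ⊥-elim (ℕₚ.<⇒≱ k1 (subst (k ≤ℕ_) (upsBefore-downs-U-short (g 0) _ t (ℕₚ.≮⇒≥ ¬lt)) le))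
  ... | yes lt with <⇒∃suc lt
  ...   | u , refl = go k k1 kn (subst (k ≤ℕ_) (upsBefore-downs-U (g 0) (toPath g' n) u) le)
    where
    g' : ℕ → ℕ
    g' = λ i → g (suc i)
    go : ∀ k → 1 ≤ℕ k → k ≤ℕ suc n → k ≤ℕ suc (upsBefore (toPath g' n) u) → k + δ g k ≤ℕ g 0 + suc u
    go (suc zero) _ _ _ = subst (_≤ℕ g 0 + suc u) (cong suc (sym (ℕₚ.+-identityʳ (g 0))))
        (subst (suc (g 0) ≤ℕ_) (sym (ℕₚ.+-suc (g 0) u)) (s≤s (ℕₚ.m≤m+n (g 0) u)))
    go (suc (suc k)) _ (s≤s kn') (s≤s le'') = subst (_≤ℕ g 0 + suc u) (sym (suc-+-interchange (suc k) (g 0) (δ g' (suc k))))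
        (ℕₚ.+-monoʳ-≤ (g 0) (s≤s (upsBefore-toPath⇒ n g' (suc k) u (s≤s z≤n) kn' le'')))

  upsBefore-toPath⇐ : ∀ n g k t → 1 ≤ℕ k → k ≤ℕ n → k + δ g k ≤ℕ t → k ≤ℕ upsBefore (toPath g n) t
  upsBefore-toPath⇐ zero g k t k1 kn le = ⊥-elim (ℕₚ.<⇒≱ k1 kn)
  upsBefore-toPath⇐ (suc n) g zero t () kn le
  upsBefore-toPath⇐ (suc n) g (suc k) t k1 kn le with <⇒∃suc {g 0} {t} (ℕₚ.≤-trans (s≤s (ℕₚ.m≤m+n (g 0) _))
      (ℕₚ.≤-trans (ℕₚ.≤-reflexive (cong suc (ℕₚ.+-comm (g 0) k)))
      (ℕₚ.≤-trans (s≤s (ℕₚ.+-monoʳ-≤ k (ℕₚ.m≤m+n (g 0) _))) le)))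
  ... | u , refl = subst (suc k ≤ℕ_) (sym (upsBefore-downs-U (g 0) (toPath g' n) u)) (go k kn le)
    where
    g' : ℕ → ℕ
    g' = λ i → g (suc i)
    go : ∀ k → suc k ≤ℕ suc n → suc k + δ g (suc k) ≤ℕ g 0 + suc u → suc k ≤ℕ suc (upsBefore (toPath g' n) u)
    go zero _ _ = s≤s z≤n
    go (suc k) (s≤s kn') le' = s≤s (upsBefore-toPath⇐ n g' (suc k) u (s≤s z≤n) kn'
       (ℕₚ.≤-pred (ℕₚ.+-cancelˡ-≤ (g 0) (suc (suc k + δ g' (suc k))) (suc u)
           (subst₂ _≤ℕ_ (suc-+-interchange (suc k) (g 0) (δ g' (suc k))) refl le'))))

  ≤St⇒δ≥ : ∀ n g h → length (toPath g n) ≡ length (toPath h n) → (toPath g n ≤St toPath h n) ≡ true → ∀ k → 1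
      ≤ℕ k → k ≤ℕ n → δ h k ≤ℕ δ g k
  ≤St⇒δ≥ n g h l e k k1 kn = ℕₚ.+-cancelˡ-≤ k (δ h k) (δ g k)
      (upsBefore-toPath⇒ n h k (k + δ g k) k1 kn (ℕₚ.≤-trans c1 c2))
    where
    tle : k + δ g k ≤ℕ length (toPath g n)
    tle = subst (k + δ g k ≤ℕ_) (sym (length-toPath g n)) (ℕₚ.+-mono-≤ kn (δ-mono g (ℕₚ.m≤n⇒m≤1+n kn)))
    c1 : k ≤ℕ upsBefore (toPath g n) (k + δ g k)
    c1 = upsBefore-toPath⇐ n g k (k + δ g k) k1 kn ℕₚ.≤-refl
    c2 : upsBefore (toPath g n) (k + δ g k) ≤ℕ upsBefore (toPath h n) (k + δ g k)
    c2 = ≤St⇒upsBefore≤ (toPath g n) (toPath h n) l e (k + δ g k) tle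

  δ≥⇒≤St : ∀ n g h → length (toPath g n) ≡ length (toPath h n) → (∀ k → 1 ≤ℕ k → k ≤ℕ n → δ h k ≤ℕ δ g k) →
      (toPath g n ≤St toPath h n) ≡ true
  δ≥⇒≤St n g h l hyp = upsBefore≤⇒≤St (toPath g n) (toPath h n) l f
    where
    f : ∀ t → t ≤ℕ length (toPath g n) → upsBefore (toPath g n) t ≤ℕ upsBefore (toPath h n) t
    f t _ with upsBefore (toPath g n) t in eq
    ... | zero = z≤n
    ... | suc c = upsBefore-toPath⇐ n h (suc c) t (s≤s z≤n) cn (ℕₚ.≤-trans
        (ℕₚ.+-monoʳ-≤ (suc c) (hyp (suc c) (s≤s z≤n) cn))
        (upsBefore-toPath⇒ n g (suc c) t (s≤s z≤n) cn (ℕₚ.≤-reflexive (sym eq))))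
      where
      cn : suc c ≤ℕ n
      cn = subst (_≤ℕ n) eq (upsBefore-toPath≤ g n t)

module Flips (p : ℕ) where

  open Gaps
  open Validity using (ValidGaps; positive-persists)
  open NatSearch using (least)
  open BoolFacts using (∧-true⁻; ∧-true⁺; ≤ᵇ-true⁻; ≤ᵇ-true⁺)
  open import Data.Bool using (Bool; true; false; _∧_; _∨_; T)
  open import Data.Nat as ℕ using (zero; suc; _∸_; _+_; z≤n; s≤s; _≤ᵇ_) renaming
      (_≤_ to _≤ℕ_; _<_ to _<ℕ_; _≡ᵇ_ to _=ℕ_)
  import Data.Nat.Properties as ℕₚ
  open import Data.Product using (_×_; _,_; ∃)
  open import Data.Sum using (_⊎_; inj₁; inj₂)
  open import Relation.Binary.PropositionalEquality
  open import Relation.Nullary using (¬_; Dec; yes; no)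
  open import Relation.Nullary.Decidable using (_×-dec_)
  open import Data.Empty using (⊥; ⊥-elim)

  -- flip g j moves one D from run j to run j + 1: the valley DU before the (j + 1)-th U becomes a peak UD.
  flip : (ℕ → ℕ) → ℕ → ℕ → ℕ
  flip g zero zero = g 0 ∸ 1
  flip g zero (suc zero) = suc (g 1)
  flip g zero (suc (suc i)) = g (suc (suc i))
  flip g (suc j) zero = g 0
  flip g (suc j) (suc i) = flip (λ x → g (suc x)) j i

  flip-at : ∀ g j → flip g j j ≡ g j ∸ 1
  flip-at g zero = refl
  flip-at g (suc j) = flip-at (λ x → g (suc x)) j

  flip-next : ∀ g j → flip g j (suc j) ≡ suc (g (suc j))
  flip-next g zero = refl
  flip-next g (suc j) = flip-next (λ x → g (suc x)) j

  flip-other : ∀ g j i → i ≢ j → i ≢ suc j → flip g j i ≡ g i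
  flip-other g zero zero ne _ = ⊥-elim (ne refl)
  flip-other g zero (suc zero) _ ne = ⊥-elim (ne refl)
  flip-other g zero (suc (suc i)) _ _ = refl
  flip-other g (suc j) zero _ _ = refl
  flip-other g (suc j) (suc i) ne ne' = flip-other (λ x → g (suc x)) j i (λ e → ne (cong suc e))
      (λ e → ne' (cong suc e))

  δ-flip-before : ∀ g j k → k ≤ℕ j → δ (flip g j) k ≡ δ g k
  δ-flip-before g j k le = δ-cong k (λ i lt → flip-other g j i (λ e → ℕₚ.<-irrefl e (ℕₚ.<-≤-trans lt le))
      (λ e → ℕₚ.<-irrefl e (ℕₚ.<-trans (ℕₚ.<-≤-trans lt le) (ℕₚ.n<1+n j))))

  δ-flip-next : ∀ g j → 1 ≤ℕ g j → δ (flip g j) (suc j) + 1 ≡ δ g (suc j)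
  δ-flip-next g j g1 = begin
      δ (flip g j) (suc j) + 1
    ≡⟨ cong (_+ 1) (δ-last (flip g j) j) ⟩
      δ (flip g j) j + flip g j j + 1
    ≡⟨ cong₂ (λ a b → a + b + 1) (δ-flip-before g j j ℕₚ.≤-refl) (flip-at g j) ⟩
      δ g j + (g j ∸ 1) + 1
    ≡⟨ trans (ℕₚ.+-assoc (δ g j) (g j ∸ 1) 1) (cong (δ g j +_) (ℕₚ.m∸n+n≡m g1)) ⟩
      δ g j + g j
    ≡⟨ sym (δ-last g j) ⟩
      δ g (suc j)
    ∎ where open ≡-Reasoning

  δ-flip-beyond : ∀ g j → 1 ≤ℕ g j → ∀ m → δ (flip g j) (suc (suc j) + m) ≡ δ g (suc (suc j) + m)
  δ-flip-beyond g j g1 zero = begin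
      δ (flip g j) (suc (suc j) + 0)
    ≡⟨ cong (δ (flip g j)) (ℕₚ.+-identityʳ (suc (suc j))) ⟩
      δ (flip g j) (suc (suc j))
    ≡⟨ δ-last (flip g j) (suc j) ⟩
      δ (flip g j) (suc j) + flip g j (suc j)
    ≡⟨ cong (δ (flip g j) (suc j) +_) (flip-next g j) ⟩
      δ (flip g j) (suc j) + suc (g (suc j))
    ≡⟨ trans (ℕₚ.+-suc (δ (flip g j) (suc j)) (g (suc j)))
        (trans (cong (_+ g (suc j)) (trans (ℕₚ.+-comm 1 _) (δ-flip-next g j g1))) refl) ⟩
      δ g (suc j) + g (suc j)
    ≡⟨ sym (δ-last g (suc j)) ⟩
      δ g (suc (suc j))
    ≡⟨ cong (δ g) (sym (ℕₚ.+-identityʳ (suc (suc j)))) ⟩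
      δ g (suc (suc j) + 0)
    ∎ where open ≡-Reasoning
  δ-flip-beyond g j g1 (suc m) = begin
      δ (flip g j) (suc (suc j) + suc m)
    ≡⟨ cong (δ (flip g j)) (ℕₚ.+-suc (suc (suc j)) m) ⟩
      δ (flip g j) (suc (suc (suc j) + m))
    ≡⟨ δ-last (flip g j) (suc (suc j) + m) ⟩
      δ (flip g j) (suc (suc j) + m) + flip g j (suc (suc j) + m)
    ≡⟨ cong₂ _+_ (δ-flip-beyond g j g1 m) (flip-other g j (suc (suc j) + m)
        (λ e → ℕₚ.<-irrefl (sym e) (s≤s (ℕₚ.≤-trans (ℕₚ.n≤1+n j) (ℕₚ.m≤m+n (suc j) m))))
        (λ e → ℕₚ.<-irrefl (sym e) (s≤s (s≤s (ℕₚ.m≤m+n j m))))) ⟩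
      δ g (suc (suc j) + m) + g (suc (suc j) + m)
    ≡⟨ sym (δ-last g (suc (suc j) + m)) ⟩
      δ g (suc (suc (suc j) + m))
    ≡⟨ cong (δ g) (sym (ℕₚ.+-suc (suc (suc j)) m)) ⟩
      δ g (suc (suc j) + suc m)
    ∎ where open ≡-Reasoning

  δ-flip-≢ : ∀ g j k → 1 ≤ℕ g j → k ≢ suc j → δ (flip g j) k ≡ δ g k
  δ-flip-≢ g j k g1 ne with k ℕ.≤? j
  ... | yes le = δ-flip-before g j k le
  ... | no ¬le = subst (λ z → δ (flip g j) z ≡ δ g z) (ℕₚ.m+[n∸m]≡n ssj≤k) (δ-flip-beyond g j g1 (k ∸ suc (suc j)))
    where
    ssj≤k : suc (suc j) ≤ℕ k
    ssj≤k = ℕₚ.≤∧≢⇒< (ℕₚ.≰⇒> ¬le) (λ e → ne (sym e))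

  δ-flip-≤ : ∀ g j k → 1 ≤ℕ g j → δ (flip g j) k ≤ℕ δ g k
  δ-flip-≤ g j k g1 with k ℕ.≟ suc j
  ... | yes refl = ℕₚ.≤-trans (ℕₚ.m≤m+n _ 1) (ℕₚ.≤-reflexive (δ-flip-next g j g1))
  ... | no ne = ℕₚ.≤-reflexive (δ-flip-≢ g j k g1 ne)

  -- Emptying run j after an earlier D would create DUU, and run j + 1 must stay ≤ p.
  Flippable : (ℕ → ℕ) → ℕ → Set
  Flippable g j = (1 ≤ℕ g j) × ((2 ≤ℕ g j) ⊎ (δ g j ≡ 0)) × (suc (g (suc j)) ≤ℕ p)

  flippableᵇ : (ℕ → ℕ) → ℕ → Bool
  flippableᵇ g j = (1 ≤ᵇ g j) ∧ (((2 ≤ᵇ g j) ∨ (δ g j =ℕ 0)) ∧ (suc (g (suc j)) ≤ᵇ p))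

  flippableᵇ⇒ : ∀ g j → flippableᵇ g j ≡ true → Flippable g j
  flippableᵇ⇒ g j e with ∧-true⁻ {1 ≤ᵇ g j} e
  ... | e1 , e23 with ∧-true⁻ {(2 ≤ᵇ g j) ∨ (δ g j =ℕ 0)} e23
  ... | e2 , e3 = ≤ᵇ-true⁻ 1 (g j) e1 , orc e2 , ≤ᵇ-true⁻ (suc (g (suc j))) p e3
    where
    orc : ((2 ≤ᵇ g j) ∨ (δ g j =ℕ 0)) ≡ true → (2 ≤ℕ g j) ⊎ (δ g j ≡ 0)
    orc ee with 2 ≤ᵇ g j in e4
    ... | true = inj₁ (≤ᵇ-true⁻ 2 (g j) e4)
    ... | false = inj₂ (ℕₚ.≡ᵇ⇒≡ (δ g j) 0 (subst T (sym ee) _))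

  flippableᵇ⇐ : ∀ g j → Flippable g j → flippableᵇ g j ≡ true
  flippableᵇ⇐ g j (g1 , g2 , g3) = ∧-true⁺ (≤ᵇ-true⁺ g1) (∧-true⁺ (orc g2) (≤ᵇ-true⁺ g3))
    where
    orc : (2 ≤ℕ g j) ⊎ (δ g j ≡ 0) → ((2 ≤ᵇ g j) ∨ (δ g j =ℕ 0)) ≡ true
    orc (inj₁ x) rewrite ≤ᵇ-true⁺ x = refl
    orc (inj₂ e) rewrite e with 2 ≤ᵇ g j
    ... | true = refl
    ... | false = refl

  2≤-from-sums : ∀ {a b c d} → a ≤ℕ b → 1 ≤ℕ c → suc (b + c) ≤ℕ a + d → 2 ≤ℕ d
  2≤-from-sums {a} {b} {c} {d} ab c1 h = ℕₚ.+-cancelˡ-≤ a 2 d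
      (ℕₚ.≤-trans (ℕₚ.≤-reflexive (e a)) (ℕₚ.≤-trans (s≤s (ℕₚ.+-mono-≤ ab c1)) h))
    where
    e : ∀ a → a + 2 ≡ suc (a + 1)
    e a = trans (ℕₚ.+-suc a 1) refl

  +-<-≤-contradiction : ∀ {a b c d} → a <ℕ b → c ≤ℕ d → b + d ≤ℕ a + c → ⊥
  +-<-≤-contradiction {a} {b} {c} {d} ab cd le = ℕₚ.<⇒≱ (ℕₚ.+-mono-<-≤ ab cd) le

  -- If Q is strictly above P at some U, take the least k at which it is strictly above P with run k of P
  -- shorter than p (one exists, since δ agrees at the end); then j = k - 1 is flippable and the flip stays below Q.
  module FlipTowards {n : ℕ} {g h : ℕ → ℕ} (2≤p : 2 ≤ℕ p) (vg : ValidGaps p n g) (vh : ValidGaps p n h)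
              (hle : ∀ k → 1 ≤ℕ k → k ≤ℕ n → δ h k ≤ℕ δ g k) where

    Ahead : ℕ → Set
    Ahead k = δ h k <ℕ δ g k

    Candidate : ℕ → Set
    Candidate k = ((1 ≤ℕ k) × (k ≤ℕ n)) × Ahead k × (suc (g k) ≤ℕ p)

    Candidate? : ∀ k → Dec (Candidate k)
    Candidate? k = ((1 ℕ.≤? k) ×-dec (k ℕ.≤? n)) ×-dec ((suc (δ h k) ℕ.≤? δ g k) ×-dec (suc (g k) ℕ.≤? p))

    blocked-ahead : ∀ k → Ahead k → ¬ (suc (g k) ≤ℕ p) → k ≤ℕ n → δ g k + g k ≤ℕ δ h k + h k → ⊥
    blocked-ahead k dk ng kn le = +-<-≤-contradiction dk
        (ℕₚ.≤-trans (ValidGaps.gap≤p vh k kn) (ℕₚ.≤-pred (ℕₚ.≰⇒> ng))) le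

    candidate-exists : ∀ m k → k + m ≡ n → 1 ≤ℕ k → Ahead k → ∃ Candidate
    candidate-exists m k e k1 dk with suc (g k) ℕ.≤? p
    ... | yes ok = k , (k1 , subst (k ≤ℕ_) e (ℕₚ.m≤m+n k m)) , dk , ok
    candidate-exists zero k e k1 dk | no ng = ⊥-elim (blocked-ahead k dk ng kn
        (ℕₚ.≤-reflexive (trans (sym (δ-last g k)) (trans tg (trans (sym th) (δ-last h k))))))
      where
      kn : k ≤ℕ n
      kn = subst (k ≤ℕ_) e (ℕₚ.m≤m+n k 0)
      k≡n : k ≡ n
      k≡n = trans (sym (ℕₚ.+-identityʳ k)) e
      tg : δ g (suc k) ≡ n
      tg = subst (λ z → δ g (suc z) ≡ n) (sym k≡n) (ValidGaps.total vg)
      th : δ h (suc k) ≡ n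
      th = subst (λ z → δ h (suc z) ≡ n) (sym k≡n) (ValidGaps.total vh)
    candidate-exists (suc m) k e k1 dk | no ng with suc (δ h (suc k)) ℕ.≤? δ g (suc k)
    ... | yes dk' = candidate-exists m (suc k) (trans (sym (ℕₚ.+-suc k m)) e) (s≤s z≤n) dk'
    ... | no ndk' = ⊥-elim (blocked-ahead k dk ng kn (subst₂ _≤ℕ_ (δ-last g k) (δ-last h k) (ℕₚ.≮⇒≥ ndk')))
      where
      kn : k ≤ℕ n
      kn = subst (k ≤ℕ_) e (ℕₚ.≤-trans (ℕₚ.n≤1+n k) (ℕₚ.≤-trans
          (ℕₚ.≤-reflexive (sym (ℕₚ.+-identityʳ (suc k))))
          (ℕₚ.≤-trans (ℕₚ.+-monoʳ-≤ (suc k) (z≤n {m})) (ℕₚ.≤-reflexive (sym (ℕₚ.+-suc k m))))))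

    donor-condition : ∀ j → suc j ≤ℕ n → Ahead (suc j) → (∀ i → i <ℕ suc j → ¬ Candidate i) → (2 ≤ℕ g j) ⊎ (δ g j ≡ 0)
    donor-condition j sjn dsj mini with δ g j ℕ.≟ 0
    donor-condition j sjn dsj mini | yes e = inj₂ e
    donor-condition zero sjn dsj mini | no ne = ⊥-elim (ne refl)
    donor-condition (suc j') sjn dsj mini | no ne with suc (δ h (suc j')) ℕ.≤? δ g (suc j')
    ... | yes dj = inj₁ (ℕₚ.≤-trans 2≤p
        (ℕₚ.≤-pred (ℕₚ.≰⇒> (λ okj → mini (suc j') (ℕₚ.n<1+n (suc j')) ((s≤s z≤n , ℕₚ.<⇒≤ sjn) , dj , okj)))))
    ... | no ndj = inj₁ (2≤-from-sums (ℕₚ.≮⇒≥ ndj)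
        (positive-persists (ValidGaps.noDUU vh) (suc j') sjn (ℕₚ.≤-trans (ℕₚ.n≢0⇒n>0 ne) (ℕₚ.≮⇒≥ ndj)))
                    (subst₂ _≤ℕ_ (cong suc (δ-last h (suc j'))) (δ-last g (suc j')) dsj))

    flippable-towards : ∀ k0 → 1 ≤ℕ k0 → k0 ≤ℕ n → Ahead k0 → ∃ (λ j → j <ℕ n × Flippable g j × Ahead (suc j))
    flippable-towards k0 k1 kn d0 with candidate-exists (n ∸ k0) k0 (ℕₚ.m+[n∸m]≡n kn) k1 d0
    ... | kg , goodkg with least Candidate Candidate? kg goodkg
    ... | zero , ((() , _) , _) , _
    ... | suc j , ((_ , sjn) , dsj , okp) , mini = j , sjn , (g1 , donor-condition j sjn dsj mini , okp) , dsj
      where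
      jn : j <ℕ n
      jn = sjn
      g1 : 1 ≤ℕ g j
      g1 with g j ℕ.≟ 0
      ... | no ne = ℕₚ.n≢0⇒n>0 ne
      ... | yes e0 = ⊥-elim (ℕₚ.<⇒≱ (positive-persists (ValidGaps.noDUU vg) j jn (subst (1 ≤ℕ_)
          (trans (δ-last g j) (trans (cong (δ g j +_) e0) (ℕₚ.+-identityʳ _))) (ℕₚ.≤-trans (s≤s z≤n) dsj)))
          (ℕₚ.≤-reflexive e0))

  flip-valid : ∀ {n g} j → j <ℕ n → Flippable g j → ValidGaps p n g → ValidGaps p n (flip g j)
  flip-valid {n} {g} j jn (g1 , g2 , okp) v = record { dyck = dy' ; total = tot' ; noDUU = duu' ; gap≤p = dp' }
    where
    dy' : ∀ k → 1 ≤ℕ k → k ≤ℕ n → δ (flip g j) k <ℕ k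
    dy' k k1 kn = ℕₚ.≤-<-trans (δ-flip-≤ g j k g1) (ValidGaps.dyck v k k1 kn)
    tot' : δ (flip g j) (suc n) ≡ n
    tot' = trans (δ-flip-≢ g j (suc n) g1 (λ e → ℕₚ.<-irrefl (ℕₚ.suc-injective (sym e)) jn)) (ValidGaps.total v)
    duu' : ∀ i → suc i <ℕ n → 1 ≤ℕ flip g j i → 1 ≤ℕ flip g j (suc i)
    duu' i lt f1 with i ℕ.≟ j
    ... | yes refl = subst (1 ≤ℕ_) (sym (flip-next g j)) (s≤s z≤n)
    ... | no i≢j with i ℕ.≟ suc j
    ...   | yes refl = subst (1 ≤ℕ_) (sym (flip-other g j (suc (suc j))
        (λ e → ℕₚ.<-irrefl (sym e) (ℕₚ.≤-trans (ℕₚ.n<1+n j) (ℕₚ.n≤1+n (suc j))))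
        (λ e → ℕₚ.<-irrefl (sym e) (ℕₚ.n<1+n (suc j)))))
                         (positive-persists (ValidGaps.noDUU v) (suc (suc j)) lt
                           (ℕₚ.≤-trans g1 (ℕₚ.≤-trans (ℕₚ.m≤n+m (g j) (δ g j))
                             (ℕₚ.≤-trans (ℕₚ.≤-reflexive (sym (δ-last g j))) (δ-mono g (ℕₚ.n≤1+n (suc j)))))))
    ...   | no i≢sj with suc i ℕ.≟ j
    ...     | yes refl = subst (1 ≤ℕ_) (sym (flip-at g (suc i))) (ℕₚ.≤-pred (s≤s (two⇒ (case g2))))
      where
      gi : 1 ≤ℕ g i
      gi = subst (1 ≤ℕ_) (flip-other g (suc i) i (λ e → ℕₚ.<-irrefl e (ℕₚ.n<1+n i)) i≢sj) f1
      case : (2 ≤ℕ g (suc i)) ⊎ (δ g (suc i) ≡ 0) → 2 ≤ℕ g (suc i)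
      case (inj₁ x) = x
      case (inj₂ e) = ⊥-elim (ℕₚ.<⇒≱
          (ℕₚ.≤-trans gi (ℕₚ.≤-trans (ℕₚ.m≤n+m (g i) (δ g i)) (ℕₚ.≤-reflexive (sym (δ-last g i)))))
          (ℕₚ.≤-reflexive e))
      two⇒ : 2 ≤ℕ g (suc i) → 1 ≤ℕ g (suc i) ∸ 1
      two⇒ le = ℕₚ.∸-monoˡ-≤ 1 le
    ...     | no si≢j = subst (1 ≤ℕ_) (sym (flip-other g j (suc i) si≢j (λ e → i≢j (ℕₚ.suc-injective e))))
                  (ValidGaps.noDUU v i lt (subst (1 ≤ℕ_) (flip-other g j i i≢j i≢sj) f1))
    dp' : ∀ i → i ≤ℕ n → flip g j i ≤ℕ p
    dp' i le with i ℕ.≟ j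
    ... | yes refl = subst (_≤ℕ p) (sym (flip-at g j)) (ℕₚ.≤-trans (ℕₚ.m∸n≤m (g j) 1) (ValidGaps.gap≤p v j le))
    ... | no i≢j with i ℕ.≟ suc j
    ...   | yes refl = subst (_≤ℕ p) (sym (flip-next g j)) okp
    ...   | no i≢sj = subst (_≤ℕ p) (sym (flip-other g j i i≢j i≢sj)) (ValidGaps.gap≤p v i le)

  δ-injective : ∀ {n g h} → ValidGaps p n g → ValidGaps p n h → (∀ k → 1 ≤ℕ k → k ≤ℕ n → δ g k ≡ δ h k) → ∀ i
      → i ≤ℕ n → g i ≡ h i
  δ-injective {n} {g} {h} vg vh eq i le = ℕₚ.+-cancelˡ-≡ (δ g i) (g i) (h i)
      (trans (sym (δ-last g i)) (trans (up i le) (trans (δ-last h i) (cong (_+ h i) (sym (low i le))))))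
    where
    low : ∀ i → i ≤ℕ n → δ g i ≡ δ h i
    low zero _ = refl
    low (suc i) le = eq (suc i) (s≤s z≤n) le
    up : ∀ i → i ≤ℕ n → δ g (suc i) ≡ δ h (suc i)
    up i le with i ℕ.≟ n
    ... | yes refl = trans (ValidGaps.total vg) (sym (ValidGaps.total vh))
    ... | no ne = eq (suc i) (s≤s z≤n) (ℕₚ.≤∧≢⇒< le ne)

module UpperCovers (p : ℕ) (2≤p : 2 ≤ p) where

  open Counting
  open BoolFacts using (true≢false; false≢true; ∧-true⁻; ∧-true⁺; not-true⁻; not-true⁺)
  open Words
  open Gaps
  open Validity using (ValidGaps; module LongDescents)
  open StanleyOrderGaps
  open Flips p
  open NatSearch using (first-below)
  open import Data.Nat as ℕ using (suc; _∸_; _+_; s≤s) renaming (_≤_ to _≤ℕ_; _<_ to _<ℕ_; _*_ to _*ℕ_)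
  import Data.Nat.Properties as ℕₚ
  open import Data.Bool using (Bool; true; false; _∧_; not)
  open import Data.Bool.ListAction using (any)
  open import Data.List using (List; []; _∷_; map; length; filterᵇ; upTo)
  open import Data.List.Membership.Propositional using (_∈_)
  open import Data.List.Membership.Propositional.Properties using (∈-map⁺; ∈-map⁻; ∈-upTo⁺; ∈-upTo⁻)
  open import Data.List.Relation.Unary.Any using (there)
  open import Data.List.Relation.Unary.Unique.Propositional using (Unique)
  import Data.List.Relation.Unary.Unique.Propositional.Properties as UP
  open import Data.Product using (_×_; _,_; proj₁; proj₂; ∃)
  open import Data.Sum using (_⊎_; inj₁; inj₂)
  open import Relation.Binary.PropositionalEquality
  open import Relation.Nullary using (Dec; yes; no)
  open import Relation.Nullary.Decidable using (_×-dec_)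
  open import Data.Empty using (⊥; ⊥-elim)

  open LongDescents p using (is𝓕⇒ValidGaps; ValidGaps⇒is𝓕)

  ==S-refl : ∀ s → (s ==S s) ≡ true
  ==S-refl U = refl
  ==S-refl D = refl

  ==W-refl : ∀ w → (w ==W w) ≡ true
  ==W-refl [] = refl
  ==W-refl (x ∷ w) rewrite ==S-refl x = ==W-refl w

  ==W-true : ∀ v w → (v ==W w) ≡ true → v ≡ w
  ==W-true [] [] _ = refl
  ==W-true (U ∷ v) (U ∷ w) e = cong (U ∷_) (==W-true v w e)
  ==W-true (D ∷ v) (D ∷ w) e = cong (D ∷_) (==W-true v w e)
  ==W-true [] (x ∷ w) ()
  ==W-true (x ∷ v) [] ()
  ==W-true (U ∷ v) (D ∷ w) ()
  ==W-true (D ∷ v) (U ∷ w) ()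

  ==W-false : ∀ v w → v ≢ w → (v ==W w) ≡ false
  ==W-false v w ne with v ==W w in e
  ... | true = ⊥-elim (ne (==W-true v w e))
  ... | false = refl

  <St⁻ : ∀ P Q → (P <St Q) ≡ true → (P ≤St Q) ≡ true × P ≢ Q
  <St⁻ P Q e with P ≤St Q | P ==W Q in e2
  <St⁻ P Q () | false | _
  <St⁻ P Q () | true | true
  ... | true | false = refl , λ eq → false≢true (trans (sym e2) (subst (λ z → (P ==W z) ≡ true) eq (==W-refl P)))

  <St⁺ : ∀ P Q → (P ≤St Q) ≡ true → P ≢ Q → (P <St Q) ≡ true
  <St⁺ P Q e ne rewrite e | ==W-false P Q ne = refl

  n+n≡2*n : ∀ n → n + n ≡ 2 *ℕ n
  n+n≡2*n n = cong (n +_) (sym (ℕₚ.+-identityʳ n))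

  ∈𝓕⇒ValidGaps : ∀ {n P} → P ∈ 𝓕 p n → ValidGaps p n (gaps P) × toPath (gaps P) n ≡ P
  ∈𝓕⇒ValidGaps {n} {P} m with ∈𝓕⁻ p n m
  ... | l , e = subst (λ z → ValidGaps p z (gaps P)) nUn v , trans (cong (toPath (gaps P)) (sym nUn)) (toPath-gaps P)
    where
    g = gaps P
    e' : is𝓕 p (toPath g (ups P)) ≡ true
    e' = subst (λ w → is𝓕 p w ≡ true) (sym (toPath-gaps P)) e
    v : ValidGaps p (ups P) g
    v = is𝓕⇒ValidGaps (ups P) g e'
    nUn : ups P ≡ n
    nUn = ℕₚ.*-cancelˡ-≡ (ups P) n 2 (trans (sym (n+n≡2*n (ups P))) (trans
        (cong (ups P +_) (sym (ValidGaps.total v)))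
        (trans (sym (length-toPath g (ups P))) (trans (cong length (toPath-gaps P)) l))))

  length-toPath-valid : ∀ {n g} → ValidGaps p n g → length (toPath g n) ≡ 2 *ℕ n
  length-toPath-valid {n} {g} v = trans (length-toPath g n) (trans (cong (n +_) (ValidGaps.total v)) (n+n≡2*n n))

  ValidGaps⇒∈𝓕 : ∀ {n g} → ValidGaps p n g → toPath g n ∈ 𝓕 p n
  ValidGaps⇒∈𝓕 {n} {g} v = ∈𝓕⁺ p n (length-toPath-valid v) (ValidGaps⇒is𝓕 n g v)

  pred< : ∀ m → 1 ≤ℕ m → m ∸ 1 <ℕ m
  pred< (suc m) _ = ℕₚ.n<1+n m

  module _ {n : ℕ} {P : List Step} (mP : P ∈ 𝓕 p n) where
    g : ℕ → ℕ
    g = gaps P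
    vg : ValidGaps p n g
    vg = proj₁ (∈𝓕⇒ValidGaps {n} {P} mP)
    Peq : toPath g n ≡ P
    Peq = proj₂ (∈𝓕⇒ValidGaps {n} {P} mP)

    S : List (List Step)
    S = 𝓕 p n

    flippableIndices : List ℕ
    flippableIndices = filterᵇ (flippableᵇ g) (upTo n)

    flipPath : ℕ → List Step
    flipPath j = toPath (flip g j) n

    isUpperCover : List Step → Bool
    isUpperCover Q = (P <St Q) ∧ not (any (λ R → (P <St R) ∧ (R <St Q)) S)

    flip-above : ∀ j → j <ℕ n → Flippable g j → flipPath j ∈ S × (P <St flipPath j) ≡ true
    flip-above j jn ok = ValidGaps⇒∈𝓕 vf , <St⁺ P (flipPath j) le ne
      where
      vf : ValidGaps p n (flip g j)
      vf = flip-valid j jn ok vg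
      g1 : 1 ≤ℕ g j
      g1 = proj₁ ok
      le : (P ≤St flipPath j) ≡ true
      le = subst (λ z → (z ≤St flipPath j) ≡ true) Peq (δ≥⇒≤St n g (flip g j)
          (trans (length-toPath-valid vg) (sym (length-toPath-valid vf))) (λ k _ _ → δ-flip-≤ g j k g1))
      ne : P ≢ flipPath j
      ne e = ℕₚ.<-irrefl (sym x) (pred< (g j) g1)
        where
        x : g j ≡ g j ∸ 1
        x = trans (toPath-injective n g (flip g j) (trans Peq e) j (ℕₚ.<⇒≤ jn)) (flip-at g j)

    flip-≥ : ∀ j → Flippable g j → ∀ {h} → δ h (suc j) <ℕ δ g (suc j) → ∀ k → 1 ≤ℕ k → k ≤ℕ n → δ h k ≤ℕ δ g k
        → δ h k ≤ℕ δ (flip g j) k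
    flip-≥ j ok {h} dsj k _ _ hk with k ℕ.≟ suc j
    ... | yes refl = ℕₚ.≤-pred (ℕₚ.≤-trans dsj
        (ℕₚ.≤-trans (ℕₚ.≤-reflexive (sym (δ-flip-next g j (proj₁ ok)))) (ℕₚ.≤-reflexive (ℕₚ.+-comm _ 1))))
    ... | no ne = subst (δ h k ≤ℕ_) (sym (δ-flip-≢ g j k (proj₁ ok) ne)) hk

    strict-or-eq : ∀ h → (∀ k → 1 ≤ℕ k → k ≤ℕ n → δ h k ≤ℕ δ g k) →
      (∃ λ k → 1 ≤ℕ k × k ≤ℕ n × δ h k <ℕ δ g k) ⊎ (∀ k → 1 ≤ℕ k → k ≤ℕ n → δ g k ≡ δ h k)
    strict-or-eq h hle with first-below (λ k → (1 ≤ℕ k × k ≤ℕ n) × δ h k <ℕ δ g k)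
        (λ k → ((1 ℕ.≤? k) ×-dec (k ℕ.≤? n)) ×-dec (suc (δ h k) ℕ.≤? δ g k)) (suc n)
    ... | inj₂ (k , _ , ((k1 , kn) , d) , _) = inj₁ (k , k1 , kn , d)
    ... | inj₁ none = inj₂ (λ k k1 kn → ℕₚ.≤-antisym (ℕₚ.≮⇒≥ (λ lt → none k (s≤s kn) ((k1 , kn) , lt))) (hle k k1 kn))

    upperCover⇒flip : ∀ {Q} → Q ∈ filterᵇ isUpperCover S → Q ∈ map flipPath flippableIndices
    upperCover⇒flip {Q} m with ∈-filterᵇ⁻ isUpperCover m
    ... | mQ , ce with ∧-true⁻ {P <St Q} ce
    ... | lt , nany with <St⁻ P Q lt
    ... | leq , neq with ∈𝓕⇒ValidGaps {n} {Q} mQ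
    ... | vh , Qeq = res (strict-or-eq h hle)
      where
      h : ℕ → ℕ
      h = gaps Q
      lenPQ : length (toPath g n) ≡ length (toPath h n)
      lenPQ = trans (length-toPath-valid vg) (sym (length-toPath-valid vh))
      hle : ∀ k → 1 ≤ℕ k → k ≤ℕ n → δ h k ≤ℕ δ g k
      hle = ≤St⇒δ≥ n g h lenPQ (subst₂ (λ a b → (a ≤St b) ≡ true) (sym Peq) (sym Qeq) leq)
      res : (∃ λ k → 1 ≤ℕ k × k ≤ℕ n × δ h k <ℕ δ g k) ⊎ (∀ k → 1 ≤ℕ k → k ≤ℕ n → δ g k ≡ δ h k) → Q ∈ map
          flipPath flippableIndices
      res (inj₂ alleq) = ⊥-elim (neq (trans (sym Peq) (trans (toPath-cong n (δ-injective vg vh alleq)) Qeq)))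
      res (inj₁ (k0 , k1 , kn , d0)) with FlipTowards.flippable-towards 2≤p vg vh hle k0 k1 kn d0
      ... | j , jn , ok , dsj with flip-above j jn ok
      ... | mR , PR = fin (flipPath j ==W Q) refl
        where
        vf : ValidGaps p n (flip g j)
        vf = flip-valid j jn ok vg
        RQ : (flipPath j ≤St Q) ≡ true
        RQ = subst (λ b → (flipPath j ≤St b) ≡ true) Qeq (δ≥⇒≤St n (flip g j) h
            (trans (length-toPath-valid vf) (sym (length-toPath-valid vh)))
            (λ k k1 kn → flip-≥ j ok dsj k k1 kn (hle k k1 kn)))
        fin : ∀ b → (flipPath j ==W Q) ≡ b → Q ∈ map flipPath flippableIndices
        fin true e = subst (_∈ map flipPath flippableIndices) (==W-true (flipPath j) Q e)
            (∈-map⁺ flipPath (∈-filterᵇ⁺ (flippableᵇ g) (∈-upTo⁺ jn) (flippableᵇ⇐ g j ok)))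
        fin false e = ⊥-elim (true≢false (trans (sym between) (not-true⁻ nany)))
          where
          F≢Q : flipPath j ≢ Q
          F≢Q eq = false≢true (trans (sym e) (subst (λ z → (flipPath j ==W z) ≡ true) eq (==W-refl (flipPath j))))
          between : any (λ R → (P <St R) ∧ (R <St Q)) S ≡ true
          between = any-true (λ R → (P <St R) ∧ (R <St Q)) S mR (∧-true⁺ PR (<St⁺ (flipPath j) Q RQ F≢Q))

    -- A path between P and its flip at j has the partial sums of one of them everywhere, since the two
    -- differ only at the (j + 1)-th U, and there by one.
    nothing-between : ∀ j → j <ℕ n → Flippable g j → ∀ {R} → R ∈ S → ((P <St R) ∧ (R <St flipPath j)) ≡ false
    nothing-between j jn ok {R} mR with (P <St R) ∧ (R <St flipPath j) in e
    ... | false = refl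
    ... | true with ∧-true⁻ {P <St R} e
    ... | e1 , e2 with <St⁻ P R e1 | <St⁻ R (flipPath j) e2 | ∈𝓕⇒ValidGaps {n} {R} mR
    ... | (le1 , ne1) | (le2 , ne2) | (vr , Req) = ⊥-elim (decide (δ r (suc j) ℕ.≟ δ g (suc j)))
      where
      r : ℕ → ℕ
      r = gaps R
      vf : ValidGaps p n (flip g j)
      vf = flip-valid j jn ok vg
      rg : ∀ k → 1 ≤ℕ k → k ≤ℕ n → δ r k ≤ℕ δ g k
      rg = ≤St⇒δ≥ n g r (trans (length-toPath-valid vg) (sym (length-toPath-valid vr)))
          (subst₂ (λ a b → (a ≤St b) ≡ true) (sym Peq) (sym Req) le1)
      fr : ∀ k → 1 ≤ℕ k → k ≤ℕ n → δ (flip g j) k ≤ℕ δ r k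
      fr = ≤St⇒δ≥ n r (flip g j) (trans (length-toPath-valid vr) (sym (length-toPath-valid vf)))
          (subst (λ a → (a ≤St flipPath j) ≡ true) (sym Req) le2)
      g1 : 1 ≤ℕ g j
      g1 = proj₁ ok
      decide : Dec (δ r (suc j) ≡ δ g (suc j)) → ⊥
      decide (yes eq) = ne1 (trans (sym Peq) (trans (toPath-cong n (δ-injective vg vr all)) Req))
        where
        all : ∀ k → 1 ≤ℕ k → k ≤ℕ n → δ g k ≡ δ r k
        all k k1 kn with k ℕ.≟ suc j
        ... | yes refl = sym eq
        ... | no nk = ℕₚ.≤-antisym (ℕₚ.≤-trans (ℕₚ.≤-reflexive (sym (δ-flip-≢ g j k g1 nk))) (fr k k1 kn)) (rg k k1 kn)
      decide (no neq) = ne2 (trans (sym Req) (trans (toPath-cong n (δ-injective vr vf all)) refl))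
        where
        all : ∀ k → 1 ≤ℕ k → k ≤ℕ n → δ r k ≡ δ (flip g j) k
        all k k1 kn with k ℕ.≟ suc j
        ... | yes refl = ℕₚ.≤-antisym (ℕₚ.≤-pred (ℕₚ.≤-trans (ℕₚ.≤∧≢⇒< (rg (suc j) k1 kn) neq)
            (ℕₚ.≤-reflexive (trans (sym (δ-flip-next g j g1)) (ℕₚ.+-comm _ 1))))) (fr (suc j) k1 kn)
        ... | no nk = ℕₚ.≤-antisym (ℕₚ.≤-trans (rg k k1 kn) (ℕₚ.≤-reflexive (sym (δ-flip-≢ g j k g1 nk)))) (fr k k1 kn)

    flip⇒upperCover : ∀ {Q} → Q ∈ map flipPath flippableIndices → Q ∈ filterᵇ isUpperCover S
    flip⇒upperCover {Q} m with ∈-map⁻ flipPath m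
    ... | j , mj , refl with ∈-filterᵇ⁻ (flippableᵇ g) mj
    ... | mu , oke with flip-above j (∈-upTo⁻ mu) (flippableᵇ⇒ g j oke)
    ... | mF , P<F = ∈-filterᵇ⁺ isUpperCover mF
      (∧-true⁺ P<F (not-true⁺ (any-false (λ R → (P <St R) ∧ (R <St flipPath j)) S
        (nothing-between j (∈-upTo⁻ mu) (flippableᵇ⇒ g j oke)))))

    unique-flips : Unique (map flipPath flippableIndices)
    unique-flips = unique-map-injectiveOn flipPath flippableIndices inj (unique-filterᵇ (flippableᵇ g) (UP.upTo⁺ n))
      where
      inj : ∀ {j j'} → j ∈ flippableIndices → j' ∈ flippableIndices → flipPath j ≡ flipPath j' → j ≡ j'
      inj {j} {j'} mj mj' e with j ℕ.≟ j'
      ... | yes eq = eq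
      ... | no ne with ∈-filterᵇ⁻ (flippableᵇ g) mj
      ... | mu , oke = ⊥-elim (case (j ℕ.≟ suc j'))
        where
        jn : j <ℕ n
        jn = ∈-upTo⁻ mu
        g1 : 1 ≤ℕ g j
        g1 = proj₁ (flippableᵇ⇒ g j oke)
        at : flip g j j ≡ flip g j' j
        at = toPath-injective n (flip g j) (flip g j') e j (ℕₚ.<⇒≤ jn)
        case : Dec (j ≡ suc j') → ⊥
        case (yes refl) = ℕₚ.<-irrefl (trans (sym (flip-at g (suc j'))) (trans at (flip-next g j')))
            (ℕₚ.≤-trans (pred< (g (suc j')) g1) (ℕₚ.n≤1+n _))
        case (no ns) = ℕₚ.<-irrefl (trans (sym (flip-at g j)) (trans at (flip-other g j' j ne ns))) (pred< (g j) g1)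

    length-upperCovers : length (filterᵇ isUpperCover S) ≡ countᵇ (flippableᵇ g) (upTo n)
    length-upperCovers = trans (length-image (filterᵇ isUpperCover S) flipPath flippableIndices
        (unique-filterᵇ isUpperCover (𝓕-unique p n)) unique-flips upperCover⇒flip flip⇒upperCover)
        (length-filterᵇ (flippableᵇ g) (upTo n))

module Compositions (p : ℕ) where

  open Counting
  open BoolFacts using (≤ᵇ-true⁻; ≤ᵇ-true⁺)
  open import Data.Nat as ℕ using (ℕ; zero; suc; _∸_; _+_; z≤n; s≤s; _≤ᵇ_; _<ᵇ_) renaming
      (_≤_ to _≤ℕ_; _<_ to _<ℕ_; _≡ᵇ_ to _==ℕ_)
  import Data.Nat.Properties as ℕₚ
  open import Data.Nat.ListAction using (sum)
  open import Data.Bool using (Bool; true; false; _∧_; not; if_then_else_)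
  open import Data.List using (List; []; _∷_; map; _++_; length)
  open import Data.List.Properties using (∷-injectiveˡ; ∷-injectiveʳ)
  open import Data.List.Membership.Propositional using (_∈_)
  open import Data.List.Membership.Propositional.Properties using (∈-map⁺; ∈-map⁻; ∈-++⁺ˡ; ∈-++⁺ʳ; ∈-++⁻)
  open import Data.List.Relation.Unary.Any using (here)
  open import Data.List.Relation.Unary.All using (All; []; _∷_)
  open import Data.List.Relation.Unary.AllPairs using ([]; _∷_)
  open import Data.List.Relation.Unary.Unique.Propositional using (Unique)
  import Data.List.Relation.Unary.Unique.Propositional.Properties as Unique
  open import Data.Product using (_×_; _,_; ∃)
  open import Data.Sum using (inj₁; inj₂)
  open import Relation.Binary.PropositionalEquality
  open import Relation.Nullary using (yes; no)
  open import Data.Empty using (⊥; ⊥-elim)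

  prependParts : (ℕ → List (List ℕ)) → ℕ → ℕ → ℕ → List (List ℕ)
  prependParts R n t zero = []
  prependParts R n t (suc c) = (if t ≤ᵇ n then map (suc t ∷_) (R (n ∸ t)) else []) ++ prependParts R n (suc t) c

  -- The compositions of n with parts in [1, p], listed last part first; the fuel only makes the recursion structural.
  compositionsFuel : ℕ → ℕ → List (List ℕ)
  compositionsFuel f zero = [] ∷ []
  compositionsFuel zero (suc n) = []
  compositionsFuel (suc f) (suc n) = prependParts (compositionsFuel f) n 0 p

  compositions : ℕ → List (List ℕ)
  compositions n = compositionsFuel n n

  prependParts-cong : ∀ R R' n t c → (∀ j → j ≤ℕ n → R j ≡ R' j) → prependParts R n t c ≡ prependParts R' n t c
  prependParts-cong R R' n t zero h = refl
  prependParts-cong R R' n t (suc c) h = cong₂ _++_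
      (cong (λ z → if t ≤ᵇ n then map (suc t ∷_) z else []) (h (n ∸ t) (ℕₚ.m∸n≤m n t)))
      (prependParts-cong R R' n (suc t) c h)

  compositionsFuel-irrelevant : ∀ f f' n → n ≤ℕ f → n ≤ℕ f' → compositionsFuel f n ≡ compositionsFuel f' n
  compositionsFuel-irrelevant f f' zero _ _ = refl
  compositionsFuel-irrelevant (suc f) (suc f') (suc n) (s≤s a) (s≤s b) = prependParts-cong
      (compositionsFuel f) (compositionsFuel f') n 0 p
      (λ j le → compositionsFuel-irrelevant f f' j (ℕₚ.≤-trans le a) (ℕₚ.≤-trans le b))

  compositions-suc : ∀ m → compositions (suc m) ≡ prependParts compositions m 0 p
  compositions-suc m = prependParts-cong (compositionsFuel m) compositions m 0 p
      (λ j le → compositionsFuel-irrelevant m j j le ℕₚ.≤-refl)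

  countᵇ-prependParts : ∀ (Q : List ℕ → Bool) R n t c →
    countᵇ Q (prependParts R n t c) ≡ Σℕ c
        (λ i → if (t + i) ≤ᵇ n then countᵇ (λ x → Q (suc (t + i) ∷ x)) (R (n ∸ (t + i))) else 0)
  countᵇ-prependParts Q R n t zero = refl
  countᵇ-prependParts Q R n t (suc c) = begin
      countᵇ Q ((if t ≤ᵇ n then map (suc t ∷_) (R (n ∸ t)) else []) ++ prependParts R n (suc t) c)
    ≡⟨ countᵇ-++ Q (if t ≤ᵇ n then map (suc t ∷_) (R (n ∸ t)) else []) (prependParts R n (suc t) c) ⟩
      countᵇ Q (if t ≤ᵇ n then map (suc t ∷_) (R (n ∸ t)) else []) + countᵇ Q (prependParts R n (suc t) c)
    ≡⟨ cong₂ _+_ first (countᵇ-prependParts Q R n (suc t) c) ⟩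
      B (t + 0) + Σℕ c (λ i → B (suc t + i))
    ≡⟨ cong (B (t + 0) +_) (Σℕ-cong c (λ i → cong B (sym (ℕₚ.+-suc t i)))) ⟩
      B (t + 0) + Σℕ c (λ i → B (t + suc i))
    ∎ where
    open ≡-Reasoning
    B : ℕ → ℕ
    B s = if s ≤ᵇ n then countᵇ (λ x → Q (suc s ∷ x)) (R (n ∸ s)) else 0
    first : countᵇ Q (if t ≤ᵇ n then map (suc t ∷_) (R (n ∸ t)) else []) ≡ B (t + 0)
    first rewrite ℕₚ.+-identityʳ t with t ≤ᵇ n
    ... | true = countᵇ-map Q (suc t ∷_) (R (n ∸ t))
    ... | false = refl

  countComp : ℕ → (List ℕ → Bool) → ℕ
  countComp m Q = countᵇ Q (compositions m)

  countComp-suc : ∀ m Q → countComp (suc m) Q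
      ≡ Σℕ p (λ t → if t ≤ᵇ m then countComp (m ∸ t) (λ x → Q (suc t ∷ x)) else 0)
  countComp-suc m Q = trans (cong (countᵇ Q) (compositions-suc m)) (countᵇ-prependParts Q compositions m 0 p)

  Part : ℕ → Set
  Part d = 1 ≤ℕ d × d ≤ℕ p

  IsComposition : ℕ → List ℕ → Set
  IsComposition n rc = All Part rc × sum rc ≡ n

  ∈-prependParts⁻ : ∀ R n t c {x} → x ∈ prependParts R n t c → ∃ λ s → t ≤ℕ s × s <ℕ t + c × s ≤ℕ n × ∃ λ y →
      x ≡ suc s ∷ y × y ∈ R (n ∸ s)
  ∈-prependParts⁻ R n t zero ()
  ∈-prependParts⁻ R n t (suc c) {x} m with ∈-++⁻ (if t ≤ᵇ n then map (suc t ∷_) (R (n ∸ t)) else []) m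
  ... | inj₂ m2 with ∈-prependParts⁻ R n (suc t) c m2
  ...   | s , ts , sc , sn , y , eq , my = s , ℕₚ.<⇒≤ ts , subst (s <ℕ_) (sym (ℕₚ.+-suc t c)) sc , sn , y , eq , my
  ∈-prependParts⁻ R n t (suc c) {x} m | inj₁ m1 with t ≤ᵇ n in e
  ... | true with ∈-map⁻ (suc t ∷_) m1
  ...   | y , my , eq = t , ℕₚ.≤-refl , ℕₚ.m<m+n t (s≤s z≤n) , ≤ᵇ-true⁻ t n e , y , eq , my
  ∈-prependParts⁻ R n t (suc c) {x} m | inj₁ () | false

  ∈-prependParts⁺ : ∀ R n t c s y → t ≤ℕ s → s <ℕ t + c → s ≤ℕ n → y ∈ R (n ∸ s) → (suc s ∷ y) ∈ prependParts R n t c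
  ∈-prependParts⁺ R n t zero s y ts sc sn my = ⊥-elim (ℕₚ.<⇒≱ sc (subst (_≤ℕ s) (sym (ℕₚ.+-identityʳ t)) ts))
  ∈-prependParts⁺ R n t (suc c) s y ts sc sn my with t ℕ.≟ s
  ... | yes refl rewrite ≤ᵇ-true⁺ sn = ∈-++⁺ˡ (∈-map⁺ (suc t ∷_) my)
  ... | no ne = ∈-++⁺ʳ (if t ≤ᵇ n then map (suc t ∷_) (R (n ∸ t)) else [])
      (∈-prependParts⁺ R n (suc t) c s y (ℕₚ.≤∧≢⇒< ts ne) (subst (s <ℕ_) (ℕₚ.+-suc t c) sc) sn my)

  ∈compositionsFuel⁻ : ∀ f n {rc} → rc ∈ compositionsFuel f n → IsComposition n rc
  ∈compositionsFuel⁻ f zero (here refl) = [] , refl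
  ∈compositionsFuel⁻ zero (suc n) ()
  ∈compositionsFuel⁻ (suc f) (suc n) m with ∈-prependParts⁻ (compositionsFuel f) n 0 p m
  ... | s , _ , sp , sn , y , refl , my with ∈compositionsFuel⁻ f (n ∸ s) my
  ... | ay , sy = (s≤s z≤n , sp) ∷ ay , cong suc (trans (cong (s +_) sy) (ℕₚ.m+[n∸m]≡n sn))

  length≤sum : ∀ {rc} → All Part rc → length rc ≤ℕ sum rc
  length≤sum [] = z≤n
  length≤sum {d ∷ rc} ((d1 , _) ∷ a) = ℕₚ.+-mono-≤ d1 (length≤sum a)

  ∈compositionsFuel⁺ : ∀ f n rc → n ≤ℕ f → IsComposition n rc → rc ∈ compositionsFuel f n
  ∈compositionsFuel⁺ f zero [] _ _ = here refl
  ∈compositionsFuel⁺ f zero (d ∷ rc) _ ((d1 , _) ∷ _ , s) = ⊥-elim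
      (ℕₚ.<⇒≱ (ℕₚ.≤-trans d1 (ℕₚ.m≤m+n d (sum rc))) (ℕₚ.≤-reflexive s))
  ∈compositionsFuel⁺ f (suc n) [] _ (_ , ())
  ∈compositionsFuel⁺ (suc f) (suc n) (suc s ∷ rc) (s≤s nf) ((_ , sp) ∷ a , e) =
    ∈-prependParts⁺ (compositionsFuel f) n 0 p s rc z≤n sp sn
        (∈compositionsFuel⁺ f (n ∸ s) rc (ℕₚ.≤-trans (ℕₚ.m∸n≤m n s) nf) (a , se))
    where
    e' : s + sum rc ≡ n
    e' = ℕₚ.suc-injective e
    sn : s ≤ℕ n
    sn = subst (s ≤ℕ_) e' (ℕₚ.m≤m+n s (sum rc))
    se : sum rc ≡ n ∸ s
    se = sym (trans (cong (_∸ s) (sym e')) (ℕₚ.m+n∸m≡n s (sum rc)))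
  ∈compositionsFuel⁺ zero (suc n) rc () v
  ∈compositionsFuel⁺ (suc f) (suc n) (zero ∷ rc) _ ((() , _) ∷ _ , _)

  ∈compositions⁻ : ∀ n {rc} → rc ∈ compositions n → IsComposition n rc
  ∈compositions⁻ n = ∈compositionsFuel⁻ n n

  ∈compositions⁺ : ∀ n rc → IsComposition n rc → rc ∈ compositions n
  ∈compositions⁺ n rc v = ∈compositionsFuel⁺ n n rc ℕₚ.≤-refl v

  prependParts-unique : ∀ R n t c → (∀ j → Unique (R j)) → Unique (prependParts R n t c)
  prependParts-unique R n t zero u = []
  prependParts-unique R n t (suc c) u = Unique.++⁺ first (prependParts-unique R n (suc t) c u) disj
    where
    first : Unique (if t ≤ᵇ n then map (suc t ∷_) (R (n ∸ t)) else [])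
    first with t ≤ᵇ n
    ... | true = Unique.map⁺ ∷-injectiveʳ (u (n ∸ t))
    ... | false = []
    disj : ∀ {v} → v ∈ (if t ≤ᵇ n then map (suc t ∷_) (R (n ∸ t)) else []) × v ∈ prependParts R n (suc t) c → ⊥
    disj (m1 , m2) with ∈-prependParts⁻ R n (suc t) c m2
    ... | s , ts , _ , _ , y , refl , _ with t ≤ᵇ n
    ...   | true with ∈-map⁻ (suc t ∷_) m1
    ...     | y' , _ , eq = ℕₚ.<-irrefl (sym (ℕₚ.suc-injective (∷-injectiveˡ eq))) ts
    disj (() , m2) | s , ts , _ , _ , y , refl , _ | false

  compositionsFuel-unique : ∀ f n → Unique (compositionsFuel f n)
  compositionsFuel-unique f zero = [] ∷ []
  compositionsFuel-unique zero (suc n) = []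
  compositionsFuel-unique (suc f) (suc n) = prependParts-unique (compositionsFuel f) n 0 p (compositionsFuel-unique f)

  compositions-unique : ∀ n → Unique (compositions n)
  compositions-unique n = compositionsFuel-unique n n

  isNil : List ℕ → Bool
  isNil [] = true
  isNil (_ ∷ _) = false

  -- A nonempty composition is in class E if its last part is ≥ 2 or is its only part, and in class I otherwise;
  -- appending a part d < p to a composition of class E creates exactly one new upper cover.
  isE : List ℕ → Bool
  isE [] = false
  isE (d ∷ []) = true
  isE (d ∷ _ ∷ _) = 2 ≤ᵇ d

  isI : List ℕ → Bool
  isI [] = false
  isI (d ∷ []) = false
  isI (d ∷ _ ∷ _) = not (2 ≤ᵇ d)

  newCover : ℕ → List ℕ → Bool
  newCover d c = isE c ∧ (d <ᵇ p)

  #covers : List ℕ → ℕ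
  #covers [] = 0
  #covers (d ∷ c) = toℕ (newCover d c) + #covers c

  Ac : ℕ → ℕ → ℕ
  Ac m k = countComp m (λ c → #covers c ==ℕ k)

module CompositionGaps (p : ℕ) where

  open Gaps
  open Validity using (ValidGaps; positive-persists)
  open Compositions p
  open import Data.Nat as ℕ using (ℕ; zero; suc; _∸_; _+_; z≤n; s≤s) renaming (_≤_ to _≤ℕ_; _<_ to _<ℕ_)
  import Data.Nat.Properties as ℕₚ
  open import Data.Nat.ListAction using (sum)
  open import Data.Nat.ListAction.Properties using (sum-++; sum-↭)
  open import Data.List using (List; []; _∷_; _++_; length; replicate; reverse)
  import Data.List.Properties as LP
  open import Data.List.Relation.Binary.Permutation.Propositional using (↭-sym)
  open import Data.List.Relation.Binary.Permutation.Propositional.Properties using (↭-reverse; All-resp-↭)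
  open import Data.List.Relation.Unary.All as All using (All; []; _∷_)
  import Data.List.Relation.Unary.All.Properties as AllP
  open import Data.Product using (_×_; _,_; proj₁; proj₂; ∃)
  open import Relation.Binary.PropositionalEquality
  open import Relation.Nullary using (yes; no)
  open import Data.Empty using (⊥-elim)

  sum-reverse : ∀ l → sum (reverse l) ≡ sum l
  sum-reverse l = sum-↭ (↭-reverse l)

  All-reverse : ∀ {P : ℕ → Set} {l} → All P l → All P (reverse l)
  All-reverse {l = l} = All-resp-↭ (↭-sym (↭-reverse l))

  lookup0 : List ℕ → ℕ → ℕ
  lookup0 [] i = 0
  lookup0 (x ∷ l) zero = x
  lookup0 (x ∷ l) (suc i) = lookup0 l i

  tabulate≤ : (ℕ → ℕ) → ℕ → List ℕ
  tabulate≤ g zero = g 0 ∷ []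
  tabulate≤ g (suc n) = g 0 ∷ tabulate≤ (λ i → g (suc i)) n

  lookup0-tabulate≤ : ∀ g n i → i ≤ℕ n → lookup0 (tabulate≤ g n) i ≡ g i
  lookup0-tabulate≤ g zero zero _ = refl
  lookup0-tabulate≤ g (suc n) zero _ = refl
  lookup0-tabulate≤ g (suc n) (suc i) (s≤s le) = lookup0-tabulate≤ (λ j → g (suc j)) n i le

  length-tabulate≤ : ∀ g n → length (tabulate≤ g n) ≡ suc n
  length-tabulate≤ g zero = refl
  length-tabulate≤ g (suc n) = cong suc (length-tabulate≤ (λ i → g (suc i)) n)

  δ-lookup0 : ∀ l → δ (lookup0 l) (length l) ≡ sum l
  δ-lookup0 [] = refl
  δ-lookup0 (x ∷ l) = cong (x +_) (δ-lookup0 l)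

  lookup0-ext : ∀ (l l' : List ℕ) → length l ≡ length l' → (∀ i → i <ℕ length l → lookup0 l i ≡ lookup0 l' i) → l ≡ l'
  lookup0-ext [] [] _ _ = refl
  lookup0-ext (x ∷ l) (y ∷ l') e h = cong₂ _∷_ (h 0 (s≤s z≤n))
      (lookup0-ext l l' (ℕₚ.suc-injective e) (λ i lt → h (suc i) (s≤s lt)))

  All-lookup0 : ∀ {P : ℕ → Set} l → All P l → P 0 → ∀ i → P (lookup0 l i)
  All-lookup0 [] [] p0 i = p0
  All-lookup0 (x ∷ l) (px ∷ a) p0 zero = px
  All-lookup0 (x ∷ l) (px ∷ a) p0 (suc i) = All-lookup0 l a p0 i

  All-lookup0< : ∀ {P : ℕ → Set} l → All P l → ∀ i → i <ℕ length l → P (lookup0 l i)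
  All-lookup0< (x ∷ l) (px ∷ a) zero _ = px
  All-lookup0< (x ∷ l) (px ∷ a) (suc i) (s≤s lt) = All-lookup0< l a i lt

  sum-rep0 : ∀ m → sum (replicate m 0) ≡ 0
  sum-rep0 zero = refl
  sum-rep0 (suc m) = sum-rep0 m

  Pos : ℕ → Set
  Pos d = 1 ≤ℕ d

  lookup0-zeros : ∀ m c i → i <ℕ m → lookup0 (replicate m 0 ++ c) i ≡ 0
  lookup0-zeros (suc m) c zero _ = refl
  lookup0-zeros (suc m) c (suc i) (s≤s lt) = lookup0-zeros m c i lt

  lookup0-shift : ∀ m c i → lookup0 (replicate m 0 ++ c) (m + i) ≡ lookup0 c i
  lookup0-shift zero c i = refl
  lookup0-shift (suc m) c i = lookup0-shift m c i

  gapsOf : ℕ → List ℕ → ℕ → ℕ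
  gapsOf n rc = lookup0 (replicate (suc n ∸ length rc) 0 ++ reverse rc)

  length-positive : ∀ {n} rc → sum rc ≡ n → 1 ≤ℕ n → 1 ≤ℕ length rc
  length-positive [] e n1 = ⊥-elim (ℕₚ.<⇒≱ n1 (ℕₚ.≤-reflexive (sym e)))
  length-positive (x ∷ r) _ _ = s≤s z≤n

  module GapsOf {n : ℕ} {rc : List ℕ} (v : IsComposition n rc) where
    c : List ℕ
    c = reverse rc
    m : ℕ
    m = suc n ∸ length rc
    l : List ℕ
    l = replicate m 0 ++ c
    apos : All Pos c
    apos = All-reverse (All.map proj₁ (proj₁ v))
    ap : All (λ d → d ≤ℕ p) c
    ap = All-reverse (All.map proj₂ (proj₁ v))
    sumc : sum c ≡ n
    sumc = trans (sum-reverse rc) (proj₂ v)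
    lenrc : length rc ≤ℕ n
    lenrc = ℕₚ.≤-trans (length≤sum (proj₁ v)) (ℕₚ.≤-reflexive (proj₂ v))
    lenc : length c ≡ length rc
    lenc = LP.length-reverse rc
    lenl : length l ≡ suc n
    lenl = trans (LP.length-++ (replicate m 0))
        (trans (cong₂ _+_ (LP.length-replicate m) lenc) (ℕₚ.m∸n+n≡m (ℕₚ.≤-trans lenrc (ℕₚ.n≤1+n n))))
    m1 : 1 ≤ℕ m
    m1 = ℕₚ.≤-trans (s≤s z≤n) (ℕₚ.≤-reflexive (sym (ℕₚ.+-∸-assoc 1 lenrc)))
    g : ℕ → ℕ
    g = lookup0 l
    pos-at : ∀ i → m ≤ℕ i → i ≤ℕ n → 1 ≤ℕ g i
    pos-at i m≤i i≤n = subst (1 ≤ℕ_) at-i (All-lookup0< c apos (i ∸ m) lt)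
      where
      m+[i∸m]≡i : m + (i ∸ m) ≡ i
      m+[i∸m]≡i = ℕₚ.m+[n∸m]≡n m≤i
      at-i : lookup0 c (i ∸ m) ≡ g i
      at-i = trans (sym (lookup0-shift m c (i ∸ m))) (cong g m+[i∸m]≡i)
      1+n≡m+|c| : suc n ≡ m + length c
      1+n≡m+|c| = trans (sym lenl) (trans (LP.length-++ (replicate m 0)) (cong (_+ length c) (LP.length-replicate m)))
      lt : i ∸ m <ℕ length c
      lt = ℕₚ.+-cancelˡ-< m (i ∸ m) (length c) (subst₂ _<ℕ_ (sym m+[i∸m]≡i) 1+n≡m+|c| (s≤s i≤n))
    pos⇒m : ∀ i → 1 ≤ℕ g i → m ≤ℕ i
    pos⇒m i g1 with m ℕ.≤? i
    ... | yes le = le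
    ... | no nle = ⊥-elim (ℕₚ.<⇒≱ g1 (ℕₚ.≤-reflexive (lookup0-zeros m c i (ℕₚ.≰⇒> nle))))
    total : δ g (suc n) ≡ n
    total = trans (cong (δ g) (sym lenl))
        (trans (δ-lookup0 l) (trans (sum-++ (replicate m 0) c) (trans (cong₂ _+_ (sum-rep0 m) sumc) refl)))
    gap≤p : ∀ k → k ≤ℕ n → g k ≤ℕ p
    gap≤p k _ = All-lookup0 l (AllP.++⁺ (AllP.replicate⁺ m (z≤n {p})) ap) z≤n k
      where
      import Data.List.Relation.Unary.All.Properties
    noDUU : ∀ k → suc k <ℕ n → 1 ≤ℕ g k → 1 ≤ℕ g (suc k)
    noDUU k lt g1 = pos-at (suc k) (ℕₚ.≤-trans (pos⇒m k g1) (ℕₚ.n≤1+n k)) (ℕₚ.<⇒≤ lt)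
    last : 1 ≤ℕ n → 1 ≤ℕ g n
    last n1 = pos-at n mn ℕₚ.≤-refl
      where
      lc1 : 1 ≤ℕ length rc
      lc1 = length-positive rc (proj₂ v) n1
      mn : m ≤ℕ n
      mn = ℕₚ.≤-trans (ℕₚ.∸-monoʳ-≤ (suc n) lc1) ℕₚ.≤-refl

  sumlow : ∀ g k d → (∀ j → k ≤ℕ j → j <ℕ k + d → 1 ≤ℕ g j) → δ g k + d ≤ℕ δ g (k + d)
  sumlow g k zero h = ℕₚ.≤-reflexive (trans (ℕₚ.+-identityʳ _) (cong (δ g) (sym (ℕₚ.+-identityʳ k))))
  sumlow g k (suc d) h = subst₂ _≤ℕ_ e1 e2 (ℕₚ.+-mono-≤ IH g1)
    where
    lt' : ∀ {j} → j <ℕ k + d → j <ℕ k + suc d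
    lt' lt = ℕₚ.<-trans lt (subst (k + d <ℕ_) (sym (ℕₚ.+-suc k d)) (ℕₚ.n<1+n (k + d)))
    IH : δ g k + d ≤ℕ δ g (k + d)
    IH = sumlow g k d (λ j kj lt → h j kj (lt' lt))
    g1 : 1 ≤ℕ g (k + d)
    g1 = h (k + d) (ℕₚ.m≤m+n k d) (subst (k + d <ℕ_) (sym (ℕₚ.+-suc k d)) (ℕₚ.n<1+n (k + d)))
    e1 : (δ g k + d) + 1 ≡ δ g k + suc d
    e1 = trans (ℕₚ.+-assoc (δ g k) d 1) (cong (δ g k +_) (ℕₚ.+-comm d 1))
    e2 : δ g (k + d) + g (k + d) ≡ δ g (k + suc d)
    e2 = trans (sym (δ-last g (k + d))) (cong (δ g) (sym (ℕₚ.+-suc k d)))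

  dy-from : ∀ {n g} → (∀ k → suc k <ℕ n → 1 ≤ℕ g k → 1 ≤ℕ g (suc k)) → δ g (suc n) ≡ n → (1 ≤ℕ n → 1 ≤ℕ g n) →
      ∀ k → 1 ≤ℕ k → k ≤ℕ n → δ g k <ℕ k
  dy-from {n} {g} d t lst k k1 kn with δ g k ℕ.≟ 0
  ... | yes e = subst (_<ℕ k) (sym e) k1
  ... | no ne = ℕₚ.+-cancelʳ-≤ (n ∸ k) (suc (δ g k)) k (ℕₚ.≤-trans
      (ℕₚ.≤-reflexive (sym (ℕₚ.+-suc (δ g k) (n ∸ k))))
      (ℕₚ.≤-trans tail-sum-bound (ℕₚ.≤-reflexive (sym (ℕₚ.m+[n∸m]≡n kn)))))
    where
    dpos : 1 ≤ℕ δ g k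
    dpos = ℕₚ.n≢0⇒n>0 ne
    allpos : ∀ j → k ≤ℕ j → j <ℕ k + suc (n ∸ k) → 1 ≤ℕ g j
    allpos j kj lt with j ℕ.<? n
    ... | yes jn = positive-persists d j jn (ℕₚ.≤-trans dpos (δ-mono g kj))
    ... | no njn = subst (λ z → 1 ≤ℕ g z) (sym (ℕₚ.≤-antisym jle (ℕₚ.≮⇒≥ njn))) (lst (ℕₚ.≤-trans k1 kn))
      where
      jle : j ≤ℕ n
      jle = ℕₚ.≤-pred (subst (j <ℕ_) (trans (ℕₚ.+-suc k (n ∸ k)) (cong suc (ℕₚ.m+[n∸m]≡n kn))) lt)
    tail-sum-bound : δ g k + suc (n ∸ k) ≤ℕ n
    tail-sum-bound = ℕₚ.≤-trans (sumlow g k (suc (n ∸ k)) allpos)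
        (ℕₚ.≤-reflexive (trans (cong (δ g) (trans (ℕₚ.+-suc k (n ∸ k)) (cong suc (ℕₚ.m+[n∸m]≡n kn)))) t))

  gapsOf-valid : ∀ {n rc} → IsComposition n rc → ValidGaps p n (gapsOf n rc)
  gapsOf-valid {n} {rc} v = record { dyck = dy-from noDUU total last ; total = total ; noDUU = noDUU ; gap≤p = gap≤p }
    where open GapsOf v

  Persistent : List ℕ → Set
  Persistent l = ∀ i → suc i <ℕ length l → 1 ≤ℕ lookup0 l i → 1 ≤ℕ lookup0 l (suc i)

  persistent-positive : ∀ x l → 1 ≤ℕ x → Persistent (x ∷ l) → All Pos (x ∷ l)
  persistent-positive x [] x1 ps = x1 ∷ []
  persistent-positive x (y ∷ l) x1 ps = x1 ∷ persistent-positive y l (ps 0 (s≤s (s≤s z≤n)) x1)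
      (λ i lt f → ps (suc i) (s≤s lt) f)

  persistent-shape : ∀ l → Persistent l → ∃ λ m → ∃ λ c → l ≡ replicate m 0 ++ c × All Pos c
  persistent-shape [] ps = 0 , [] , refl , []
  persistent-shape (zero ∷ l) ps with persistent-shape l (λ i lt f → ps (suc i) (s≤s lt) f)
  ... | m , c , refl , a = suc m , c , refl , a
  persistent-shape (suc x ∷ l) ps = 0 , suc x ∷ l , refl , persistent-positive (suc x) l (s≤s z≤n) ps

  All-tabulate≤ : ∀ {P : ℕ → Set} g n → (∀ i → i ≤ℕ n → P (g i)) → All P (tabulate≤ g n)
  All-tabulate≤ g zero h = h 0 z≤n ∷ []
  All-tabulate≤ g (suc n) h = h 0 z≤n ∷ All-tabulate≤ (λ i → g (suc i)) n (λ i le → h (suc i) (s≤s le))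

  valid⇒composition : ∀ {n g} → ValidGaps p n g → ∃ λ rc → IsComposition n rc × (∀ i → i ≤ℕ n → gapsOf n rc i ≡ g i)
  valid⇒composition {n} {g} vg with persistent-shape (tabulate≤ g n) pers
    where
    lastg : 1 ≤ℕ n → 1 ≤ℕ g n
    lastg n1 = ℕₚ.+-cancelˡ-≤ (δ g n) 1 (g n) (subst₂ _≤ℕ_ (ℕₚ.+-comm 1 (δ g n))
        (trans (sym (ValidGaps.total vg)) (δ-last g n)) (ValidGaps.dyck vg n n1 ℕₚ.≤-refl))
    pers : Persistent (tabulate≤ g n)
    pers i lt f = subst (1 ≤ℕ_) (sym (lookup0-tabulate≤ g n (suc i) sin))
        (step (subst (1 ≤ℕ_) (lookup0-tabulate≤ g n i (ℕₚ.≤-trans (ℕₚ.n≤1+n i) sin)) f))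
      where
      sin : suc i ≤ℕ n
      sin = ℕₚ.≤-pred (subst (suc i <ℕ_) (length-tabulate≤ g n) lt)
      step : 1 ≤ℕ g i → 1 ≤ℕ g (suc i)
      step gi with suc i ℕ.≟ n
      ... | yes refl = lastg (s≤s z≤n)
      ... | no ne = ValidGaps.noDUU vg i (ℕₚ.≤∧≢⇒< sin ne) gi
  ... | m , c , leq , apos = reverse c , (valid , sumeq) , agree
    where
    lenl : m + length c ≡ suc n
    lenl = trans (sym (trans (LP.length-++ (replicate m 0)) (cong (_+ length c) (LP.length-replicate m))))
        (trans (cong length (sym leq)) (length-tabulate≤ g n))
    allp : All (λ d → d ≤ℕ p) (tabulate≤ g n)
    allp = All-tabulate≤ g n (ValidGaps.gap≤p vg)
    allpc : All (λ d → d ≤ℕ p) c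
    allpc = AllP.++⁻ʳ (replicate m 0) (subst (All (λ d → d ≤ℕ p)) leq allp)
    valid : All Part (reverse c)
    valid = All-reverse (All.zipWith (λ (a , b) → a , b) (apos , allpc))
    sumeq : sum (reverse c) ≡ n
    sumeq = begin
      sum (reverse c)                                        ≡⟨ sum-reverse c ⟩
      sum c                                                  ≡⟨ cong (_+ sum c) (sym (sum-rep0 m)) ⟩
      sum (replicate m 0) + sum c                            ≡⟨ sym (sum-++ (replicate m 0) c) ⟩
      sum (replicate m 0 ++ c)                               ≡⟨ cong sum (sym leq) ⟩
      sum (tabulate≤ g n)                                    ≡⟨ sym (δ-lookup0 (tabulate≤ g n)) ⟩
      δ (lookup0 (tabulate≤ g n)) (length (tabulate≤ g n))   ≡⟨ cong (δ (lookup0 (tabulate≤ g n))) (length-tabulate≤ g n) ⟩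
      δ (lookup0 (tabulate≤ g n)) (suc n)                    ≡⟨ δ-cong (suc n) (λ i lt → lookup0-tabulate≤ g n i (ℕₚ.≤-pred lt)) ⟩
      δ g (suc n)                                            ≡⟨ ValidGaps.total vg ⟩
      n                                                      ∎
      where open ≡-Reasoning
    meq : suc n ∸ length (reverse c) ≡ m
    meq = trans (cong (suc n ∸_) (LP.length-reverse c))
        (trans (cong (_∸ length c) (sym lenl)) (ℕₚ.m+n∸n≡m m (length c)))
    agree : ∀ i → i ≤ℕ n → gapsOf n (reverse c) i ≡ g i
    agree i le = trans (cong₂ (λ a b → lookup0 (replicate a 0 ++ b) i) meq (LP.reverse-involutive c))
        (trans (cong (λ z → lookup0 z i) (sym leq)) (lookup0-tabulate≤ g n i le))

  zeros-++-cancel : ∀ m m' c c' → replicate m 0 ++ c ≡ replicate m' 0 ++ c' → All Pos c → All Pos c' → c ≡ c'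
  zeros-++-cancel zero zero c c' e _ _ = e
  zeros-++-cancel (suc m) (suc m') c c' e a a' = zeros-++-cancel m m' c c' (LP.∷-injectiveʳ e) a a'
  zeros-++-cancel zero (suc m') (x ∷ c) c' e (px ∷ _) _ = ⊥-elim
      (ℕₚ.<⇒≱ px (ℕₚ.≤-reflexive (LP.∷-injectiveˡ e)))
  zeros-++-cancel zero (suc m') [] c' () _ _
  zeros-++-cancel (suc m) zero c (x ∷ c') e _ (px ∷ _) = ⊥-elim
      (ℕₚ.<⇒≱ px (ℕₚ.≤-reflexive (LP.∷-injectiveˡ (sym e))))
  zeros-++-cancel (suc m) zero c [] () _ _

  gapsOf-injective : ∀ {n rc rc'} → IsComposition n rc → IsComposition n rc' →
      (∀ i → i ≤ℕ n → gapsOf n rc i ≡ gapsOf n rc' i) → rc ≡ rc'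
  gapsOf-injective {n} {rc} {rc'} v v' h = trans (sym (LP.reverse-involutive rc))
      (trans (cong reverse ceq) (LP.reverse-involutive rc'))
    where
    module A = GapsOf v
    module B = GapsOf v'
    leq : A.l ≡ B.l
    leq = lookup0-ext A.l B.l (trans A.lenl (sym B.lenl)) (λ i lt → h i (ℕₚ.≤-pred (subst (i <ℕ_) A.lenl lt)))
    ceq : reverse rc ≡ reverse rc'
    ceq = zeros-++-cancel A.m B.m A.c B.c leq A.apos B.apos

module CompositionCovers (p : ℕ) where

  open Counting
  open Gaps
  open Compositions p
  open CompositionGaps p
  open Flips p using (flippableᵇ)
  open import Data.Nat using (ℕ; zero; suc; _+_; _≤ᵇ_) renaming (_≤_ to _≤ℕ_; _≡ᵇ_ to _=ℕ_)
  import Data.Nat.Properties as ℕₚ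
  open import Data.Bool using (Bool; true; false; _∧_; _∨_; not)
  open import Data.Bool.Properties using (∨-identityʳ)
  open import Data.List using (List; []; _∷_; _++_; length; replicate; reverse; upTo; applyUpTo)
  import Data.List.Properties as LP
  open import Data.List.Relation.Unary.All as All using (All; []; _∷_)
  open import Data.List.Membership.Propositional.Properties using (∈-upTo⁻)
  open import Data.Product using (proj₁)
  open import Relation.Binary.PropositionalEquality

  countᵇ-applyUpTo : ∀ (Q : ℕ → Bool) f n → countᵇ Q (applyUpTo f n) ≡ Σℕ n (λ j → toℕ (Q (f j)))
  countᵇ-applyUpTo Q f zero = refl
  countᵇ-applyUpTo Q f (suc n) = cong (toℕ (Q (f 0)) +_) (countᵇ-applyUpTo Q (λ i → f (suc i)) n)

  -- flippableᵇ with the test δ g j = 0 replaced by a flag recording an earlier nonzero run, so that the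
  -- count of flippable indices can be computed run by run.
  flippableAfter : Bool → (ℕ → ℕ) → ℕ → Bool
  flippableAfter s g j = (1 ≤ᵇ g j) ∧ (((2 ≤ᵇ g j) ∨ (not s ∧ (δ g j =ℕ 0))) ∧ (suc (g (suc j)) ≤ᵇ p))

  flippableRuns : Bool → ℕ → ℕ → Bool
  flippableRuns s a b = (1 ≤ᵇ a) ∧ (((2 ≤ᵇ a) ∨ (not s ∧ true)) ∧ (suc b ≤ᵇ p))

  #flipsAfter : Bool → List ℕ → ℕ
  #flipsAfter s [] = 0
  #flipsAfter s (a ∷ []) = 0
  #flipsAfter s (a ∷ b ∷ l) = toℕ (flippableRuns s a b) + #flipsAfter (s ∨ not (a =ℕ 0)) (b ∷ l)

  +≡ᵇ0 : ∀ a b → ((a + b) =ℕ 0) ≡ ((a =ℕ 0) ∧ (b =ℕ 0))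
  +≡ᵇ0 zero b = refl
  +≡ᵇ0 (suc a) b = refl

  flippableAfter-suc : ∀ s g j → flippableAfter s g (suc j) ≡ flippableAfter (s ∨ not (g 0 =ℕ 0)) (λ i → g (suc i)) j
  flippableAfter-suc s g j rewrite +≡ᵇ0 (g 0) (δ (λ i → g (suc i)) j) with g 0 =ℕ 0
  flippableAfter-suc true g j | true = refl
  flippableAfter-suc false g j | true = refl
  flippableAfter-suc true g j | false = refl
  flippableAfter-suc false g j | false = refl

  Σ-flippableAfter : ∀ s x l → Σℕ (length l) (λ j → toℕ (flippableAfter s (lookup0 (x ∷ l)) j)) ≡ #flipsAfter s (x ∷ l)
  Σ-flippableAfter s x [] = refl
  Σ-flippableAfter s x (y ∷ l) = cong (toℕ (flippableRuns s x y) +_) (trans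
      (Σℕ-cong (length l) (λ j → cong toℕ (flippableAfter-suc s (lookup0 (x ∷ y ∷ l)) j)))
      (Σ-flippableAfter (s ∨ not (x =ℕ 0)) y l))

  #flipsAfter-0∷ : ∀ r → #flipsAfter false (0 ∷ r) ≡ #flipsAfter false r
  #flipsAfter-0∷ [] = refl
  #flipsAfter-0∷ (y ∷ r) = refl

  #flipsAfter-zeros : ∀ m c → #flipsAfter false (replicate m 0 ++ c) ≡ #flipsAfter false c
  #flipsAfter-zeros zero c = refl
  #flipsAfter-zeros (suc m) c = trans (#flipsAfter-0∷ (replicate m 0 ++ c)) (#flipsAfter-zeros m c)

  seenNonzero : Bool → List ℕ → Bool
  seenNonzero s [] = s
  seenNonzero s (a ∷ l) = seenNonzero (s ∨ not (a =ℕ 0)) l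

  #flipsAfter-∷ʳ : ∀ s l x d → #flipsAfter s (l ++ x ∷ d ∷ [])
      ≡ #flipsAfter s (l ++ x ∷ []) + toℕ (flippableRuns (seenNonzero s l) x d)
  #flipsAfter-∷ʳ s [] x d = trans (ℕₚ.+-identityʳ _) refl
  #flipsAfter-∷ʳ s (a ∷ []) x d = trans (cong (toℕ (flippableRuns s a x) +_) (ℕₚ.+-identityʳ _))
      (cong (_+ toℕ (flippableRuns (seenNonzero (s ∨ not (a =ℕ 0)) []) x d)) (sym (ℕₚ.+-identityʳ _)))
  #flipsAfter-∷ʳ s (a ∷ b ∷ l) x d = trans
      (cong (toℕ (flippableRuns s a b) +_) (#flipsAfter-∷ʳ (s ∨ not (a =ℕ 0)) (b ∷ l) x d))
      (sym (ℕₚ.+-assoc (toℕ (flippableRuns s a b)) _ _))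

  seenNonzero-positive : ∀ s l → All Pos l → seenNonzero s l ≡ (s ∨ not (isNil l))
  seenNonzero-positive s [] [] = sym (∨-identityʳ s)
  seenNonzero-positive s (suc a ∷ l) (_ ∷ ap) = trans (seenNonzero-positive (s ∨ true) l ap) (tr s (not (isNil l)))
    where
    tr : ∀ s b → ((s ∨ true) ∨ b) ≡ (s ∨ true)
    tr true b = refl
    tr false b = refl

  isNil-reverse : ∀ l → isNil (reverse l) ≡ isNil l
  isNil-reverse [] = refl
  isNil-reverse (x ∷ l) = trans (cong isNil (LP.unfold-reverse x l)) (nn (reverse l))
    where
    nn : ∀ r → isNil (r ++ x ∷ []) ≡ false
    nn [] = refl
    nn (y ∷ r) = refl

  flippableRuns≡newCover : ∀ x rc d → 1 ≤ℕ x → flippableRuns (not (isNil rc)) x d ≡ newCover d (x ∷ rc)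
  flippableRuns≡newCover (suc zero) [] d _ = refl
  flippableRuns≡newCover (suc (suc x)) [] d _ = refl
  flippableRuns≡newCover (suc zero) (y ∷ r) d _ = refl
  flippableRuns≡newCover (suc (suc x)) (y ∷ r) d _ = refl

  #flipsAfter-reverse : ∀ rc → All Pos rc → #flipsAfter false (reverse rc) ≡ #covers rc
  #flipsAfter-reverse [] _ = refl
  #flipsAfter-reverse (d ∷ []) _ = refl
  #flipsAfter-reverse (d ∷ x ∷ rc) (_ ∷ px ∷ ap) = begin
      #flipsAfter false (reverse (d ∷ x ∷ rc))
    ≡⟨ cong (#flipsAfter false) (revs d x rc) ⟩
      #flipsAfter false (reverse rc ++ x ∷ d ∷ [])
    ≡⟨ #flipsAfter-∷ʳ false (reverse rc) x d ⟩
      #flipsAfter false (reverse rc ++ x ∷ []) + toℕ (flippableRuns (seenNonzero false (reverse rc)) x d)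
    ≡⟨ cong₂ _+_ (trans (cong (#flipsAfter false) (sym (LP.unfold-reverse x rc)))
        (#flipsAfter-reverse (x ∷ rc) (px ∷ ap))) (cong toℕ okeq) ⟩
      #covers (x ∷ rc) + toℕ (newCover d (x ∷ rc))
    ≡⟨ ℕₚ.+-comm (#covers (x ∷ rc)) _ ⟩
      #covers (d ∷ x ∷ rc)
    ∎ where
    open ≡-Reasoning
    revs : ∀ d x rc → reverse (d ∷ x ∷ rc) ≡ reverse rc ++ x ∷ d ∷ []
    revs d x rc = trans (LP.unfold-reverse d (x ∷ rc))
        (trans (cong (_++ d ∷ []) (LP.unfold-reverse x rc)) (LP.++-assoc (reverse rc) (x ∷ []) (d ∷ [])))
    seen≡ : seenNonzero false (reverse rc) ≡ not (isNil rc)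
    seen≡ = trans (seenNonzero-positive false (reverse rc) (All-reverse ap)) (cong not (isNil-reverse rc))
    okeq : flippableRuns (seenNonzero false (reverse rc)) x d ≡ newCover d (x ∷ rc)
    okeq = trans (cong (λ f → flippableRuns f x d) seen≡) (flippableRuns≡newCover x rc d px)

  Σ-flippableAfter-length : ∀ s l n → length l ≡ suc n → Σℕ n (λ j → toℕ (flippableAfter s (lookup0 l) j)) ≡
      #flipsAfter s l
  Σ-flippableAfter-length s (x ∷ l) n e = subst
      (λ m → Σℕ m (λ j → toℕ (flippableAfter s (lookup0 (x ∷ l)) j)) ≡ #flipsAfter s (x ∷ l))
      (ℕₚ.suc-injective e) (Σ-flippableAfter s x l)

  #flippable-gapsOf : ∀ {n rc} → IsComposition n rc → countᵇ (flippableᵇ (gapsOf n rc)) (upTo n) ≡ #covers rc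
  #flippable-gapsOf {n} {rc} v = begin
      countᵇ (flippableᵇ (gapsOf n rc)) (upTo n)
    ≡⟨ countᵇ-applyUpTo (flippableᵇ (gapsOf n rc)) (λ i → i) n ⟩
      Σℕ n (λ j → toℕ (flippableAfter false (lookup0 l) j))
    ≡⟨ Σ-flippableAfter-length false l n lenl ⟩
      #flipsAfter false l
    ≡⟨ #flipsAfter-zeros m c ⟩
      #flipsAfter false (reverse rc)
    ≡⟨ #flipsAfter-reverse rc (All.map proj₁ (proj₁ v)) ⟩
      #covers rc
    ∎ where
    open ≡-Reasoning
    open GapsOf v

  #flippable-cong : ∀ n (g g' : ℕ → ℕ) → (∀ i → i ≤ℕ n → g i ≡ g' i) →
      countᵇ (flippableᵇ g) (upTo n) ≡ countᵇ (flippableᵇ g') (upTo n)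
  #flippable-cong n g g' e = countᵇ-cong-∈ (upTo n) (λ {j} m → pt j (∈-upTo⁻ m))
    where
    okN : ℕ → ℕ → ℕ → Bool
    okN a b dd = (1 ≤ᵇ a) ∧ (((2 ≤ᵇ a) ∨ (dd =ℕ 0)) ∧ (suc b ≤ᵇ p))
    pt : ∀ j → suc j ≤ℕ n → flippableᵇ g j ≡ flippableᵇ g' j
    pt j lt = trans (cong (λ a → okN a (g (suc j)) (δ g j)) (e j (ℕₚ.≤-trans (ℕₚ.n≤1+n j) lt)))
             (trans (cong (λ b → okN (g' j) b (δ g j)) (e (suc j) lt))
             (cong (λ dd → okN (g' j) (g' (suc j)) dd)
                 (δ-cong j (λ i il → e i (ℕₚ.≤-trans (ℕₚ.<⇒≤ il) (ℕₚ.≤-trans (ℕₚ.n≤1+n j) lt))))))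

module ClassCounts (q : ℕ) where

  open Counting
  open import Data.Nat using (ℕ; zero; suc; _∸_; _≤ᵇ_; _<ᵇ_; _+_) renaming (_≡ᵇ_ to _==ℕ_)
  import Data.Nat.Properties as ℕₚ
  open import Data.Bool using (Bool; true; false; _∧_; not; if_then_else_)
  open import Data.List using (List; []; _∷_)
  open import Data.Bool.Properties using (∧-identityʳ; ∧-zeroʳ)
  open import Relation.Binary.PropositionalEquality

  p : ℕ
  p = suc (suc q)

  open Compositions p

  Ec : ℕ → ℕ → ℕ
  Ec m k = countComp m (λ c → isE c ∧ (#covers c ==ℕ k))

  Ic : ℕ → ℕ → ℕ
  Ic m k = countComp m (λ c → isI c ∧ (#covers c ==ℕ k))

  unitℕ : ℕ → ℕ → ℕ
  unitℕ zero zero = 1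
  unitℕ _ _ = 0

  shiftYℕ : (ℕ → ℕ → ℕ) → ℕ → ℕ → ℕ
  shiftYℕ H m zero = 0
  shiftYℕ H m (suc k) = H m k

  countComp-nil : ∀ m k → countComp m (λ c → isNil c ∧ (#covers c ==ℕ k)) ≡ unitℕ m k
  countComp-nil zero zero = refl
  countComp-nil zero (suc k) = refl
  countComp-nil (suc m) k = trans (countComp-suc m Q) (Σℕ-zero p (λ t → z t))
    where
    Q : List ℕ → Bool
    Q c = isNil c ∧ (#covers c ==ℕ k)
    z : ∀ t → (if t ≤ᵇ m then countComp (m ∸ t) (λ x → Q (suc t ∷ x)) else 0) ≡ 0
    z t with t ≤ᵇ m
    ... | true = countᵇ-none (λ x → Q (suc t ∷ x)) (compositions (m ∸ t)) (λ x → refl)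
    ... | false = refl

  countComp-shiftY : ∀ m k → countComp m (λ c → isE c ∧ (suc (#covers c) ==ℕ k)) ≡ shiftYℕ Ec m k
  countComp-shiftY m zero = countᵇ-none _ (compositions m) (λ c → ∧-zeroʳ (isE c))
  countComp-shiftY m (suc k) = refl

  Ac-classes : ∀ m k → Ac m k ≡ unitℕ m k + (Ec m k + Ic m k)
  Ac-classes m k = begin
      countComp m Q
    ≡⟨ countᵇ-split Q isNil (compositions m) ⟩
      countComp m (λ c → Q c ∧ isNil c) + countComp m (λ c → Q c ∧ not (isNil c))
    ≡⟨ cong (countComp m (λ c → Q c ∧ isNil c) +_) (countᵇ-split (λ c → Q c ∧ not (isNil c)) isE (compositions m)) ⟩
      countComp m (λ c → Q c ∧ isNil c) + (countComp m (λ c → (Q c ∧ not (isNil c)) ∧ isE c) + countComp m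
          (λ c → (Q c ∧ not (isNil c)) ∧ not (isE c)))
    ≡⟨ cong₂ _+_ (trans (countᵇ-cong (compositions m) nilCase) (countComp-nil m k))
        (cong₂ _+_ (countᵇ-cong (compositions m) classE) (countᵇ-cong (compositions m) classI)) ⟩
      unitℕ m k + (Ec m k + Ic m k)
    ∎ where
    open ≡-Reasoning
    Q : List ℕ → Bool
    Q c = #covers c ==ℕ k
    nilCase : ∀ c → (Q c ∧ isNil c) ≡ (isNil c ∧ Q c)
    nilCase [] = ∧-identityʳ (Q [])
    nilCase (x ∷ c) = ∧-zeroʳ (Q (x ∷ c))
    classE : ∀ c → ((Q c ∧ not (isNil c)) ∧ isE c) ≡ (isE c ∧ Q c)
    classE [] = ∧-zeroʳ _
    classE (x ∷ c) with Q (x ∷ c) | isE (x ∷ c)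
    ... | true | true = refl
    ... | true | false = refl
    ... | false | true = refl
    ... | false | false = refl
    classI : ∀ c → ((Q c ∧ not (isNil c)) ∧ not (isE c)) ≡ (isI c ∧ Q c)
    classI [] = trans (∧-identityʳ _) (∧-zeroʳ _)
    classI (x ∷ []) = ∧-zeroʳ _
    classI (x ∷ y ∷ c) with Q (x ∷ y ∷ c) | 2 ≤ᵇ x
    ... | true | true = refl
    ... | true | false = refl
    ... | false | true = refl
    ... | false | false = refl

  countComp-E-shift : ∀ m k v → countComp m (λ c → isE c ∧ ((toℕ v + #covers c) ==ℕ k)) ≡
      (if v then shiftYℕ Ec m k else Ec m k)
  countComp-E-shift m k true = countComp-shiftY m k
  countComp-E-shift m k false = refl

  afterPart : ℕ → ℕ → ℕ → ℕ
  afterPart t m k = unitℕ m k + (if 1 ≤ᵇ t then ((if suc t <ᵇ p then shiftYℕ Ec m k else Ec m k) + Ic m k) else 0)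

  afterPart-eval : ∀ t m k → countComp m (λ c → isE (suc t ∷ c) ∧ (#covers (suc t ∷ c) ==ℕ k)) ≡ afterPart t m k
  afterPart-eval t m k = begin
      countComp m P
    ≡⟨ countᵇ-split P isNil (compositions m) ⟩
      countComp m (λ c → P c ∧ isNil c) + countComp m (λ c → P c ∧ not (isNil c))
    ≡⟨ cong (countComp m (λ c → P c ∧ isNil c) +_) (countᵇ-split (λ c → P c ∧ not (isNil c)) isE (compositions m)) ⟩
      countComp m (λ c → P c ∧ isNil c) + (countComp m (λ c → (P c ∧ not (isNil c)) ∧ isE c) + countComp m
          (λ c → (P c ∧ not (isNil c)) ∧ not (isE c)))
    ≡⟨ cong₂ _+_ (trans (countᵇ-cong (compositions m) nilCase) (countComp-nil m k))
         (cong₂ _+_ (trans (countᵇ-cong (compositions m) classE) (countᵇ-const∧ (1 ≤ᵇ t) _ (compositions m)))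
             (trans (countᵇ-cong (compositions m) classI) (countᵇ-const∧ (1 ≤ᵇ t) _ (compositions m)))) ⟩
      unitℕ m k + ((if 1 ≤ᵇ t then countComp m (λ c → isE c ∧ ((toℕ (suc t <ᵇ p) + #covers c) ==ℕ k)) else 0)
          + (if 1 ≤ᵇ t then Ic m k else 0))
    ≡⟨ cong (unitℕ m k +_) (fin (1 ≤ᵇ t)) ⟩
      afterPart t m k
    ∎ where
    open ≡-Reasoning
    P : List ℕ → Bool
    P c = isE (suc t ∷ c) ∧ (#covers (suc t ∷ c) ==ℕ k)
    nilCase : ∀ c → (P c ∧ isNil c) ≡ (isNil c ∧ (#covers c ==ℕ k))
    nilCase [] = ∧-identityʳ _
    nilCase (x ∷ c) = ∧-zeroʳ _
    classE : ∀ c → ((P c ∧ not (isNil c)) ∧ isE c) ≡ ((1 ≤ᵇ t) ∧ (isE c ∧ ((toℕ (suc t <ᵇ p) + #covers c) ==ℕ k)))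
    classE [] = trans (∧-zeroʳ _) (sym (∧-zeroʳ (1 ≤ᵇ t)))
    classE (x ∷ c) with 1 ≤ᵇ t | isE (x ∷ c)
    ... | true | true = trans (∧-identityʳ _) (∧-identityʳ _)
    ... | true | false = ∧-zeroʳ _
    ... | false | q = refl
    classI : ∀ c → ((P c ∧ not (isNil c)) ∧ not (isE c)) ≡ ((1 ≤ᵇ t) ∧ (isI c ∧ (#covers c ==ℕ k)))
    classI [] = trans (∧-identityʳ _) (trans (∧-zeroʳ _) (sym (∧-zeroʳ (1 ≤ᵇ t))))
    classI (x ∷ []) = trans (∧-zeroʳ _) (sym (∧-zeroʳ (1 ≤ᵇ t)))
    classI (x ∷ y ∷ c) with 1 ≤ᵇ t | 2 ≤ᵇ x
    ... | true | true = ∧-zeroʳ _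
    ... | true | false = trans (∧-identityʳ _) (∧-identityʳ _)
    ... | false | q = refl
    fin : ∀ b → ((if b then countComp m (λ c → isE c ∧ ((toℕ (suc t <ᵇ p) + #covers c) ==ℕ k)) else 0) +
        (if b then Ic m k else 0))
                ≡ (if b then ((if suc t <ᵇ p then shiftYℕ Ec m k else Ec m k) + Ic m k) else 0)
    fin true = cong (_+ Ic m k) (countComp-E-shift m k (suc t <ᵇ p))
    fin false = refl

  Ec-suc : ∀ m k → Ec (suc m) k ≡ Σℕ p (λ t → if t ≤ᵇ m then afterPart t (m ∸ t) k else 0)
  Ec-suc m k = trans (countComp-suc m _) (Σℕ-cong p (λ t → h t))
    where
    h : ∀ t → (if t ≤ᵇ m then countComp (m ∸ t) (λ c → isE (suc t ∷ c) ∧ (#covers (suc t ∷ c) ==ℕ k)) else 0)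
        ≡ (if t ≤ᵇ m then afterPart t (m ∸ t) k else 0)
    h t with t ≤ᵇ m
    ... | true = afterPart-eval t (m ∸ t) k
    ... | false = refl

  Ic-suc : ∀ m k → Ic (suc m) k ≡ shiftYℕ Ec m k + Ic m k
  Ic-suc m k = begin
    Ic (suc m) k                                                      ≡⟨ countComp-suc m _ ⟩
    Σℕ p (λ t → if t ≤ᵇ m then countComp (m ∸ t) (P t) else 0)          ≡⟨ cong₂ _+_ t0 (Σℕ-zero (suc q) zt) ⟩
    (shiftYℕ Ec m k + Ic m k) + 0                                     ≡⟨ ℕₚ.+-identityʳ _ ⟩
    shiftYℕ Ec m k + Ic m k                                           ∎
    where
    open ≡-Reasoning
    P : ℕ → List ℕ → Bool
    P t c = isI (suc t ∷ c) ∧ (#covers (suc t ∷ c) ==ℕ k)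
    t0 : countComp m (P 0) ≡ shiftYℕ Ec m k + Ic m k
    t0 = begin
        countComp m (P 0)
      ≡⟨ countᵇ-split (P 0) isE (compositions m) ⟩
        countComp m (λ c → P 0 c ∧ isE c) + countComp m (λ c → P 0 c ∧ not (isE c))
      ≡⟨ cong₂ _+_ (trans (countᵇ-cong (compositions m) q1) (countComp-shiftY m k)) (countᵇ-cong (compositions m) q2) ⟩
        shiftYℕ Ec m k + Ic m k
      ∎ where
      q1 : ∀ c → (P 0 c ∧ isE c) ≡ (isE c ∧ (suc (#covers c) ==ℕ k))
      q1 [] = refl
      q1 (x ∷ c) with isE (x ∷ c)
      ... | true = ∧-identityʳ _
      ... | false = ∧-zeroʳ _
      q2 : ∀ c → (P 0 c ∧ not (isE c)) ≡ (isI c ∧ (#covers c ==ℕ k))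
      q2 [] = refl
      q2 (x ∷ []) = ∧-zeroʳ _
      q2 (x ∷ y ∷ c) with 2 ≤ᵇ x
      ... | true = ∧-zeroʳ _
      ... | false = ∧-identityʳ _
    zt : ∀ t → (if suc t ≤ᵇ m then countComp (m ∸ suc t) (P (suc t)) else 0) ≡ 0
    zt t with suc t ≤ᵇ m
    ... | true = countᵇ-none (P (suc t)) (compositions (m ∸ suc t)) nonI
      where
      nonI : ∀ c → P (suc t) c ≡ false
      nonI [] = refl
      nonI (x ∷ c) = refl
    ... | false = refl

module SeriesEquations (q : ℕ) where

  open Counting using (Σℕ)
  open IntegerSums
  open PowerSeries
  open RationalIdentity
  open import Data.Nat as ℕ using (ℕ; zero; suc; _∸_; s≤s; _≤ᵇ_; _<ᵇ_) renaming (_<_ to _<ℕ_)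
  import Data.Nat.Properties as ℕₚ
  open import Data.Integer using (ℤ; +_; 0ℤ; _+_)
  open import Data.Integer.Properties
  open import Data.Bool using (Bool; true; false; if_then_else_)
  open import Relation.Binary.PropositionalEquality

  p : ℕ
  p = suc (suc q)

  open Compositions p
  open ClassCounts q hiding (p)

  Eˢ Iˢ Aˢ : Ser
  Eˢ n k = + Ec n k
  Iˢ n k = + Ic n k
  Aˢ n k = + Ac n k

  Tˢ : Ser
  Tˢ = (𝕐 ⊛ Eˢ) ⊕ Iˢ

  unitℕ≋𝟙 : ∀ n k → + unitℕ n k ≡ 𝟙 n k
  unitℕ≋𝟙 zero zero = refl
  unitℕ≋𝟙 zero (suc k) = refl
  unitℕ≋𝟙 (suc n) k = refl

  Aˢ-classes : Aˢ ≋ ((𝟙 ⊕ Eˢ) ⊕ Iˢ)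
  Aˢ-classes n k = trans (cong +_ (Ac-classes n k)) (trans (sym (+-assoc (+ unitℕ n k) (Eˢ n k) (Iˢ n k)))
      (cong (λ z → (z + Eˢ n k) + Iˢ n k) (unitℕ≋𝟙 n k)))

  shiftYℕ≋shiftY : ∀ m k → + shiftYℕ Ec m k ≡ shiftY Eˢ m k
  shiftYℕ≋shiftY m zero = refl
  shiftYℕ≋shiftY m (suc k) = refl

  Tˢ-eval : ∀ m k → Tˢ m k ≡ + shiftYℕ Ec m k + Iˢ m k
  Tˢ-eval m k = cong (λ z → z + Iˢ m k) (trans (𝕐⊛≋shiftY Eˢ m k) (sym (shiftYℕ≋shiftY m k)))

  Iˢ-equation : Iˢ ≋ (𝕏 ⊛ Tˢ)
  Iˢ-equation n k = trans (go n) (sym (𝕏⊛≋shiftX Tˢ n k))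
    where
    go : ∀ n → Iˢ n k ≡ shiftX Tˢ n k
    go zero = refl
    go (suc m) = trans (cong +_ (Ic-suc m k)) (sym (Tˢ-eval m k))

  Sˢ Pˢ : Ser
  Sˢ = powerRange 1 p
  Pˢ = powerRange 2 q

  Sˢ-closed-form : ((𝟙 ⊖ 𝕏) ⊛ Sˢ) ≋ ((𝕏 ⊛ 𝟙) ⊖ (𝕏 ⊛ (𝕏 ^ˢ p)))
  Sˢ-closed-form = 𝟙⊖𝕏⊛powerRange 1 p

  Pˢ-closed-form : ((𝟙 ⊖ 𝕏) ⊛ Pˢ) ≋ ((𝕏 ⊛ (𝕏 ⊛ 𝟙)) ⊖ (𝕏 ^ˢ p))
  Pˢ-closed-form = 𝟙⊖𝕏⊛powerRange 2 q

  +Σℕ : ∀ c g → + Σℕ c g ≡ Σℤ c (λ t → + g t)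
  +Σℕ zero g = refl
  +Σℕ (suc c) g = cong (_+_ (+ g 0)) (+Σℕ c (λ i → g (suc i)))

  +if : ∀ (b : Bool) x → + (if b then x else 0) ≡ (if b then + x else 0ℤ)
  +if true x = refl
  +if false x = refl

  <ᵇ-irr : ∀ n → (n <ᵇ n) ≡ false
  <ᵇ-irr zero = refl
  <ᵇ-irr (suc n) = <ᵇ-irr n

  <⇒<ᵇ≡ : ∀ {m n} → m <ℕ n → (m <ᵇ n) ≡ true
  <⇒<ᵇ≡ {zero} {suc n} _ = refl
  <⇒<ᵇ≡ {suc m} {suc n} (s≤s lt) = <⇒<ᵇ≡ lt

  afterPartˢ : ℕ → Ser
  afterPartˢ t m k = + (if 1 ≤ᵇ t then ((if suc t <ᵇ p then shiftYℕ Ec m k else Ec m k) ℕ.+ Ic m k) else 0)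

  afterPart≋ : ∀ t → (λ m k → + afterPart t m k) ≋ (𝟙 ⊕ afterPartˢ t)
  afterPart≋ t m k = cong (λ z → z + afterPartˢ t m k) (unitℕ≋𝟙 m k)

  afterPartˢ-<p : ∀ t → t <ℕ q → afterPartˢ (suc t) ≋ Tˢ
  afterPartˢ-<p t lt m k rewrite <⇒<ᵇ≡ lt = sym (Tˢ-eval m k)

  afterPartˢ-p : afterPartˢ (suc q) ≋ (Eˢ ⊕ Iˢ)
  afterPartˢ-p m k rewrite <ᵇ-irr q = refl

  Eˢ-suc : ∀ m k → Eˢ (suc m) k ≡
    Σℤ p (λ t → shiftXⁿ t 𝟙 m k) + (Σℤ q (λ t → shiftXⁿ (suc t) Tˢ m k) + shiftXⁿ (suc q) (Eˢ ⊕ Iˢ) m k)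
  Eˢ-suc m k = begin
      + Ec (suc m) k
    ≡⟨ cong +_ (Ec-suc m k) ⟩
      + Σℕ p (λ t → if t ≤ᵇ m then afterPart t (m ∸ t) k else 0)
    ≡⟨ +Σℕ p (λ t → if t ≤ᵇ m then afterPart t (m ∸ t) k else 0) ⟩
      Σℤ p (λ t → + (if t ≤ᵇ m then afterPart t (m ∸ t) k else 0))
    ≡⟨ Σℤ-cong p (λ t → trans (+if (t ≤ᵇ m) (afterPart t (m ∸ t) k))
        (sym (shiftXⁿ-eval t (λ m' k' → + afterPart t m' k') m k))) ⟩
      Σℤ p (λ t → shiftXⁿ t (λ m' k' → + afterPart t m' k') m k)
    ≡⟨ Σℤ-cong p (λ t → trans (shiftXⁿ-cong t (afterPart≋ t) m k) (shiftXⁿ-⊕ t 𝟙 (afterPartˢ t) m k)) ⟩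
      Σℤ p (λ t → shiftXⁿ t 𝟙 m k + shiftXⁿ t (afterPartˢ t) m k)
    ≡⟨ Σℤ-+ p (λ t → shiftXⁿ t 𝟙 m k) (λ t → shiftXⁿ t (afterPartˢ t) m k) ⟩
      Σℤ p (λ t → shiftXⁿ t 𝟙 m k) + Σℤ p (λ t → shiftXⁿ t (afterPartˢ t) m k)
    ≡⟨ cong (_+_ (Σℤ p (λ t → shiftXⁿ t 𝟙 m k))) indsum ⟩
      Σℤ p (λ t → shiftXⁿ t 𝟙 m k) + (Σℤ q (λ t → shiftXⁿ (suc t) Tˢ m k) + shiftXⁿ (suc q) (Eˢ ⊕ Iˢ) m k)
    ∎ where
    open ≡-Reasoning
    indsum : Σℤ p (λ t → shiftXⁿ t (afterPartˢ t) m k)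
        ≡ Σℤ q (λ t → shiftXⁿ (suc t) Tˢ m k) + shiftXⁿ (suc q) (Eˢ ⊕ Iˢ) m k
    indsum = begin
        afterPartˢ 0 m k + Σℤ (suc q) (λ t → shiftXⁿ (suc t) (afterPartˢ (suc t)) m k)
      ≡⟨ +-identityˡ _ ⟩
        Σℤ (suc q) (λ t → shiftXⁿ (suc t) (afterPartˢ (suc t)) m k)
      ≡⟨ Σℤ-last q (λ t → shiftXⁿ (suc t) (afterPartˢ (suc t)) m k) ⟩
        Σℤ q (λ t → shiftXⁿ (suc t) (afterPartˢ (suc t)) m k) + shiftXⁿ (suc q) (afterPartˢ (suc q)) m k
      ≡⟨ cong₂ _+_ (Σℤ-cong< q (λ t lt → shiftXⁿ-cong (suc t) (afterPartˢ-<p t lt) m k))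
          (shiftXⁿ-cong (suc q) afterPartˢ-p m k) ⟩
        Σℤ q (λ t → shiftXⁿ (suc t) Tˢ m k) + shiftXⁿ (suc q) (Eˢ ⊕ Iˢ) m k
      ∎

  Eˢ-equation : Eˢ ≋ ((Sˢ ⊕ (Pˢ ⊛ Tˢ)) ⊕ ((𝕏 ^ˢ p) ⊛ (Eˢ ⊕ Iˢ)))
  Eˢ-equation n k = trans (lhs n) (sym (trans (cong₂ _+_
      (cong₂ _+_ (trans (sym (⊛-identityʳ Sˢ n k)) (powerRange⊛ 1 p 𝟙 n k)) (powerRange⊛ 2 q Tˢ n k))
      (𝕏^⊛≋shiftXⁿ p (Eˢ ⊕ Iˢ) n k)) (rhs n)))
    where
    RHS : ℕ → ℤ
    RHS n = (Σℤ p (λ t → shiftXⁿ (1 ℕ.+ t) 𝟙 n k) + Σℤ q (λ t → shiftXⁿ (2 ℕ.+ t) Tˢ n k)) + shiftXⁿ p (Eˢ ⊕ Iˢ) n k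
    L : ℕ → ℤ
    L zero = 0ℤ
    L (suc m) = Σℤ p (λ t → shiftXⁿ t 𝟙 m k) + (Σℤ q (λ t → shiftXⁿ (suc t) Tˢ m k) + shiftXⁿ (suc q) (Eˢ ⊕ Iˢ) m k)
    rhs : ∀ n → RHS n ≡ L n
    rhs zero = trans (cong (λ z → z + 0ℤ) (cong₂ _+_ (Σℤ-zero p (λ t → refl)) (Σℤ-zero q (λ t → refl)))) refl
    rhs (suc m) = +-assoc (Σℤ p (λ t → shiftXⁿ t 𝟙 m k)) _ _
    lhs : ∀ n → Eˢ n k ≡ L n
    lhs zero = refl
    lhs (suc m) = Eˢ-suc m k

  Aˢ⊛Den≋Num : (Aˢ ⊛ Den p) ≋ Num p
  Aˢ⊛Den≋Num = ⊛Den≋Num p Eˢ Iˢ Aˢ Sˢ Pˢ Iˢ-equation Eˢ-equation Sˢ-closed-form Pˢ-closed-form Aˢ-classes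

module CoverCount (p : ℕ) (2≤p : 2 ≤ p) where

  open Counting
  open Words
  open Gaps
  open Flips p using (flippableᵇ)
  open UpperCovers p 2≤p
  open Compositions p
  open CompositionGaps p
  open CompositionCovers p
  open import Data.Nat using (ℕ; suc) renaming (_≡ᵇ_ to _==ℕ_)
  open import Data.Bool using (Bool)
  open import Data.List using (List; map; length; upTo)
  open import Data.List.Membership.Propositional using (_∈_)
  open import Data.List.Membership.Propositional.Properties using (∈-map⁺; ∈-map⁻)
  open import Data.List.Relation.Unary.Unique.Propositional using (Unique)
  open import Data.Product using (_,_)
  open import Relation.Binary.PropositionalEquality

  pathOf : ℕ → List ℕ → List Step
  pathOf n rc = toPath (gapsOf n rc) n

  pathOf-unique : ∀ n → Unique (map (pathOf n) (compositions n))
  pathOf-unique n = unique-map-injectiveOn (pathOf n) (compositions n) injective (compositions-unique n)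
    where
    injective : ∀ {x y} → x ∈ compositions n → y ∈ compositions n → pathOf n x ≡ pathOf n y → x ≡ y
    injective {x} {y} mx my e =
      gapsOf-injective (∈compositions⁻ n mx) (∈compositions⁻ n my) (toPath-injective n (gapsOf n x) (gapsOf n y) e)

  𝓕⊆pathOf : ∀ {n P} → P ∈ 𝓕 p n → P ∈ map (pathOf n) (compositions n)
  𝓕⊆pathOf {n} {P} mP with ∈𝓕⇒ValidGaps {n} {P} mP
  ... | vg , P≡ with valid⇒composition vg
  ... | rc , v , agree =
    subst (_∈ map (pathOf n) (compositions n)) (trans (toPath-cong n agree) P≡)
        (∈-map⁺ (pathOf n) (∈compositions⁺ n rc v))

  pathOf⊆𝓕 : ∀ {n P} → P ∈ map (pathOf n) (compositions n) → P ∈ 𝓕 p n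
  pathOf⊆𝓕 {n} m with ∈-map⁻ (pathOf n) m
  ... | rc , mrc , refl = ValidGaps⇒∈𝓕 (gapsOf-valid (∈compositions⁻ n mrc))

  #flippable-pathOf : ∀ {n rc} → rc ∈ compositions n →
    countᵇ (flippableᵇ (gaps (pathOf n rc))) (upTo n) ≡ #covers rc
  #flippable-pathOf {n} {rc} m =
    trans (#flippable-cong n (gaps (pathOf n rc)) (gapsOf n rc) (gaps-toPath (gapsOf n rc) n))
          (#flippable-gapsOf (∈compositions⁻ n m))

  a≡Ac : ∀ n k → a p n k ≡ Ac n k
  a≡Ac n k = begin
      a p n k
    ≡⟨ length-filterᵇ hasCovers (𝓕 p n) ⟩
      countᵇ hasCovers (𝓕 p n)
    ≡⟨ countᵇ-cong-∈ (𝓕 p n) (λ {P} mP → cong (_==ℕ k) (length-upperCovers {n} {P} mP)) ⟩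
      countᵇ hasFlips (𝓕 p n)
    ≡⟨ countᵇ-image hasFlips (𝓕 p n) (pathOf n) (compositions n)
         (𝓕-unique p n) (pathOf-unique n) (𝓕⊆pathOf {n}) (pathOf⊆𝓕 {n}) ⟩
      countᵇ (λ rc → hasFlips (pathOf n rc)) (compositions n)
    ≡⟨ countᵇ-cong-∈ (compositions n) (λ m → cong (_==ℕ k) (#flippable-pathOf {n} m)) ⟩
      Ac n k
    ∎
    where
    open ≡-Reasoning
    hasCovers hasFlips : List Step → Bool
    hasCovers P = length (upperCovers (𝓕 p n) P) ==ℕ k
    hasFlips P = countᵇ (flippableᵇ (gaps P)) (upTo n) ==ℕ k

open import Data.Nat using (suc; s≤s; z≤n)
open import Data.Integer using (+_)
open import Relation.Binary.PropositionalEquality using (cong)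
open PowerSeries using (_≋_; ≋-trans; ≋-refl; ⊛-cong)

theorem2p1 : (p : ℕ) → 2 ≤ p → (n k : ℕ) → (GF p ⊛ Den p) n k ≡ Num p n k
theorem2p1 p@(suc (suc q)) 2≤p@(s≤s (s≤s z≤n)) =
  ≋-trans (⊛-cong {GF p} {Aˢ} {Den p} {Den p} GF≋Aˢ ≋-refl) Aˢ⊛Den≋Num
  where
  open SeriesEquations q using (Aˢ; Aˢ⊛Den≋Num)
  GF≋Aˢ : GF p ≋ Aˢ
  GF≋Aˢ n k = cong +_ (CoverCount.a≡Ac p 2≤p n k)
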